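{- There is a (randomized, always correct) algorithm which, given as input any Proth number $N=2^e\cdot t+1$ (with $t$ odd and $2^e>t>0$), decides whether $N$ is prime, and whose expected running time and worst case running time are, respectively, $$\tilde{O}\big((t\log t+\log N)\log N\big)\qquad\text{and}\qquad \tilde{O}\big((t\log t+\log N)\log^2 N\big)$$ bit operations.
   Context: A Proth number is a positive integer of the form $N=2^e\cdot t+1$ with $t$ odd and $2^e>t>0$. Running time is counted in bit operations, with fast integer arithmetic (one multiplication or division modulo $N$ costs $\tilde O(\log N)$ bit operations). $f=\tilde O(g)$ means $f=O(g\cdot(\log g)^c)$ for some constant $c$. The algorithm may use random choices but always returns the correct answer; the expected running time on an input $N$ is the expectation over the algorithm's internal random choices, and the worst case running time is the maximum over those choices. No unproven hypothesis is assumed. -}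

module Defs where

open import Data.Integer using (+_)
open import Data.List using (List; []; _∷_; _++_)
open import Data.Nat
  using (ℕ; zero; suc; _+_; _∸_; _*_; _^_; _/_; _%_; _≤_; _<_; _⊔_; _≡ᵇ_)
open import Data.Nat.Divisibility using (_∣_)
open import Data.Nat.Logarithm using (⌊log₂_⌋)
open import Data.Nat.Primality using (Prime)
open import Data.Bool using (if_then_else_)
open import Data.Product using (_×_; ∃-syntax)
open import Data.Rational as ℚ using (ℚ; ½)
open import Data.Sum using (_⊎_)
open import Relation.Nullary using (¬_)
open import Relation.Binary.PropositionalEquality using (_≡_)

record ProthNumber : Set where
  field
    e t   : ℕ
    t-odd : ¬ (2 ∣ t)
    0<t   : 0 < t
    t<2^e : t < 2 ^ e

  value : ℕ
  value = 2 ^ e * t + 1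

open ProthNumber public using (t; value)

-- The machine model is a random access machine with logarithmic
-- (bit-length) costs, multiplication, division and fair coin tosses.
-- Programs are structured; they are finite syntax and do not depend on
-- the input.  Cells are named by the numbers x, y, z; `load x y` is
-- x := [y] and `store x y` is [x] := y.

Memory : Set
Memory = ℕ → ℕ

_[_↦_] : Memory → ℕ → ℕ → Memory
(μ [ x ↦ v ]) y = if x ≡ᵇ y then v else μ y

data Op : Set where
  add sub mul quo rem : Op

-- Subtraction is truncated; division by zero is totalised.
apply : Op → ℕ → ℕ → ℕ
apply add a b       = a + b
apply sub a b       = a ∸ b
apply mul a b       = a * b
apply quo a zero    = 0
apply quo a (suc b) = a / suc b
apply rem a zero    = a
apply rem a (suc b) = a % suc b

data Instruction : Set where
  const  : (x k : ℕ) → Instruction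
  arith  : Op → (x y z : ℕ) → Instruction
  load   : (x y : ℕ) → Instruction
  store  : (x y : ℕ) → Instruction
  toss   : (x : ℕ) → Instruction
  branch : (x : ℕ) (p q : List Instruction) → Instruction
  while  : (x : ℕ) (p : List Instruction) → Instruction

Program : Set
Program = List Instruction

bits : ℕ → ℕ
bits n = suc ⌊log₂ n ⌋

quasilinear : ℕ → ℕ
quasilinear n = n * bits n

-- Bit operations for one arithmetic instruction: linear for addition and
-- subtraction, and n log n on n-bit operands for fast multiplication and
-- division with remainder.
opCost : Op → ℕ → ℕ → ℕ
opCost add a b = bits a + bits b
opCost sub a b = bits a + bits b
opCost mul a b = quasilinear (bits a + bits b)
opCost quo a b = quasilinear (bits a + bits b)
opCost rem a b = quasilinear (bits a + bits b)

-- The instructions still to be executed, and the memory.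
record Configuration : Set where
  constructor ⟨_,_⟩
  field
    todo   : Program
    memory : Memory

data Transition : Set where
  halted  : Memory → Transition
  proceed : (cost : ℕ) → Configuration → Transition
  random  : (cost : ℕ) → Configuration → Configuration → Transition

next : Configuration → Transition
next ⟨ [] , μ ⟩ = halted μ
next ⟨ const x k ∷ r , μ ⟩ = proceed (bits k) ⟨ r , μ [ x ↦ k ] ⟩
next ⟨ arith o x y z ∷ r , μ ⟩ =
  proceed (opCost o (μ y) (μ z)) ⟨ r , μ [ x ↦ apply o (μ y) (μ z) ] ⟩
next ⟨ load x y ∷ r , μ ⟩ =
  proceed (bits (μ y) + bits (μ (μ y))) ⟨ r , μ [ x ↦ μ (μ y) ] ⟩
next ⟨ store x y ∷ r , μ ⟩ =
  proceed (bits (μ x) + bits (μ y)) ⟨ r , μ [ μ x ↦ μ y ] ⟩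
next ⟨ toss x ∷ r , μ ⟩ = random 1 ⟨ r , μ [ x ↦ 0 ] ⟩ ⟨ r , μ [ x ↦ 1 ] ⟩
next ⟨ branch x p q ∷ r , μ ⟩ with μ x
... | zero  = proceed 1 ⟨ q ++ r , μ ⟩
... | suc n = proceed (bits (suc n)) ⟨ p ++ r , μ ⟩
next ⟨ while x p ∷ r , μ ⟩ with μ x
... | zero  = proceed 1 ⟨ r , μ ⟩
... | suc n = proceed (bits (suc n)) ⟨ p ++ while x p ∷ r , μ ⟩

-- The complete execution tree, branching at coin tosses.  Being inductive,
-- it exists only if the program halts for every sequence of coin tosses,
-- and it is then determined by the starting configuration.
data Run : Transition → Set where
  halt  : ∀ {μ} → Run (halted μ)
  step  : ∀ {k c} → Run (next c) → Run (proceed k c)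
  split : ∀ {k c d} → Run (next c) → Run (next d) → Run (random k c d)

input : ℕ → Memory
input n = (λ _ → 0) [ 0 ↦ n ]

Execution : Program → ℕ → Set
Execution p n = Run (next ⟨ p , input n ⟩)

fromℕ : ℕ → ℚ
fromℕ n = + n ℚ./ 1

worstTime : ∀ {τ} → Run τ → ℕ
worstTime halt                = 0
worstTime (step {k} r)        = k + worstTime r
worstTime (split {k} r s)     = k + (worstTime r ⊔ worstTime s)

expectedTime : ∀ {τ} → Run τ → ℚ
expectedTime halt            = ℚ.0ℚ
expectedTime (step {k} r)    = fromℕ k ℚ.+ expectedTime r
expectedTime (split {k} r s) =
  fromℕ k ℚ.+ ½ ℚ.* (expectedTime r ℚ.+ expectedTime s)

AllOutcomes : (Memory → Set) → ∀ {τ} → Run τ → Set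
AllOutcomes P (halt {μ})  = P μ
AllOutcomes P (step r)    = AllOutcomes P r
AllOutcomes P (split r s) = AllOutcomes P r × AllOutcomes P s

-- The answer is left in cell 0: 1 for "prime", 0 for "not prime".
CorrectAnswer : ℕ → Memory → Set
CorrectAnswer n μ = (μ 0 ≡ 1 × Prime n) ⊎ (μ 0 ≡ 0 × ¬ Prime n)

-- f = O(g · (log g)ᶜ) for some c, as the Proth number tends to infinity.
-- Rounding logarithms down, here and in the bounds below, changes them only
-- by a constant factor, since ⌊log₂ n⌋ ≥ ½ log₂ n for every n ≥ 1.
infix 4 _∈Õ_
_∈Õ_ : (ProthNumber → ℚ) → (ProthNumber → ℕ) → Set
f ∈Õ g = ∃[ c ] ∃[ C ] ∃[ N₀ ] ((N : ProthNumber) → N₀ ≤ value N →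
  f N ℚ.≤ fromℕ (C * (g N * ⌊log₂ g N ⌋ ^ c)))

expectedBound worstBound : ProthNumber → ℕ
expectedBound N = (t N * ⌊log₂ t N ⌋ + ⌊log₂ value N ⌋) * ⌊log₂ value N ⌋
worstBound N    = (t N * ⌊log₂ t N ⌋ + ⌊log₂ value N ⌋) * ⌊log₂ value N ⌋ ^ 2

-- Let N = 2 ^ e * t + 1.  If x ^ (2 ^ (e - 1)) ≡ -1 modulo N, then 2 ^ e divides
-- p - 1 for every prime p ∣ N, so p > √N and N is prime.  The test climbs to such
-- an x by square roots: if (-β) ^ (2 ^ j) ≡ -1 and z² ≡ -β, then -z has the same
-- property with j + 1 in place of j.
--
-- For N prime the square roots are found deterministically.  Let a² = β.  The map
-- s ↦ (s + a) / (s - a) is injective and misses 1, so at most 2t + 1 residues s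
-- satisfy s² = β or (s + a) ^ 2t = (s - a) ^ 2t.  For any other s, consider
-- u + vX = (s + X) ^ t modulo X² - β and its iterated squares.  The components
-- u ± va have orders dividing 2 ^ e and distinct squares, so some iterated square
-- w₀ + w₁X has components whose squares are opposite, that is, w₀² + βw₁² = 0,
-- and z = w₀ / w₁.  A step takes O(t log t + log N) multiplications modulo N.
--
-- The climb starts at the power x ^ t of a random x.  Let p be a prime divisor
-- of N and p - 1 = 2 ^ f * u with u odd.  The climb cannot pass the level f, and
-- a start i levels below f forces x ^ ((p - 1) / 2 ^ i) ≡ 1 modulo p, which has
-- probability O(2 ^ -i).  Hence the expected number of square root steps is
-- bounded by a constant, whether N is prime or not.
module Submission where

open import Defs

-- Acceptance rests on a verified certificate alone: each candidate root z enters the chain only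
-- after z² ≡ -β has been checked modulo N. The finite field arguments serve solely to show that a
-- failed search proves N composite.
--
-- Every search is therefore specified for arbitrary N as a disjunction, "all candidates fail or the
-- stored one passes", and primality enters only when a failure is interpreted. Likewise the ring
-- modulo X² - β is never constructed: an element is described by its values at all α with α² ≡ β,
-- and the proof for prime N evaluates at α = a and α = -a.
--
-- All coin tosses precede the test, so the expected time is an average, over 2 ^ (2E) samples, of
-- deterministic running times, where E is the exponent in N. This number is at least N, hence at
-- least p. Among the first M ≥ p integers at most 4M / 2 ^ i start i levels or more below f; adding
-- one step that may fail, the average number of steps is at most 1 + 4 = 5. In the worst case f <
-- 2E bounds it.

-- Congruences of integers and Fermat's little theorem

module Congruence where

  open import Data.Integer using (ℤ; +_; _+_; _*_; _-_; -_; _^_; 0ℤ; 1ℤ; -1ℤ; ∣_∣)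
  import Data.Integer.Properties as ℤ
  import Data.Integer.DivMod as ℤ
  open import Data.Integer.Divisibility.Signed using (divides; ∣ᵤ⇒∣; ∣⇒∣ᵤ)
  open import Data.Integer.Tactic.RingSolver using (solve-∀)
  open import Data.Nat as ℕ using (ℕ; zero; suc; NonZero)
  import Data.Nat.Properties as ℕ
  open import Data.Nat.Divisibility as ℕ using (_∣_)
  open import Data.Nat.Primality using (Prime; euclidsLemma; ¬prime[0]; ¬prime[1]; prime⇒nonZero)
  open import Data.Nat.Combinatorics using (_C_; nCk≡n!/k![n-k]!; k![n∸k]!∣n!; nCn≡1)
  open import Data.Nat.Base using (_!)
  open import Data.Nat.DivMod using (m/n*n≡m)
  import Data.Nat.DivMod as ℕ
  open import Data.Empty using (⊥-elim)
  open import Data.Product using (_,_)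
  open import Data.Sum using (_⊎_; inj₁; inj₂; [_,_]′)
  open import Data.Fin as Fin using (Fin; toℕ; inject₁)
  import Data.Fin.Properties as Fin
  open import Algebra.Properties.CommutativeSemiring.Binomial ℤ.+-*-commutativeSemiring
    using () renaming (theorem to binomialTheorem)
  open import Algebra.Properties.Semiring.Binomial ℤ.+-*-semiring using (binomialTerm)
  open import Algebra.Properties.Semiring.Exp ℤ.+-*-semiring using () renaming (_^_ to _^ₛ_)
  open import Algebra.Properties.Semiring.Mult ℤ.+-*-semiring using () renaming (_×_ to _×ₛ_)
  open import Algebra.Properties.Semiring.Sum ℤ.+-*-semiring using (sum; sum-init-last)
  open import Data.Vec.Functional using (Vector; init; last; tail)
  open import Relation.Nullary using (¬_; Dec; contradiction)
  open import Relation.Nullary.Decidable using (map′)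
  open import Relation.Binary.PropositionalEquality

  infix 4 _≈_[_] _≉_[_] _≈?_[_]

  record _≈_[_] (x y : ℤ) (n : ℕ) : Set where
    constructor cong-by
    field
      quotient : ℤ
      equality : x ≡ y + quotient * + n

  _≉_[_] : ℤ → ℤ → ℕ → Set
  x ≉ y [ n ] = ¬ x ≈ y [ n ]

  private variable
    n p : ℕ
    x y z u v a b c d : ℤ

  ≈-reflexive : x ≡ y → x ≈ y [ n ]
  ≈-reflexive {x} {n = n} refl = cong-by 0ℤ (lemma x (+ n))
    where
    lemma : ∀ x n → x ≡ x + 0ℤ * n
    lemma = solve-∀

  ≈-refl : x ≈ x [ n ]
  ≈-refl = ≈-reflexive refl

  -- Every congruence below follows from others by exhibiting the difference
  -- of its sides as an explicit combination of known differences.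
  combine : ∀ u → a ≈ b [ n ] → x ≡ y + u * (a - b) → x ≈ y [ n ]
  combine {a} {b} {n} {x} {y} u (cong-by q refl) eq = cong-by (u * q) (trans eq (lemma y u b q (+ n)))
    where
    lemma : ∀ y u b q n → y + u * (b + q * n - b) ≡ y + u * q * n
    lemma = solve-∀

  combine₂ : ∀ u v → a ≈ b [ n ] → c ≈ d [ n ] → x ≡ y + (u * (a - b) + v * (c - d)) → x ≈ y [ n ]
  combine₂ {a} {b} {n} {c} {d} {x} {y} u v (cong-by q refl) (cong-by r refl) eq =
    cong-by (u * q + v * r) (trans eq (lemma y u b q v d r (+ n)))
    where
    lemma : ∀ y u b q v d r n → y + (u * (b + q * n - b) + v * (d + r * n - d)) ≡ y + (u * q + v * r) * n
    lemma = solve-∀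

  ≈-sym : x ≈ y [ n ] → y ≈ x [ n ]
  ≈-sym {x} {y} h = combine -1ℤ h (lemma x y)
    where
    lemma : ∀ x y → y ≡ x + -1ℤ * (x - y)
    lemma = solve-∀

  ≈-trans : x ≈ y [ n ] → y ≈ z [ n ] → x ≈ z [ n ]
  ≈-trans {x} {y} {z = z} h k = combine₂ 1ℤ 1ℤ h k (lemma x y z)
    where
    lemma : ∀ x y z → x ≡ z + (1ℤ * (x - y) + 1ℤ * (y - z))
    lemma = solve-∀

  +-cong : x ≈ y [ n ] → u ≈ v [ n ] → x + u ≈ y + v [ n ]
  +-cong {x} {y} {u = u} {v} h k = combine₂ 1ℤ 1ℤ h k (lemma x y u v)
    where
    lemma : ∀ x y u v → x + u ≡ y + v + (1ℤ * (x - y) + 1ℤ * (u - v))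
    lemma = solve-∀

  *-cong : x ≈ y [ n ] → u ≈ v [ n ] → x * u ≈ y * v [ n ]
  *-cong {x} {y} {u = u} {v} h k = combine₂ u y h k (lemma x y u v)
    where
    lemma : ∀ x y u v → x * u ≡ y * v + (u * (x - y) + y * (u - v))
    lemma = solve-∀

  -‿cong : x ≈ y [ n ] → - x ≈ - y [ n ]
  -‿cong {x} {y} h = combine -1ℤ h (lemma x y)
    where
    lemma : ∀ x y → - x ≡ - y + -1ℤ * (x - y)
    lemma = solve-∀

  ^-cong : ∀ k → x ≈ y [ n ] → x ^ k ≈ y ^ k [ n ]
  ^-cong zero    h = ≈-refl
  ^-cong (suc k) h = *-cong h (^-cong k h)

  ≈⇒∣ : x ≈ y [ n ] → n ∣ ∣ x - y ∣
  ≈⇒∣ {y = y} {n} (cong-by q refl) = ∣⇒∣ᵤ (divides q (lemma y q (+ n)))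
    where
    lemma : ∀ y q n → y + q * n - y ≡ q * n
    lemma = solve-∀

  ∣⇒≈ : n ∣ ∣ x - y ∣ → x ≈ y [ n ]
  ∣⇒≈ {n} {x} {y} h with ∣ᵤ⇒∣ {+ n} {x - y} h
  ... | divides q eq = cong-by q (trans (lemma x y) (cong (λ w → y + w) eq))
    where
    lemma : ∀ x y → x ≡ y + (x - y)
    lemma = solve-∀

  ≈0⇒∣ : x ≈ 0ℤ [ n ] → n ∣ ∣ x ∣
  ≈0⇒∣ {x} h = subst (λ z → _ ∣ ∣ z ∣) (ℤ.+-identityʳ x) (≈⇒∣ h)

  _≈?_[_] : ∀ x y n → Dec (x ≈ y [ n ])
  x ≈? y [ n ] = map′ ∣⇒≈ ≈⇒∣ (n ℕ.∣? ∣ x - y ∣)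

  ≈-weaken : p ∣ n → x ≈ y [ n ] → x ≈ y [ p ]
  ≈-weaken {p} {n} {x} {y} p∣n h = ∣⇒≈ (ℕ.∣-trans p∣n (≈⇒∣ h))

  small≈⇒≡ : ∀ {i j} → i ℕ.< n → j ℕ.< n → + i ≈ + j [ n ] → i ≡ j
  small≈⇒≡ {n} {i} {j} i<n j<n h with ∣ + i - + j ∣ in eq | ≈⇒∣ h
  ... | zero  | _  = ℤ.+-injective (ℤ.i-j≡0⇒i≡j (+ i) (+ j) (ℤ.∣i∣≡0⇒i≡0 eq))
  ... | suc k | dv = contradiction (ℕ.∣⇒≤ dv) (ℕ.<⇒≱ (ℕ.≤-<-trans k<i⊔j (ℕ.⊔-lub i<n j<n)))
    where
    k<i⊔j : suc k ℕ.≤ i ℕ.⊔ j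
    k<i⊔j = subst (ℕ._≤ i ℕ.⊔ j) (trans (cong ∣_∣ (sym (ℤ.m-n≡m⊖n i j))) eq) (ℤ.∣m⊝n∣≤m⊔n i j)

  ^-distrib-* : ∀ x y k → (x * y) ^ k ≡ x ^ k * y ^ k
  ^-distrib-* x y zero    = refl
  ^-distrib-* x y (suc k) = trans (cong (x * y *_) (^-distrib-* x y k)) (lemma x y (x ^ k) (y ^ k))
    where
    lemma : ∀ x y a b → x * y * (a * b) ≡ x * a * (y * b)
    lemma = solve-∀

  ^-comm : ∀ x j k → (x ^ j) ^ k ≡ (x ^ k) ^ j
  ^-comm x j k = trans (ℤ.^-*-assoc x j k) (trans (cong (x ^_) (ℕ.*-comm j k)) (sym (ℤ.^-*-assoc x k j)))

  ≈1⇒^≈1 : ∀ k → x ≈ 1ℤ [ n ] → x ^ k ≈ 1ℤ [ n ]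
  ≈1⇒^≈1 k h = ≈-trans (^-cong k h) (≈-reflexive (ℤ.^-zeroˡ k))

  module _ (pr : Prime p) where

    p≢1 : ¬ p ∣ 1
    p≢1 p∣1 with ℕ.∣1⇒≡1 p∣1
    ... | refl = ¬prime[1] pr

    1≉0 : 1ℤ ≉ 0ℤ [ p ]
    1≉0 h = p≢1 (≈0⇒∣ h)

    x*y≈0⇒x≈0⊎y≈0 : ∀ x y → x * y ≈ 0ℤ [ p ] → x ≈ 0ℤ [ p ] ⊎ y ≈ 0ℤ [ p ]
    x*y≈0⇒x≈0⊎y≈0 x y h
      with euclidsLemma ∣ x ∣ ∣ y ∣ pr (subst (p ∣_) (ℤ.abs-* x y) (≈0⇒∣ h))
    ... | inj₁ d = inj₁ (∣⇒≈ (subst (λ z → p ∣ ∣ z ∣) (sym (ℤ.+-identityʳ x)) d))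
    ... | inj₂ d = inj₂ (∣⇒≈ (subst (λ z → p ∣ ∣ z ∣) (sym (ℤ.+-identityʳ y)) d))

    *-≉0 : x ≉ 0ℤ [ p ] → y ≉ 0ℤ [ p ] → x * y ≉ 0ℤ [ p ]
    *-≉0 x≉0 y≉0 h = [ x≉0 , y≉0 ]′ (x*y≈0⇒x≈0⊎y≈0 _ _ h)

    ^-≉0 : ∀ k → x ≉ 0ℤ [ p ] → x ^ k ≉ 0ℤ [ p ]
    ^-≉0 zero    x≉0 = 1≉0
    ^-≉0 (suc k) x≉0 = *-≉0 x≉0 (^-≉0 k x≉0)

    power≈-1⇒≉0 : ∀ {x k} → 0 ℕ.< k → x ^ k ≈ -1ℤ [ p ] → x ≉ 0ℤ [ p ]
    power≈-1⇒≉0 {x} {suc k} _ h x≈0 = 1≉0 (combine₂ 1ℤ (- (x ^ k)) h x≈0 (lemma x (x ^ k)))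
      where
      lemma : ∀ x y → 1ℤ ≡ 0ℤ + (1ℤ * (x * y - -1ℤ) + - y * (x - 0ℤ))
      lemma = solve-∀

    *-cancelˡ-≈ : x ≉ 0ℤ [ p ] → x * y ≈ x * z [ p ] → y ≈ z [ p ]
    *-cancelˡ-≈ {x} {y} {z} x≉0 h =
      [ (λ x≈0 → contradiction x≈0 x≉0) , (λ d → combine 1ℤ d (lemma₂ y z)) ]′
        (x*y≈0⇒x≈0⊎y≈0 x (y - z) (combine 1ℤ h (lemma₁ x y z)))
      where
      lemma₁ : ∀ x y z → x * (y - z) ≡ 0ℤ + 1ℤ * (x * y - x * z)
      lemma₁ = solve-∀
      lemma₂ : ∀ y z → y ≡ z + 1ℤ * (y - z - 0ℤ)
      lemma₂ = solve-∀

    x²≈y²⇒x≈±y : x * x ≈ y * y [ p ] → x ≈ y [ p ] ⊎ x ≈ - y [ p ]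
    x²≈y²⇒x≈±y {x} {y} h =
      [ (λ d → inj₁ (combine 1ℤ d (lemma₂ x y))) , (λ d → inj₂ (combine 1ℤ d (lemma₃ x y))) ]′
        (x*y≈0⇒x≈0⊎y≈0 (x - y) (x + y) (combine 1ℤ h (lemma₁ x y)))
      where
      lemma₁ : ∀ x y → (x - y) * (x + y) ≡ 0ℤ + 1ℤ * (x * x - y * y)
      lemma₁ = solve-∀
      lemma₂ : ∀ x y → x ≡ y + 1ℤ * (x - y - 0ℤ)
      lemma₂ = solve-∀
      lemma₃ : ∀ x y → x ≡ - y + 1ℤ * (x + y - 0ℤ)
      lemma₃ = solve-∀

    p∤k! : ∀ k → k ℕ.< p → ¬ p ∣ k !
    p∤k! zero    _   d = p≢1 d
    p∤k! (suc k) k<p d with euclidsLemma (suc k) (k !) pr d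
    ... | inj₁ p∣k = contradiction (ℕ.∣⇒≤ p∣k) (ℕ.<⇒≱ k<p)
    ... | inj₂ p∣k! = p∤k! k (ℕ.<-trans (ℕ.n<1+n k) k<p) p∣k!

    p∣pCk : ∀ k → 0 ℕ.< k → k ℕ.< p → p ∣ p C k
    p∣pCk k 0<k k<p =
      [ (λ d → d) , (λ d → ⊥-elim ([ p∤k! k k<p , p∤k! (p ℕ.∸ k) p-k<p ]′ (euclidsLemma (k !) _ pr d))) ]′
        (euclidsLemma (p C k) (k ! ℕ.* (p ℕ.∸ k) !) pr (subst (p ∣_) (sym product) (p∣p! p (ℕ.<-trans 0<k k<p))))
      where
      instance
        nz : NonZero (k ! ℕ.* (p ℕ.∸ k) !)
        nz = k !* (p ℕ.∸ k) !≢0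
          where open import Data.Nat.Properties using (_!*_!≢0)
      p-k<p : p ℕ.∸ k ℕ.< p
      p-k<p = ℕ.∸-monoʳ-< 0<k (ℕ.<⇒≤ k<p)
      product : (p C k) ℕ.* (k ! ℕ.* (p ℕ.∸ k) !) ≡ p !
      product = trans (cong (λ c → c ℕ.* (k ! ℕ.* (p ℕ.∸ k) !)) (nCk≡n!/k![n-k]! (ℕ.<⇒≤ k<p))) (m/n*n≡m (k![n∸k]!∣n! (ℕ.<⇒≤ k<p)))
      p∣p! : ∀ m → 0 ℕ.< m → m ∣ m !
      p∣p! (suc m) _ = ℕ.m∣m*n (m !)

  ^ₛ≡^ : ∀ x k → x ^ₛ k ≡ x ^ k
  ^ₛ≡^ x zero    = refl
  ^ₛ≡^ x (suc k) = cong (x *_) (^ₛ≡^ x k)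

  ×ₛ≡* : ∀ k x → k ×ₛ x ≡ + k * x
  ×ₛ≡* zero    x = sym (ℤ.*-zeroˡ x)
  ×ₛ≡* (suc k) x = trans (cong (λ y → x + y) (×ₛ≡* k x)) (trans (lemma (+ k) x) (cong (_* x) (sym (ℤ.pos-+ 1 k))))
    where
    lemma : ∀ k x → x + k * x ≡ (1ℤ + k) * x
    lemma = solve-∀

  sum≈0 : ∀ {m} (t : Vector ℤ m) → (∀ i → t i ≈ 0ℤ [ n ]) → sum t ≈ 0ℤ [ n ]
  sum≈0 {m = zero}  t h = ≈-refl
  sum≈0 {m = suc m} t h = +-cong (h Fin.zero) (sum≈0 (tail t) (λ i → h (Fin.suc i)))

  freshman : Prime p → ∀ x → (x + 1ℤ) ^ p ≈ x ^ p + 1ℤ [ p ]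
  freshman {zero}  pr x = contradiction pr ¬prime[0]
  freshman {suc q} pr x = ≈-trans
    (≈-reflexive (trans (sym (^ₛ≡^ (x + 1ℤ) (suc q)))
      (trans (binomialTheorem (suc q) x 1ℤ) (cong (λ y → terms Fin.zero + y) (sum-init-last (tail terms))))))
    (≈-trans (+-cong (≈-reflexive first) (+-cong (sum≈0 (init (tail terms)) middle) (≈-reflexive final)))
      (≈-reflexive (lemma (x ^ suc q))))
    where
    terms : Vector ℤ (suc (suc q))
    terms = binomialTerm x 1ℤ (suc q)
    lemma : ∀ y → 1ℤ + (0ℤ + y) ≡ y + 1ℤ
    lemma = solve-∀
    1^ : ∀ k → 1ℤ ^ₛ k ≡ 1ℤ
    1^ k = trans (^ₛ≡^ 1ℤ k) (ℤ.^-zeroˡ k)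
    first : terms Fin.zero ≡ 1ℤ
    first = trans (×ₛ≡* 1 (1ℤ * 1ℤ ^ₛ suc q)) (cong (λ y → + 1 * (1ℤ * y)) (1^ (suc q)))
    final : last (tail terms) ≡ x ^ suc q
    final rewrite Fin.toℕ-fromℕ q | nCn≡1 (suc q) | ℕ.n∸n≡0 q =
      trans (×ₛ≡* 1 (x ^ₛ suc q * 1ℤ)) (trans (lemma′ (x ^ₛ suc q)) (^ₛ≡^ x (suc q)))
      where
      lemma′ : ∀ y → 1ℤ * (y * 1ℤ) ≡ y
      lemma′ = solve-∀
    middle : ∀ i → init (tail terms) i ≈ 0ℤ [ suc q ]
    middle i = ≈-trans (≈-reflexive (×ₛ≡* m r)) (≈-trans (*-cong m≈0 (≈-refl {r})) (≈-reflexive (ℤ.*-zeroˡ r)))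
      where
      m : ℕ
      m = suc q C toℕ (Fin.suc (inject₁ i))
      r : ℤ
      r = x ^ₛ toℕ (Fin.suc (inject₁ i)) * 1ℤ ^ₛ (suc q ℕ.∸ toℕ (Fin.suc (inject₁ i)))
      m≈0 : + m ≈ 0ℤ [ suc q ]
      m≈0 = ∣⇒≈ (subst (suc q ∣_) (sym (cong ∣_∣ (ℤ.+-identityʳ (+ m))))
        (p∣pCk pr _ (ℕ.s≤s ℕ.z≤n) (ℕ.s≤s (subst (ℕ._< q) (sym (Fin.toℕ-inject₁ i)) (Fin.toℕ<n i)))))

  ≈%ℕ : ∀ x n .{{_ : NonZero n}} → x ≈ + (x ℤ.%ℕ n) [ n ]
  ≈%ℕ x n = cong-by (x ℤ./ℕ n) (ℤ.a≡a%ℕn+[a/ℕn]*n x n)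

  fermat′ : Prime p → ∀ x → x ^ p ≈ x [ p ]
  fermat′ {p} pr x = ≈-trans (^-cong p (≈%ℕ x p)) (≈-trans (nat (x ℤ.%ℕ p)) (≈-sym (≈%ℕ x p)))
    where
    instance
      p≢0 : NonZero p
      p≢0 = prime⇒nonZero pr
    zero^ : ∀ k → 0 ℕ.< k → 0ℤ ^ k ≡ 0ℤ
    zero^ (suc k) _ = ℤ.*-zeroˡ (0ℤ ^ k)
    nat : ∀ a → (+ a) ^ p ≈ + a [ p ]
    nat zero    = ≈-reflexive (zero^ p (ℕ.>-nonZero⁻¹ p))
    nat (suc a) = subst (λ y → y ^ p ≈ y [ p ]) (trans (sym (ℤ.pos-+ a 1)) (cong +_ (ℕ.+-comm a 1)))
      (≈-trans (freshman pr (+ a)) (+-cong (nat a) ≈-refl))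

  fermat : Prime p → ∀ {x} → x ≉ 0ℤ [ p ] → x ^ (p ℕ.∸ 1) ≈ 1ℤ [ p ]
  fermat {zero}  pr x≉0 = contradiction pr ¬prime[0]
  fermat {suc q} pr {x} x≉0 = *-cancelˡ-≈ pr x≉0 (≈-trans (fermat′ pr x) (≈-reflexive (sym (ℤ.*-identityʳ x))))

-- Roots of polynomials modulo p, orders of elements, and the primality certificate

module NumberTheory where

  open Congruence
  open import Data.Integer using (ℤ; +_; _+_; _*_; _-_; -_; _^_; 0ℤ; 1ℤ; -1ℤ; ∣_∣)
  import Data.Integer.Properties as ℤ
  open import Data.Integer.Tactic.RingSolver using (solve-∀)
  open import Data.Nat as ℕ using (ℕ; zero; suc; NonZero)
  import Data.Nat.Properties as ℕ
  open import Data.Nat.Divisibility as ℕ using (_∣_; divides)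
  open import Data.Nat.Primality
  open import Data.Nat.Divisibility.Core using (hasNonTrivialDivisor)
  open import Data.Nat.Primality.Factorisation using (factorise)
  open import Data.Nat.Tactic.RingSolver using () renaming (solve-∀ to solveℕ-∀)

  open import Data.List using (List; []; _∷_; length; replicate; applyUpTo)
  open import Data.List.Properties using (length-replicate)
  open import Data.List.Relation.Unary.All as All using (All; []; _∷_)
  import Data.List.Relation.Unary.All.Properties as All
  open import Data.List.Relation.Unary.AllPairs as AllPairs using (AllPairs; []; _∷_)
  import Data.List.Relation.Unary.AllPairs.Properties as AllPairs
  open import Data.Product using (_×_; _,_; ∃-syntax)
  open import Data.Sum using (_⊎_; inj₁; inj₂; [_,_]′)
  open import Relation.Nullary using (¬_; yes; no; contradiction)

  open import Relation.Binary.PropositionalEquality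

  private variable
    p : ℕ

  -- The list of the lower coefficients of a monic polynomial, constant term first.
  ⟦_⟧ : List ℤ → ℤ → ℤ
  ⟦ [] ⟧    x = 1ℤ
  ⟦ c ∷ q ⟧ x = c + x * ⟦ q ⟧ x

  -- Horner's scheme: the coefficients of the quotient of `c ∷ q` by X - r are the values at r of
  -- the nonempty tails of `q`, with the leading 1 again implicit. This quotient is `deflate q r`.
  deflate : List ℤ → ℤ → List ℤ
  deflate []      r = []
  deflate (c ∷ q) r = ⟦ c ∷ q ⟧ r ∷ deflate q r

  length-deflate : ∀ q r → length (deflate q r) ≡ length q
  length-deflate []      r = refl
  length-deflate (c ∷ q) r = cong suc (length-deflate q r)

  deflate-correct : ∀ c q x r → ⟦ c ∷ q ⟧ x - ⟦ c ∷ q ⟧ r ≡ (x - r) * ⟦ deflate q r ⟧ x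
  deflate-correct c [] x r = lemma c x r
    where
    lemma : ∀ c x r → c + x * 1ℤ - (c + r * 1ℤ) ≡ (x - r) * 1ℤ
    lemma = solve-∀
  deflate-correct c (d ∷ q) x r = trans (lemma₁ c x r (⟦ d ∷ q ⟧ x) (⟦ d ∷ q ⟧ r))
    (trans (cong (λ y → x * y + (x - r) * ⟦ d ∷ q ⟧ r) (deflate-correct d q x r))
      (lemma₂ x r (⟦ d ∷ q ⟧ r) (⟦ deflate q r ⟧ x)))
    where
    lemma₁ : ∀ c x r u v → c + x * u - (c + r * v) ≡ x * (u - v) + (x - r) * v
    lemma₁ = solve-∀
    lemma₂ : ∀ x r v g → x * ((x - r) * g) + (x - r) * v ≡ (x - r) * (v + x * g)
    lemma₂ = solve-∀

  Distinct : ℕ → List ℤ → Set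
  Distinct p = AllPairs (λ x y → x ≉ y [ p ])

  lagrange : Prime p → ∀ q xs → Distinct p xs → All (λ x → ⟦ q ⟧ x ≈ 0ℤ [ p ]) xs → length xs ℕ.≤ length q
  lagrange pr q       []       _        _        = ℕ.z≤n
  lagrange pr []      (x ∷ xs) _        (r ∷ _)  = contradiction r (1≉0 pr)
  lagrange {p} pr (c ∷ q) (x ∷ xs) (d ∷ ds) (r ∷ rs) =
    ℕ.s≤s (subst (length xs ℕ.≤_) (length-deflate q x) (lagrange pr (deflate q x) xs ds (All.zipWith root (d , rs))))
    where
    root : ∀ {y} → x ≉ y [ p ] × ⟦ c ∷ q ⟧ y ≈ 0ℤ [ p ] → ⟦ deflate q x ⟧ y ≈ 0ℤ [ p ]
    root {y} (x≉y , h) =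
      [ (λ g → contradiction (combine -1ℤ g (lemma x y)) x≉y) , (λ g → g) ]′
        (x*y≈0⇒x≈0⊎y≈0 pr (y - x) (⟦ deflate q x ⟧ y)
          (≈-trans (≈-reflexive (sym (deflate-correct c q y x))) (+-cong h (-‿cong r))))
      where
      lemma : ∀ x y → x ≡ y + -1ℤ * (y - x - 0ℤ)
      lemma = solve-∀

  unityPoly : ℕ → List ℤ
  unityPoly d = -1ℤ ∷ replicate d 0ℤ

  eval-unityPoly : ∀ d x → ⟦ unityPoly d ⟧ x ≡ x ^ suc d - 1ℤ
  eval-unityPoly d x = trans (cong (λ y → -1ℤ + x * y) (power d)) (lemma (x ^ suc d))
    where
    lemma : ∀ y → -1ℤ + y ≡ y - 1ℤ
    lemma = solve-∀
    lemma₀ : ∀ y → 0ℤ + y ≡ y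
    lemma₀ = solve-∀
    power : ∀ d → ⟦ replicate d 0ℤ ⟧ x ≡ x ^ d
    power zero    = refl
    power (suc d) = trans (lemma₀ _) (cong (x *_) (power d))

  length-unityPoly : ∀ d → length (unityPoly d) ≡ suc d
  length-unityPoly d = cong suc (length-replicate d)

  ≈1⇒root : ∀ d x → x ^ suc d ≈ 1ℤ [ p ] → ⟦ unityPoly d ⟧ x ≈ 0ℤ [ p ]
  ≈1⇒root d x h = ≈-trans (≈-reflexive (eval-unityPoly d x)) (combine 1ℤ h (lemma (x ^ suc d)))
    where
    lemma : ∀ y → y - 1ℤ ≡ 0ℤ + 1ℤ * (y - 1ℤ)
    lemma = solve-∀

  1⋯ : ℕ → List ℤ
  1⋯ = applyUpTo (λ i → + suc i)

  1⋯-distinct : ∀ {m} → m ℕ.< p → Distinct p (1⋯ m)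
  1⋯-distinct {m = m} m<p = AllPairs.applyUpTo⁺₁ _ m λ i<j j<m h →
    ℕ.<⇒≢ i<j (ℕ.suc-injective (small≈⇒≡ (ℕ.<-trans (ℕ.s≤s i<j) (ℕ.≤-<-trans j<m m<p)) (ℕ.≤-<-trans j<m m<p) h))

  primeDivisor : ∀ n → 2 ℕ.≤ n → ∃[ p ] Prime p × p ∣ n
  primeDivisor n@(suc _) 2≤n with factorise n
  ... | record { factors = []     ; isFactorisation = eq } = contradiction (subst (2 ℕ.≤_) eq 2≤n) λ { (ℕ.s≤s ()) }
  ... | record { factors = q ∷ qs ; isFactorisation = eq ; factorsPrime = pr ∷ _ } =
    q , pr , subst (q ∣_) (sym eq) (ℕ.m∣m*n _)

  even⊎odd : ∀ k → 2 ∣ k ⊎ ∃[ m ] k ≡ suc (m ℕ.+ m)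
  even⊎odd zero = inj₁ (2 ℕ.∣0)
  even⊎odd (suc k) with even⊎odd k
  ... | inj₁ (divides m eq) = inj₂ (m , cong suc (trans eq (lemma m)))
    where
    lemma : ∀ m → m ℕ.* 2 ≡ m ℕ.+ m
    lemma = solveℕ-∀
  ... | inj₂ (m , eq) = inj₁ (divides (suc m) (trans (cong suc eq) (lemma m)))
    where
    lemma : ∀ m → suc (suc (m ℕ.+ m)) ≡ suc m ℕ.* 2
    lemma = solveℕ-∀

  -1^odd : ∀ {k} → ¬ 2 ∣ k → -1ℤ ^ k ≡ -1ℤ
  -1^odd {k} odd with even⊎odd k
  ... | inj₁ e = contradiction e odd
  ... | inj₂ (m , refl) = trans (cong (-1ℤ *_) (trans (ℤ.^-distribˡ-+-* -1ℤ m m) (square m))) refl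
    where
    square : ∀ m → -1ℤ ^ m * -1ℤ ^ m ≡ 1ℤ
    square m = trans (sym (^-distrib-* -1ℤ -1ℤ m)) (ℤ.^-zeroˡ m)

  ^2^suc : ∀ x k → x ^ (2 ℕ.^ suc k) ≡ x ^ (2 ℕ.^ k) * x ^ (2 ℕ.^ k)
  ^2^suc x k = trans (cong (x ^_) (cong (2 ℕ.^ k ℕ.+_) (ℕ.+-identityʳ _))) (ℤ.^-distribˡ-+-* x (2 ℕ.^ k) (2 ℕ.^ k))

  module OddPrime (pr : Prime p) (p∤2 : ¬ p ∣ 2) where

    instance
      p≢0 : NonZero p
      p≢0 = prime⇒nonZero pr

    2≉0 : + 2 ≉ 0ℤ [ p ]
    2≉0 h = p∤2 (≈0⇒∣ h)

    1≉-1 : 1ℤ ≉ -1ℤ [ p ]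
    1≉-1 h = 2≉0 (combine 1ℤ h refl)

    2<p : 2 ℕ.< p
    2<p = ℕ.≤∧≢⇒< (ℕ.nonTrivial⇒n>1 p {{prime⇒nonTrivial pr}}) (λ { refl → p∤2 ℕ.∣-refl })

    infix 9 _⁻¹
    _⁻¹ : ℤ → ℤ
    x ⁻¹ = x ^ (p ℕ.∸ 2)

    *-inverse : ∀ {x} → x ≉ 0ℤ [ p ] → x * x ⁻¹ ≈ 1ℤ [ p ]
    *-inverse {x} x≉0 = subst (λ k → x ^ k ≈ 1ℤ [ p ]) (eq p 2<p) (fermat pr x≉0)
      where
      eq : ∀ p → 2 ℕ.< p → p ℕ.∸ 1 ≡ suc (p ℕ.∸ 2)
      eq (suc (suc p)) _ = refl
      eq (suc zero) (ℕ.s≤s ())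

    x²≈1⇒x≈±1 : ∀ {x} → x * x ≈ 1ℤ [ p ] → x ≈ 1ℤ [ p ] ⊎ x ≈ -1ℤ [ p ]
    x²≈1⇒x≈±1 = x²≈y²⇒x≈±y pr {y = 1ℤ}

    -- If m = k * 2 ^ i with k odd and i ≤ j, raising x ^ m ≈ 1 to the power 2 ^ (j - i) gives 1 ≈
    -- (-1) ^ k = -1. So each power of 2 up to 2 ^ (j + 1) can be split off in turn.
    2^∣order : ∀ {x m} j → x ^ (2 ℕ.^ j) ≈ -1ℤ [ p ] → x ^ m ≈ 1ℤ [ p ] → 2 ℕ.^ suc j ∣ m
    2^∣order {x} {m} j x^≈-1 x^m≈1 = divisible (suc j) ℕ.≤-refl
      where
      divisible : ∀ i → i ℕ.≤ suc j → 2 ℕ.^ i ∣ m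
      divisible zero    _         = ℕ.1∣ m
      divisible (suc i) (ℕ.s≤s i≤j) with divisible i (ℕ.m≤n⇒m≤1+n i≤j)
      ... | divides k refl with 2 ℕ.∣? k
      ... | yes 2∣k = ℕ.*-monoˡ-∣ (2 ℕ.^ i) 2∣k
      ... | no  odd = contradiction (≈-trans (≈-sym (≈1⇒^≈1 (2 ℕ.^ (j ℕ.∸ i)) x^m≈1))
                        (≈-trans (≈-reflexive exponents) (≈-trans (^-cong k x^≈-1) (≈-reflexive (-1^odd odd))))) 1≉-1
        where
        exponents : (x ^ (k ℕ.* 2 ℕ.^ i)) ^ (2 ℕ.^ (j ℕ.∸ i)) ≡ (x ^ (2 ℕ.^ j)) ^ k
        exponents = trans (ℤ.^-*-assoc x (k ℕ.* 2 ℕ.^ i) (2 ℕ.^ (j ℕ.∸ i))) (trans (cong (x ^_)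
          (trans (ℕ.*-assoc k (2 ℕ.^ i) _) (trans (cong (k ℕ.*_) (trans (sym (ℕ.^-distribˡ-+-* 2 i (j ℕ.∸ i)))
            (cong (2 ℕ.^_) (ℕ.m+[n∸m]≡n i≤j)))) (ℕ.*-comm k _)))) (sym (ℤ.^-*-assoc x (2 ℕ.^ j) k)))

    -- Take square roots of c ^ (2 ^ i) ≈ 1 one at a time. The root -1 never occurs, since its t-th
    -- power is -1 while the t-th power of any power of c is 1.
    ≈1-by-coprime-exponents : ∀ {c t} → ¬ 2 ∣ t → ∀ i → c ^ t ≈ 1ℤ [ p ] → c ^ (2 ℕ.^ i) ≈ 1ℤ [ p ] → c ≈ 1ℤ [ p ]
    ≈1-by-coprime-exponents {c} odd zero _ h = ≈-trans (≈-reflexive (sym (ℤ.*-identityʳ c))) h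
    ≈1-by-coprime-exponents {c} {t} odd (suc i) c^t≈1 h =
      [ ≈1-by-coprime-exponents odd i c^t≈1 , (λ g → contradiction (impossible g) 1≉-1) ]′
        (x²≈1⇒x≈±1 {c ^ (2 ℕ.^ i)} (≈-trans (≈-reflexive (sym (^2^suc c i))) h))
      where
      impossible : c ^ (2 ℕ.^ i) ≈ -1ℤ [ p ] → 1ℤ ≈ -1ℤ [ p ]
      impossible g = ≈-trans (≈-sym (≈1⇒^≈1 (2 ℕ.^ i) c^t≈1))
        (≈-trans (≈-reflexive (^-comm c t (2 ℕ.^ i))) (≈-trans (^-cong t g) (≈-reflexive (-1^odd odd))))

    -- Let c be the element on the right. Its t-th power is trivial because 2 ^ j divides 2 ^ (f -
    -- i), its 2 ^ i-th power is a ^ (p - 1), and t is odd. Thus a low starting level forces the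
    -- sample to be a root of unity of small order.
    power-residue : ∀ {a t u f i j} → ¬ 2 ∣ t → p ℕ.∸ 1 ≡ 2 ℕ.^ f ℕ.* u → i ℕ.+ j ℕ.≤ f → a ≉ 0ℤ [ p ] →
                    a ^ (t ℕ.* 2 ℕ.^ j) ≈ 1ℤ [ p ] → a ^ (2 ℕ.^ (f ℕ.∸ i) ℕ.* u) ≈ 1ℤ [ p ]
    power-residue {a} {t} {u} {f} {i} {j} odd eq i+j≤f a≉0 h = ≈1-by-coprime-exponents odd i
      (≈-trans (≈-reflexive exponents₁) (≈1⇒^≈1 (2 ℕ.^ (f ℕ.∸ i ℕ.∸ j) ℕ.* u) h))
      (≈-trans (≈-reflexive exponents₂) (fermat pr a≉0))
      where
      pow : ∀ {m n} → m ℕ.≤ n → 2 ℕ.^ n ≡ 2 ℕ.^ (n ℕ.∸ m) ℕ.* 2 ℕ.^ m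
      pow {m} {n} m≤n = trans (cong (2 ℕ.^_) (sym (ℕ.m∸n+n≡m m≤n))) (ℕ.^-distribˡ-+-* 2 (n ℕ.∸ m) m)
      j≤f-i : j ℕ.≤ f ℕ.∸ i
      j≤f-i = ℕ.m+n≤o⇒m≤o∸n j (subst (ℕ._≤ f) (ℕ.+-comm i j) i+j≤f)
      exponents₁ : (a ^ (2 ℕ.^ (f ℕ.∸ i) ℕ.* u)) ^ t ≡ (a ^ (t ℕ.* 2 ℕ.^ j)) ^ (2 ℕ.^ (f ℕ.∸ i ℕ.∸ j) ℕ.* u)
      exponents₁ = trans (ℤ.^-*-assoc a (2 ℕ.^ (f ℕ.∸ i) ℕ.* u) t) (trans (cong (a ^_) (trans (cong (λ z → z ℕ.* u ℕ.* t) (pow j≤f-i))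
        (lemma t u (2 ℕ.^ j) (2 ℕ.^ (f ℕ.∸ i ℕ.∸ j))))) (sym (ℤ.^-*-assoc a (t ℕ.* 2 ℕ.^ j) _)))
        where
        lemma : ∀ t u x y → y ℕ.* x ℕ.* u ℕ.* t ≡ t ℕ.* x ℕ.* (y ℕ.* u)
        lemma = solveℕ-∀
      exponents₂ : (a ^ (2 ℕ.^ (f ℕ.∸ i) ℕ.* u)) ^ (2 ℕ.^ i) ≡ a ^ (p ℕ.∸ 1)
      exponents₂ = trans (ℤ.^-*-assoc a (2 ℕ.^ (f ℕ.∸ i) ℕ.* u) (2 ℕ.^ i)) (cong (a ^_) (trans (lemma (2 ℕ.^ (f ℕ.∸ i)) u (2 ℕ.^ i))
        (trans (cong (ℕ._* u) (sym (pow (ℕ.m+n≤o⇒m≤o i i+j≤f)))) (sym eq))))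
        where
        lemma : ∀ x u y → x ℕ.* u ℕ.* y ≡ x ℕ.* y ℕ.* u
        lemma = solveℕ-∀

  -- A prime divisor p of 2 ^ e * t + 1 satisfies 2 ^ e ∣ p - 1, hence p > √N.
  pocklington : ∀ e t {x} → t ℕ.< 2 ℕ.^ suc e → 0 ℕ.< t →
    x ^ (2 ℕ.^ e) ≈ -1ℤ [ 2 ℕ.^ suc e ℕ.* t ℕ.+ 1 ] → Prime (2 ℕ.^ suc e ℕ.* t ℕ.+ 1)
  pocklington e t {x} t<2^e 0<t h = rough∧square>⇒prime {{N-nonTrivial}} rough square>
    where
    E N : ℕ
    E = 2 ℕ.^ suc e
    N = E ℕ.* t ℕ.+ 1
    0<E : 0 ℕ.< E
    0<E = ℕ.m^n>0 2 (suc e)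
    N-nonTrivial : ℕ.NonTrivial N
    N-nonTrivial = ℕ.n>1⇒nonTrivial (ℕ.+-monoˡ-< 1 (ℕ.*-mono-≤ 0<E 0<t))
    square> : suc E ℕ.* suc E ℕ.> N
    square> = begin-strict
      E ℕ.* t ℕ.+ 1         ≤⟨ ℕ.+-monoˡ-≤ 1 (ℕ.*-monoʳ-≤ E (ℕ.<⇒≤ t<2^e)) ⟩
      E ℕ.* E ℕ.+ 1         ≡⟨ ℕ.+-comm _ 1 ⟩
      suc (E ℕ.* E)         ≤⟨ ℕ.s≤s (ℕ.m≤m+n (E ℕ.* E) E) ⟩
      suc (E ℕ.* E ℕ.+ E)   <⟨ ℕ.s≤s (ℕ.m<n+m (E ℕ.* E ℕ.+ E) 0<E) ⟩
      suc (E ℕ.+ (E ℕ.* E ℕ.+ E)) ≡⟨ lemma E ⟩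
      suc E ℕ.* suc E       ∎
      where
      open ℕ.≤-Reasoning
      lemma : ∀ E → suc (E ℕ.+ (E ℕ.* E ℕ.+ E)) ≡ suc E ℕ.* suc E
      lemma = solveℕ-∀
    rough : suc E Rough N
    rough (hasNonTrivialDivisor {d} {{nt}} d<E d∣N) with primeDivisor d (ℕ.nonTrivial⇒n>1 d)
    ... | q , pr , q∣d = ℕ.<⇒≱ (ℕ.≤-<-trans (ℕ.∣⇒≤ {{ℕ.nonTrivial⇒nonZero d}} q∣d) d<E) (large q pr (ℕ.∣-trans q∣d d∣N))
      where
      large : ∀ q → Prime q → q ∣ N → suc E ℕ.≤ q
      large zero          pr _ = contradiction pr ¬prime[0]
      large (suc zero)    pr _ = contradiction pr ¬prime[1]
      large (suc (suc q)) pr q∣N = ℕ.s≤s (ℕ.∣⇒≤ (2^∣order e h′ (fermat pr x≉0)))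
        where
        -- Only the prime 2 divides 2, and N is odd.
        q∤2 : ¬ suc (suc q) ∣ 2
        q∤2 q∣2 with ℕ.∣⇒≤ q∣2
        ... | ℕ.s≤s (ℕ.s≤s ℕ.z≤n) =
          p≢1 pr (ℕ.∣m+n∣m⇒∣n q∣N (ℕ.∣m⇒∣m*n t (ℕ.m∣m*n (2 ℕ.^ e))))
        open OddPrime pr q∤2
        h′ : x ^ (2 ℕ.^ e) ≈ -1ℤ [ suc (suc q) ]
        h′ = ≈-weaken q∣N h
        x≉0 : x ≉ 0ℤ [ suc (suc q) ]
        x≉0 = power≈-1⇒≉0 pr (ℕ.m^n>0 2 e) h′

-- Square roots and shifts in the field of a Proth prime

module ProthPrimes where

  open Congruence
  open NumberTheory
  open import Data.Integer using (ℤ; +_; _+_; _*_; _-_; -_; _^_; 0ℤ; 1ℤ; -1ℤ; ∣_∣)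
  import Data.Integer.Properties as ℤ
  open import Data.Integer.Tactic.RingSolver using (solve-∀)
  open import Data.Nat as ℕ using (ℕ; zero; suc)
  import Data.Nat.Properties as ℕ
  open import Data.Nat.Divisibility as ℕ using (_∣_)
  open import Data.Nat.Primality using (Prime)
  open import Data.Nat.Tactic.RingSolver using () renaming (solve-∀ to solveℕ-∀)
  open import Data.List using (List; []; _∷_; length; map)
  open import Data.List.Properties using (length-map; length-applyUpTo)
  open import Data.List.Relation.Unary.All as All using (All; []; _∷_)
  import Data.List.Relation.Unary.All.Properties as All
  open import Data.List.Relation.Unary.AllPairs using ([]; _∷_)
  open import Data.Product using (_×_; _,_; ∃-syntax; proj₁; proj₂)
  open import Data.Sum as Sum using (_⊎_; inj₁; inj₂; [_,_]′)
  open import Relation.Nullary using (¬_; Dec; yes; no; contradiction)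
  open import Relation.Nullary.Decidable using (¬?; decidable-stable)
  open import Relation.Binary.PropositionalEquality

  -- Serves to discard the pole s = a of the Möbius map. A distinct list has at most one entry
  -- congruent to a; the last component lets any property of all entries pass to the shorter list.
  remove : ∀ {p} a xs → Distinct p xs →
           ∃[ ys ] Distinct p ys × All (_≉ a [ p ]) ys × length xs ℕ.≤ suc (length ys) ×
                   (∀ {P : ℤ → Set} → All P xs → All P ys)
  remove a [] [] = [] , [] , [] , ℕ.z≤n , λ ps → ps
  remove {p} a (x ∷ xs) (d ∷ ds) with x ≈? a [ p ]
  ... | yes x≈a = xs , ds , All.map (λ x≉y y≈a → x≉y (≈-trans x≈a (≈-sym y≈a))) d , ℕ.≤-refl , λ { (_ ∷ ps) → ps }
  ... | no  x≉a with remove a xs ds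
  ... | ys , es , as , le , keep = x ∷ ys , keep d ∷ es , x≉a ∷ as , ℕ.s≤s le , λ { (q ∷ ps) → q ∷ keep ps }

  -- The Proth exponent is `suc e`, so that 2 ^ e * t = (p - 1) / 2 is the exponent of Euler's
  -- criterion.
  module ProthPrime {p} (pr : Prime p) (p∤2 : ¬ p ∣ 2) (e t : ℕ) (p-1≡ : p ℕ.∸ 1 ≡ 2 ℕ.^ suc e ℕ.* t) where

    open OddPrime pr p∤2 public

    fermat-proth : ∀ {x} → x ≉ 0ℤ [ p ] → (x ^ t) ^ (2 ℕ.^ suc e) ≈ 1ℤ [ p ]
    fermat-proth {x} x≉0 = ≈-trans
      (≈-reflexive (trans (ℤ.^-*-assoc x t (2 ℕ.^ suc e)) (cong (x ^_) (trans (ℕ.*-comm t _) (sym p-1≡)))))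
      (fermat pr x≉0)

    -- If x ^ (t * 2 ^ e) were 1 for all x from 1 to p - 1, a polynomial of degree (p - 1) / 2 would
    -- have p - 1 roots. For another x this power is -1, and g = x ^ t has order 2 ^ (e + 1).
    nonresidue : ∃[ g ] g ^ (2 ℕ.^ e) ≈ -1ℤ [ p ]
    nonresidue with ℕ.anyUpTo? (λ i → ¬? (((+ suc i) ^ t) ^ (2 ℕ.^ e) ≈? 1ℤ [ p ])) (p ℕ.∸ 1)
    ... | yes (i , i<p-1 , h) = (+ suc i) ^ t , [ (λ g → contradiction g h) , (λ g → g) ]′
            (x²≈1⇒x≈±1 (≈-trans (≈-reflexive (sym (^2^suc _ e))) (fermat-proth λ h₀ →
              ℕ.0≢1+n (sym (small≈⇒≡ (i< 2<p i<p-1) (ℕ.<-trans ℕ.z<s 2<p) h₀)))))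
      where
      i< : ∀ {p i} → 2 ℕ.< p → i ℕ.< p ℕ.∸ 1 → suc i ℕ.< p
      i< {suc p} _ lt = ℕ.s≤s lt
    ... | no none = contradiction (lagrange pr (unityPoly d) (1⋯ (p ℕ.∸ 1)) (1⋯-distinct (ℕ.∸-monoʳ-< {o = 0} ℕ.z<s (ℕ.<⇒≤ (ℕ.<-trans (ℕ.s≤s ℕ.z<s) 2<p))))
                      (All.applyUpTo⁺₁ (λ i → + suc i) (p ℕ.∸ 1) λ {i} i< → ≈1⇒root d (+ suc i) (subst (λ k → (+ suc i) ^ k ≈ 1ℤ [ p ]) half≡
                        (≈-trans (≈-reflexive (sym (ℤ.^-*-assoc (+ suc i) t (2 ℕ.^ e))))
                          (decidable-stable (_ ≈? _ [ p ]) λ h → none (i , i< , h))))))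
                    (ℕ.<⇒≱ too-long)
      where
      d : ℕ
      d = t ℕ.* 2 ℕ.^ e ℕ.∸ 1
      0<half : 0 ℕ.< t ℕ.* 2 ℕ.^ e
      0<half with t ℕ.* 2 ℕ.^ e in eq
      ... | suc _ = ℕ.z<s
      ... | zero  = contradiction (trans p-1≡ (trans (lemma (2 ℕ.^ e) t) (cong (2 ℕ.*_) eq)))
                      (ℕ.<⇒≢ (ℕ.m<n⇒0<n∸m (ℕ.<-trans (ℕ.s≤s ℕ.z<s) 2<p)) ∘ sym)
        where
        open import Function using (_∘_)
        lemma : ∀ x t → 2 ℕ.* x ℕ.* t ≡ 2 ℕ.* (t ℕ.* x)
        lemma = solveℕ-∀
      half≡ : t ℕ.* 2 ℕ.^ e ≡ suc d
      half≡ = sym (ℕ.m+[n∸m]≡n 0<half)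
      too-long : length (unityPoly d) ℕ.< length (1⋯ (p ℕ.∸ 1))
      too-long = subst₂ ℕ._<_ (trans half≡ (sym (length-unityPoly d)))
        (sym (trans (length-applyUpTo _ (p ℕ.∸ 1)) (trans p-1≡ (lemma (2 ℕ.^ e) t))))
        (ℕ.m<m+n (t ℕ.* 2 ℕ.^ e) 0<half)
        where
        lemma : ∀ x t → 2 ℕ.* x ℕ.* t ≡ t ℕ.* x ℕ.+ t ℕ.* x
        lemma = solveℕ-∀

    -- If y has order 2 ^ (k + 1), its product with a square of the same order has order at most 2 ^ k.
    sqrt : ∀ y k → k ℕ.≤ e → y ^ (2 ℕ.^ k) ≈ 1ℤ [ p ] → ∃[ z ] z * z ≈ y [ p ]
    sqrt y zero    _   h = 1ℤ , ≈-sym (≈-trans (≈-reflexive (sym (ℤ.*-identityʳ y))) h)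
    sqrt y (suc k) k<e h =
      [ sqrt y k (ℕ.<⇒≤ k<e) , (λ h₂ → let z , z² = root h₂ in z * w ⁻¹ , root′ z z²) ]′
        (x²≈1⇒x≈±1 {y ^ (2 ℕ.^ k)} (≈-trans (≈-reflexive (sym (^2^suc y k))) h))
      where
      g w : ℤ
      g = proj₁ nonresidue
      -- The exponent is chosen so that `w * w` is g ^ (2 ^ (e - k)), whose 2 ^ k-th power is g ^ (2
      -- ^ e) ≈ -1.
      w = g ^ (2 ℕ.^ (e ℕ.∸ suc k))
      w²^ : (w * w) ^ (2 ℕ.^ k) ≈ -1ℤ [ p ]
      w²^ = ≈-trans (≈-reflexive (trans (cong (_^ (2 ℕ.^ k)) (sym (^2^suc g (e ℕ.∸ suc k))))
        (trans (ℤ.^-*-assoc g (2 ℕ.^ suc (e ℕ.∸ suc k)) (2 ℕ.^ k)) (cong (g ^_) (trans (sym (ℕ.^-distribˡ-+-* 2 (suc (e ℕ.∸ suc k)) k))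
          (cong (2 ℕ.^_) (trans (sym (ℕ.+-suc (e ℕ.∸ suc k) k)) (ℕ.m∸n+n≡m k<e))))))))
        (proj₂ nonresidue)
      root : y ^ (2 ℕ.^ k) ≈ -1ℤ [ p ] → ∃[ z ] z * z ≈ y * (w * w) [ p ]
      root h₂ = sqrt (y * (w * w)) k (ℕ.<⇒≤ k<e)
        (≈-trans (≈-reflexive (^-distrib-* y (w * w) (2 ℕ.^ k))) (*-cong h₂ w²^))
      w≉0 : w ≉ 0ℤ [ p ]
      w≉0 w≈0 = power≈-1⇒≉0 pr (ℕ.m^n>0 2 k) w²^ (*-cong w≈0 w≈0)
      root′ : ∀ z → z * z ≈ y * (w * w) [ p ] → z * w ⁻¹ * (z * w ⁻¹) ≈ y [ p ]
      root′ z z² = combine₂ (w ⁻¹ * w ⁻¹) (y * (w * w ⁻¹ + 1ℤ)) z² (*-inverse w≉0) (lemma y z w (w ⁻¹))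
        where
        lemma : ∀ y z w i → z * i * (z * i) ≡ y + (i * i * (z * z - y * (w * w)) + y * (w * i + 1ℤ) * (w * i - 1ℤ))
        lemma = solve-∀

    power-±1 : ∀ b k → b ^ (2 ℕ.^ k) ≈ 1ℤ [ p ] → b ≈ 1ℤ [ p ] ⊎ ∃[ i ] i ℕ.< k × b ^ (2 ℕ.^ i) ≈ -1ℤ [ p ]
    power-±1 b zero    h = inj₁ (≈-trans (≈-reflexive (sym (ℤ.*-identityʳ b))) h)
    power-±1 b (suc k) h = [ earlier , (λ g → inj₂ (k , ℕ.≤-refl , g)) ]′
      (x²≈1⇒x≈±1 {b ^ (2 ℕ.^ k)} (≈-trans (≈-reflexive (sym (^2^suc b k))) h))
      where
      earlier : b ^ (2 ℕ.^ k) ≈ 1ℤ [ p ] → b ≈ 1ℤ [ p ] ⊎ ∃[ i ] i ℕ.< suc k × b ^ (2 ℕ.^ i) ≈ -1ℤ [ p ]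
      earlier g = Sum.map₂ (λ (i , i<k , r) → i , ℕ.m<n⇒m<1+n i<k , r) (power-±1 b k g)

    -- Modulo a prime, idempotence means being 0 or 1, so one test covers both p ∣ a and a ^ t ≈ 1.
    -- In every other case the iterated squares of a ^ t reach 1 through -1.
    initial-level : 0 ℕ.< t → ∀ a → (a ^ t) * (a ^ t) ≈ a ^ t [ p ] ⊎
                    ∃[ i ] i ℕ.< suc e × (a ^ t) ^ (2 ℕ.^ i) ≈ -1ℤ [ p ]
    initial-level 0<t a = go (a ≈? 0ℤ [ p ])
      where
      zero-power : ∀ {t} → a ≈ 0ℤ [ p ] → 0 ℕ.< t → a ^ t ≈ 0ℤ [ p ]
      zero-power {suc t} a≈0 _ = *-cong a≈0 (≈-refl {a ^ t})
      lemma₀ : ∀ b → b * b ≡ b + (b - 1ℤ) * (b - 0ℤ)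
      lemma₀ = solve-∀
      lemma₁ : ∀ b → b * b ≡ b + b * (b - 1ℤ)
      lemma₁ = solve-∀
      go : Dec (a ≈ 0ℤ [ p ]) → (a ^ t) * (a ^ t) ≈ a ^ t [ p ] ⊎
           ∃[ i ] i ℕ.< suc e × (a ^ t) ^ (2 ℕ.^ i) ≈ -1ℤ [ p ]
      go (yes a≈0) = inj₁ (combine ((a ^ t) - 1ℤ) (zero-power a≈0 0<t) (lemma₀ (a ^ t)))
      go (no  a≉0) = Sum.map₁ (λ r → combine (a ^ t) r (lemma₁ (a ^ t))) (power-±1 (a ^ t) (suc e) (fermat-proth a≉0))

    module SquareRoot {a : ℤ} (a≉0 : a ≉ 0ℤ [ p ]) where

      -- The shifts of no use: s ≈ ± a, where a component of s + X vanishes, and those for which the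
      -- components of (s + X) ^ t already have equal squares, so that no later square can have
      -- opposite ones.
      Bad : ℤ → Set
      Bad s = (s * s ≈ a * a [ p ]) ⊎ ((s + a) ^ (t ℕ.+ t) ≈ (s - a) ^ (t ℕ.+ t) [ p ])

      2a≉0 : + 2 * a ≉ 0ℤ [ p ]
      2a≉0 = *-≉0 pr 2≉0 a≉0

      ρ : ℤ → ℤ
      ρ s = (s + a) * (s - a) ⁻¹

      s-a≉0 : ∀ {s} → s ≉ a [ p ] → s - a ≉ 0ℤ [ p ]
      s-a≉0 {s} s≉a h = s≉a (combine 1ℤ h (lemma s a))
        where
        lemma : ∀ s a → s ≡ a + 1ℤ * (s - a - 0ℤ)
        lemma = solve-∀

      ρ*[s-a]≈s+a : ∀ {s} → s ≉ a [ p ] → ρ s * (s - a) ≈ s + a [ p ]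
      ρ*[s-a]≈s+a {s} s≉a = combine (s + a) (*-inverse (s-a≉0 s≉a)) (lemma (s + a) (s - a) ((s - a) ⁻¹))
        where
        lemma : ∀ x y i → x * i * y ≡ x + x * (y * i - 1ℤ)
        lemma = solve-∀

      -- The map s ↦ (s + a) / (s - a) is a Möbius transformation missing the value 1.
      ρ≉1 : ∀ {s} → s ≉ a [ p ] → 1ℤ ≉ ρ s [ p ]
      ρ≉1 {s} s≉a h = 2a≉0 (combine₂ -1ℤ (- (s - a)) (ρ*[s-a]≈s+a s≉a) h (lemma s a (ρ s)))
        where
        lemma : ∀ s a r → + 2 * a ≡ 0ℤ + (-1ℤ * (r * (s - a) - (s + a)) + - (s - a) * (1ℤ - r))
        lemma = solve-∀

      ρ-injective : ∀ {s s′} → s ≉ a [ p ] → s′ ≉ a [ p ] → ρ s ≈ ρ s′ [ p ] → s ≈ s′ [ p ]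
      ρ-injective {s} {s′} s≉a s′≉a h = ≈-sym (*-cancelˡ-≈ pr 2a≉0
        (combine 1ℤ (≈-trans (*-cong (≈-sym (ρ*[s-a]≈s+a s≉a)) (≈-refl {s′ - a}))
          (≈-trans (combine ((s - a) * (s′ - a)) h (lemma₁ (ρ s) (ρ s′) (s - a) (s′ - a)))
            (*-cong (ρ*[s-a]≈s+a s′≉a) (≈-refl {s - a})))) (lemma₂ s s′ a)))
        where
        lemma₁ : ∀ r r′ x y → r * x * y ≡ r′ * y * x + x * y * (r - r′)
        lemma₁ = solve-∀
        lemma₂ : ∀ s s′ a → + 2 * a * s′ ≡ + 2 * a * s + 1ℤ * ((s + a) * (s′ - a) - (s′ + a) * (s - a))
        lemma₂ = solve-∀

      -- The polynomial is X * (X ^ 2t - 1): the shift s = -a is sent to 0, and coinciding 2t-th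
      -- powers make the quotient ρ s a 2t-th root of unity.
      bad⇒root : 0 ℕ.< t → ∀ {s} → s ≉ a [ p ] → Bad s → ⟦ 0ℤ ∷ unityPoly (t ℕ.+ t ℕ.∸ 1) ⟧ (ρ s) ≈ 0ℤ [ p ]
      bad⇒root _ {s} s≉a (inj₁ h) = combine₂ (⟦ q ⟧ (ρ s)) 0ℤ ρ≈0 (≈-refl {0ℤ}) (lemma (ρ s) (⟦ q ⟧ (ρ s)))
        where
        q : List ℤ
        q = unityPoly (t ℕ.+ t ℕ.∸ 1)
        ρ≈0 : ρ s ≈ 0ℤ [ p ]
        ρ≈0 = [ (λ s≈a → contradiction s≈a s≉a) , (λ g → combine ((s - a) ⁻¹) g (lemma₀ s a ((s - a) ⁻¹))) ]′
          (x²≈y²⇒x≈±y pr {s} {a} h)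
          where
          lemma₀ : ∀ s a i → (s + a) * i ≡ 0ℤ + i * (s - - a)
          lemma₀ = solve-∀
        lemma : ∀ r y → 0ℤ + r * y ≡ 0ℤ + (y * (r - 0ℤ) + 0ℤ * (0ℤ - 0ℤ))
        lemma = solve-∀
      bad⇒root 0<t {s} s≉a (inj₂ h) = combine (ρ s) (≈1⇒root d (ρ s) (subst (λ k → ρ s ^ k ≈ 1ℤ [ p ]) half≡ unity))
        (lemma (ρ s) (⟦ unityPoly d ⟧ (ρ s)))
        where
        d : ℕ
        d = t ℕ.+ t ℕ.∸ 1
        half≡ : t ℕ.+ t ≡ suc d
        half≡ = sym (ℕ.m+[n∸m]≡n {1} {t ℕ.+ t} (ℕ.≤-trans 0<t (ℕ.m≤m+n t t)))
        lemma : ∀ r y → 0ℤ + r * y ≡ 0ℤ + r * (y - 0ℤ)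
        lemma = solve-∀
        unity : ρ s ^ (t ℕ.+ t) ≈ 1ℤ [ p ]
        unity = ≈-trans (≈-reflexive (^-distrib-* (s + a) ((s - a) ⁻¹) (t ℕ.+ t)))
          (≈-trans (*-cong h ≈-refl) (≈-trans (≈-reflexive (sym (^-distrib-* (s - a) ((s - a) ⁻¹) (t ℕ.+ t))))
            (≈1⇒^≈1 (t ℕ.+ t) (*-inverse (s-a≉0 s≉a)))))

      -- Of 2t + 2 candidates at most one is congruent to a. If all were bad, the images of the
      -- other 2t + 1, together with the value 1 that ρ misses but that is itself a root, would be
      -- 2t + 2 distinct roots of a polynomial of degree 2t + 1.
      good-shift : 0 ℕ.< t → suc (suc (t ℕ.+ t)) ℕ.< p → ∃[ i ] i ℕ.< suc (suc (t ℕ.+ t)) × ¬ Bad (+ suc i)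
      good-shift 0<t T<p with ℕ.anyUpTo? (λ i → ¬? (bad? (+ suc i))) (suc (suc (t ℕ.+ t)))
        where
        open import Relation.Nullary.Decidable using (_⊎-dec_)
        bad? : ∀ s → Dec (Bad s)
        bad? s = (_ ≈? _ [ p ]) ⊎-dec (_ ≈? _ [ p ])
      ... | yes r = r
      ... | no none with remove a (1⋯ T) (1⋯-distinct T<p)
        where
        T : ℕ
        T = suc (suc (t ℕ.+ t))
      ... | ys , ds , as , le , keep = contradiction
            (lagrange pr (0ℤ ∷ unityPoly d) (1ℤ ∷ map ρ ys)
              (All.map⁺ (All.map ρ≉1 as) ∷ distinct ys ds as)
              (one-root ∷ All.map⁺ (All.zipWith (λ { (s≉a , b) → bad⇒root 0<t s≉a b }) (as , keep all-bad))))
            (ℕ.<⇒≱ too-long)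
        where
        open import Relation.Nullary.Decidable using (_⊎-dec_)
        d T : ℕ
        d = t ℕ.+ t ℕ.∸ 1
        T = suc (suc (t ℕ.+ t))
        all-bad : All Bad (1⋯ T)
        all-bad = All.applyUpTo⁺₁ (λ i → + suc i) T λ {i} i<T →
          decidable-stable ((_ ≈? _ [ p ]) ⊎-dec (_ ≈? _ [ p ])) λ h → none (i , i<T , h)
        distinct : ∀ ys → Distinct p ys → All (_≉ a [ p ]) ys → Distinct p (map ρ ys)
        distinct []       []       []       = []
        distinct (y ∷ ys) (d ∷ ds) (c ∷ cs) =
          All.map⁺ (All.zipWith (λ { (y≉z , z≉a) h → y≉z (ρ-injective c z≉a h) }) (d , cs)) ∷ distinct ys ds cs
        one-root : ⟦ 0ℤ ∷ unityPoly d ⟧ 1ℤ ≈ 0ℤ [ p ]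
        one-root = combine 1ℤ (≈1⇒root d 1ℤ (≈-reflexive (ℤ.^-zeroˡ (suc d)))) (lemma (⟦ unityPoly d ⟧ 1ℤ))
          where
          lemma : ∀ y → 0ℤ + 1ℤ * y ≡ 0ℤ + 1ℤ * (y - 0ℤ)
          lemma = solve-∀
        half≡ : t ℕ.+ t ≡ suc d
        half≡ = sym (ℕ.m+[n∸m]≡n {1} {t ℕ.+ t} (ℕ.≤-trans 0<t (ℕ.m≤m+n t t)))
        too-long : suc (length (unityPoly d)) ℕ.< suc (length (map ρ ys))
        too-long = ℕ.s≤s (subst₂ ℕ._≤_ (cong suc (trans half≡ (sym (length-unityPoly d)))) (sym (length-map ρ ys))
          (ℕ.s≤s⁻¹ (subst (ℕ._≤ suc (length ys)) (length-applyUpTo (λ i → + suc i) T) le)))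

      -- Descending from the equal top powers, each square root step yields equal or opposite
      -- powers, and equality cannot persist down to the squares. The exponent `suc i` presents the
      -- opposite powers as squares of the i-th iterated squares.
      opposite-powers : ∀ {u v} k → ¬ (u * u ≈ v * v [ p ]) → u ^ (2 ℕ.^ suc k) ≈ v ^ (2 ℕ.^ suc k) [ p ] →
                        ∃[ i ] i ℕ.< k × u ^ (2 ℕ.^ suc i) ≈ - (v ^ (2 ℕ.^ suc i)) [ p ]
      opposite-powers {u} {v} zero u²≉v² h = contradiction (≈-trans (≈-reflexive (lemma u)) (≈-trans h (≈-reflexive (sym (lemma v))))) u²≉v²
        where
        lemma : ∀ u → u * u ≡ u ^ 2
        lemma u = cong (u *_) (sym (ℤ.*-identityʳ u))
      opposite-powers {u} {v} (suc k) u²≉v² h = [ earlier , (λ g → k , ℕ.≤-refl , g) ]′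
        (x²≈y²⇒x≈±y pr {u ^ (2 ℕ.^ suc k)} {v ^ (2 ℕ.^ suc k)}
          (subst₂ (λ x y → x ≈ y [ p ]) (^2^suc u (suc k)) (^2^suc v (suc k)) h))
        where
        earlier : u ^ (2 ℕ.^ suc k) ≈ v ^ (2 ℕ.^ suc k) [ p ] →
                  ∃[ i ] i ℕ.< suc k × u ^ (2 ℕ.^ suc i) ≈ - (v ^ (2 ℕ.^ suc i)) [ p ]
        earlier g = let i , i<k , r = opposite-powers {u} {v} k u²≉v² g in i , ℕ.m<n⇒m<1+n i<k , r

-- Program logic with worst case and expected time

module Machine where

  open import Data.Bool using (Bool; true; false; not; _∧_; T)
  open import Data.Bool.Properties using (∧-assoc; ∧-identityʳ)
  open import Data.Empty using (⊥-elim)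
  open import Data.Integer using (+_)
  import Data.Integer as ℤ
  import Data.Integer.Properties as ℤ
  open import Data.List using (List; []; _∷_; _++_; concatMap)
  open import Data.List.Properties using (++-assoc)
  open import Data.Nat
  open import Data.Nat.DivMod using (m%n<n; m%n≤m; m/n≤m)
  open import Data.Nat.Logarithm using (⌊log₂⌋-mono-≤)
  open import Data.Nat.Properties
  open import Data.Nat.Tactic.RingSolver using (solve-∀)
  open import Data.Product using (_×_; _,_; ∃-syntax; proj₁; proj₂)
  open import Data.Rational as ℚ using (ℚ; ½; 0ℚ)
  import Data.Rational.Properties as ℚ
  import Data.Rational.Unnormalised as ℚᵘ
  import Data.Rational.Unnormalised.Properties as ℚᵘ

  open import Relation.Nullary using (contradiction)
  open import Relation.Binary.PropositionalEquality

  fromℕ-+ : ∀ a b → fromℕ (a + b) ≡ fromℕ a ℚ.+ fromℕ b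
  fromℕ-+ a b = ℚ.toℚᵘ-injective (ℚᵘ.≃-trans (ℚ.toℚᵘ-fromℚᵘ (ℚᵘ.mkℚᵘ (+ (a + b)) 0))
    (ℚᵘ.≃-trans eq (ℚᵘ.≃-sym (ℚᵘ.≃-trans (ℚ.toℚᵘ-homo-+ (fromℕ a) (fromℕ b))
      (ℚᵘ.+-cong (ℚ.toℚᵘ-fromℚᵘ (ℚᵘ.mkℚᵘ (+ a) 0)) (ℚ.toℚᵘ-fromℚᵘ (ℚᵘ.mkℚᵘ (+ b) 0)))))))
    where
    eq : ℚᵘ.mkℚᵘ (+ (a + b)) 0 ℚᵘ.≃ ℚᵘ.mkℚᵘ (+ a) 0 ℚᵘ.+ ℚᵘ.mkℚᵘ (+ b) 0
    eq = ℚᵘ.*≡* (cong (ℤ._* + 1) (trans (ℤ.pos-+ a b) (sym (cong₂ ℤ._+_ (ℤ.*-identityʳ (+ a)) (ℤ.*-identityʳ (+ b))))))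

  fromℕ-* : ∀ a b → fromℕ (a * b) ≡ fromℕ a ℚ.* fromℕ b
  fromℕ-* a b = ℚ.toℚᵘ-injective (ℚᵘ.≃-trans (ℚ.toℚᵘ-fromℚᵘ (ℚᵘ.mkℚᵘ (+ (a * b)) 0))
    (ℚᵘ.≃-trans eq (ℚᵘ.≃-sym (ℚᵘ.≃-trans (ℚ.toℚᵘ-homo-* (fromℕ a) (fromℕ b))
      (ℚᵘ.*-cong (ℚ.toℚᵘ-fromℚᵘ (ℚᵘ.mkℚᵘ (+ a) 0)) (ℚ.toℚᵘ-fromℚᵘ (ℚᵘ.mkℚᵘ (+ b) 0)))))))
    where
    eq : ℚᵘ.mkℚᵘ (+ (a * b)) 0 ℚᵘ.≃ ℚᵘ.mkℚᵘ (+ a) 0 ℚᵘ.* ℚᵘ.mkℚᵘ (+ b) 0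
    eq = ℚᵘ.*≡* (cong (ℤ._* + 1) (ℤ.pos-* a b))

  fromℕ-mono : ∀ {a b} → a ≤ b → fromℕ a ℚ.≤ fromℕ b
  fromℕ-mono {a} {b} a≤b = ℚ.toℚᵘ-cancel-≤ (ℚᵘ.≤-respˡ-≃ (ℚᵘ.≃-sym (ℚ.toℚᵘ-fromℚᵘ (ℚᵘ.mkℚᵘ (+ a) 0)))
    (ℚᵘ.≤-respʳ-≃ (ℚᵘ.≃-sym (ℚ.toℚᵘ-fromℚᵘ (ℚᵘ.mkℚᵘ (+ b) 0)))
      (ℚᵘ.*≤* (ℤ.*-monoʳ-≤-nonNeg (+ 1) (ℤ.+≤+ a≤b)))))

  -- Indexed by a transition, so that what `next` computes for an instruction matches `proceed` or
  -- `random` directly. Since a run exists only for a halting program, termination, correctness and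
  -- both bounds are built up together.
  record Outcome′ (τ : Transition) (P : Memory → Set) (A : ℕ) (B : ℚ) : Set where
    constructor outcome
    field
      run      : Run τ
      correct  : AllOutcomes P run
      worst    : worstTime run ≤ A
      expected : expectedTime run ℚ.≤ B

  Outcome : Configuration → (Memory → Set) → ℕ → ℚ → Set
  Outcome c = Outcome′ (next c)

  weaken : ∀ {τ P A A′ B B′} → A ≤ A′ → B ℚ.≤ B′ → Outcome′ τ P A B → Outcome′ τ P A′ B′
  weaken A≤ B≤ (outcome r c w e) = outcome r c (≤-trans w A≤) (ℚ.≤-trans e B≤)

  halting : ∀ {μ} {P : Memory → Set} → P μ → Outcome ⟨ [] , μ ⟩ P 0 0ℚ
  halting Pμ = outcome halt Pμ ≤-refl ℚ.≤-refl

  proceeding : ∀ {k K c P A B} → k ≤ K → Outcome c P A B →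
               Outcome′ (proceed k c) P (K + A) (fromℕ K ℚ.+ B)
  proceeding k≤K (outcome r c w e) =
    outcome (step r) c (+-mono-≤ k≤K w) (ℚ.+-mono-≤ (fromℕ-mono k≤K) e)

  tossing : ∀ {k K c d P A B C} → k ≤ K → Outcome c P A B → Outcome d P A C →
            Outcome′ (random k c d) P (K + A) (fromℕ K ℚ.+ ½ ℚ.* (B ℚ.+ C))
  tossing k≤K (outcome r c w e) (outcome r′ c′ w′ e′) =
    outcome (split r r′) (c , c′) (+-mono-≤ k≤K (⊔-lub w w′))
      (ℚ.+-mono-≤ (fromℕ-mono k≤K) (ℚ.*-monoˡ-≤-nonNeg ½ (ℚ.+-mono-≤ e e′)))

  -- Instructions preserving the bound n on all cells.  The cells 0, 1, 2, 3
  -- hold the constants n, 1, 2, 0 throughout.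
  data Stmt : Set where
    put                      : (x k : ℕ) {x>3 : T (3 <ᵇ x)} {k≤2 : T (k ≤ᵇ 2)} → Stmt
    minus quotient remainder : (x y z : ℕ) {x>3 : T (3 <ᵇ x)} → Stmt
    mulMod addMod            : (x y z : ℕ) {x>3 : T (3 <ᵇ x)} → Stmt

  compile₁ : Stmt → Program
  compile₁ (put x k)         = const x k ∷ []
  compile₁ (minus x y z)     = arith sub x y z ∷ []
  compile₁ (quotient x y z)  = arith quo x y z ∷ []
  compile₁ (remainder x y z) = arith rem x y z ∷ []
  compile₁ (mulMod x y z)    = arith mul x y z ∷ arith rem x x 0 ∷ []
  compile₁ (addMod x y z)    = arith add x y z ∷ arith rem x x 0 ∷ []

  compile : List Stmt → Program
  compile = concatMap compile₁

  -- The modular operations keep both writes of the compiled pair. The result is then literally the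
  -- memory reached by the machine, and no two memories need to be identified by extensionality.
  exec₁ : Stmt → Memory → Memory
  exec₁ (put x k) μ         = μ [ x ↦ k ]
  exec₁ (minus x y z) μ     = μ [ x ↦ μ y ∸ μ z ]
  exec₁ (quotient x y z) μ  = μ [ x ↦ apply quo (μ y) (μ z) ]
  exec₁ (remainder x y z) μ = μ [ x ↦ apply rem (μ y) (μ z) ]
  exec₁ (mulMod x y z) μ    = μ [ x ↦ μ y * μ z ] [ x ↦ apply rem (μ y * μ z) (μ 0) ]
  exec₁ (addMod x y z) μ    = μ [ x ↦ μ y + μ z ] [ x ↦ apply rem (μ y + μ z) (μ 0) ]

  exec : List Stmt → Memory → Memory
  exec []       μ = μ
  exec (s ∷ ss) μ = exec ss (exec₁ s μ)

  -- A syntactic check that computes, so that frame conditions for concrete programs hold by `refl`.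
  -- The target of `store` is known only at run time, hence it counts as touching every cell.
  untouched : ℕ → Program → Bool
  untouched y []                   = true
  untouched y (const x k ∷ r)      = not (x ≡ᵇ y) ∧ untouched y r
  untouched y (arith o x _ _ ∷ r)  = not (x ≡ᵇ y) ∧ untouched y r
  untouched y (load x _ ∷ r)       = not (x ≡ᵇ y) ∧ untouched y r
  untouched y (store _ _ ∷ r)      = false
  untouched y (toss x ∷ r)         = not (x ≡ᵇ y) ∧ untouched y r
  untouched y (branch x p q ∷ r)   = (untouched y p ∧ untouched y q) ∧ untouched y r
  untouched y (while x p ∷ r)      = untouched y p ∧ untouched y r

  Frame : Program → Memory → Memory → Set
  Frame p μ ν = ∀ y → untouched y p ≡ true → ν y ≡ μ y

  ∧-true : ∀ {a b} → a ∧ b ≡ true → a ≡ true × b ≡ true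
  ∧-true {true} {true} _ = refl , refl

  untouched-++ : ∀ y p q → untouched y (p ++ q) ≡ untouched y p ∧ untouched y q
  untouched-++ y []                  q = refl
  untouched-++ y (const x k ∷ r)     q rewrite untouched-++ y r q = sym (∧-assoc (not (x ≡ᵇ y)) _ _)
  untouched-++ y (arith o x _ _ ∷ r) q rewrite untouched-++ y r q = sym (∧-assoc (not (x ≡ᵇ y)) _ _)
  untouched-++ y (load x _ ∷ r)      q rewrite untouched-++ y r q = sym (∧-assoc (not (x ≡ᵇ y)) _ _)
  untouched-++ y (store _ _ ∷ r)     q = refl
  untouched-++ y (toss x ∷ r)        q rewrite untouched-++ y r q = sym (∧-assoc (not (x ≡ᵇ y)) _ _)
  untouched-++ y (branch x a b ∷ r)  q rewrite untouched-++ y r q = sym (∧-assoc (untouched y a ∧ untouched y b) _ _)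
  untouched-++ y (while x a ∷ r)     q rewrite untouched-++ y r q = sym (∧-assoc (untouched y a) _ _)

  frame-trans : ∀ {p μ ν ξ} → Frame p μ ν → Frame p ν ξ → Frame p μ ξ
  frame-trans f g y u = trans (g y u) (f y u)

  frame-++ : ∀ {p q μ ν ξ} → Frame p μ ν → Frame q ν ξ → Frame (p ++ q) μ ξ
  frame-++ {p} {q} f g y u with ∧-true {untouched y p} (trans (sym (untouched-++ y p q)) u)
  ... | a , b = trans (g y b) (f y a)

  update-same : ∀ μ x v → (μ [ x ↦ v ]) x ≡ v
  update-same μ x v with x ≡ᵇ x in eq
  ... | true  = refl
  ... | false = ⊥-elim (subst T eq (≡⇒≡ᵇ x x refl))

  update-other : ∀ μ x v y → not (x ≡ᵇ y) ≡ true → (μ [ x ↦ v ]) y ≡ μ y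
  update-other μ x v y u with x ≡ᵇ y
  ... | false = refl

  frame-exec₁ : ∀ s μ → Frame (compile₁ s) μ (exec₁ s μ)
  frame-exec₁ (put x k) μ y u         = update-other μ x _ y (proj₁ (∧-true u))
  frame-exec₁ (minus x _ _) μ y u     = update-other μ x _ y (proj₁ (∧-true u))
  frame-exec₁ (quotient x _ _) μ y u  = update-other μ x _ y (proj₁ (∧-true u))
  frame-exec₁ (remainder x _ _) μ y u = update-other μ x _ y (proj₁ (∧-true u))
  frame-exec₁ (mulMod x a b) μ y u    = let u′ = proj₁ (∧-true u) in
    trans (update-other (μ [ x ↦ μ a * μ b ]) x _ y u′) (update-other μ x _ y u′)
  frame-exec₁ (addMod x a b) μ y u    = let u′ = proj₁ (∧-true u) in
    trans (update-other (μ [ x ↦ μ a + μ b ]) x _ y u′) (update-other μ x _ y u′)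

  frame-exec : ∀ ss μ → Frame (compile ss) μ (exec ss μ)
  frame-exec []       μ = λ _ _ → refl
  frame-exec (s ∷ ss) μ = frame-++ {compile₁ s} {compile ss} (frame-exec₁ s μ) (frame-exec ss (exec₁ s μ))

  bits-mono : ∀ {a b} → a ≤ b → bits a ≤ bits b
  bits-mono {a} {b} a≤b = s≤s (⌊log₂⌋-mono-≤ a≤b)

  quasilinear-mono : ∀ {a b} → a ≤ b → quasilinear a ≤ quasilinear b
  quasilinear-mono {a} {b} a≤b = *-mono-≤ a≤b (bits-mono {a} {b} a≤b)

  m≤quasilinear : ∀ m → m ≤ quasilinear m
  m≤quasilinear m = m≤m*n m (bits m)

  opCost≤ : ∀ o {a b M} → a ≤ M → b ≤ M → opCost o a b ≤ quasilinear (bits M + bits M)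
  opCost≤ o {a} {b} {M} a≤M b≤M = go o
    where
    s : bits a + bits b ≤ bits M + bits M
    s = +-mono-≤ (bits-mono a≤M) (bits-mono b≤M)
    go : ∀ o → opCost o a b ≤ quasilinear (bits M + bits M)
    go add = ≤-trans s (m≤quasilinear _)
    go sub = ≤-trans s (m≤quasilinear _)
    go mul = quasilinear-mono s
    go quo = quasilinear-mono s
    go rem = quasilinear-mono s

  apply-rem≤ : ∀ a b → apply rem a b ≤ a
  apply-rem≤ a zero    = ≤-refl
  apply-rem≤ a (suc b) = m%n≤m a (suc b)

  apply-rem< : ∀ a {b} → 0 < b → apply rem a b < b
  apply-rem< a {suc b} _ = m%n<n a (suc b)

  apply-quo≤ : ∀ a b → apply quo a b ≤ a
  apply-quo≤ a zero    = z≤n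
  apply-quo≤ a (suc b) = m/n≤m a (suc b)

  -- Sums and products of cells bounded by n are formed before they are reduced, so operands may be
  -- as large as n * n.
  unitCost : ℕ → ℕ
  unitCost n = quasilinear (bits (n * n) + bits (n * n))

  -- The unit of cost is a variable `W` with an equation, so that it remains an atom in all cost
  -- arithmetic.
  module Bounded (n : ℕ) (3≤n : 3 ≤ n) (W : ℕ) (W≡ : W ≡ unitCost n) where

    n≤n*n : n ≤ n * n
    n≤n*n = m≤m*n n n {{>-nonZero (≤-trans (s≤s z≤n) 3≤n)}}

    opCost≤W : ∀ o {a b} → a ≤ n * n → b ≤ n * n → opCost o a b ≤ W
    opCost≤W o {a} {b} a≤ b≤ = subst (opCost o a b ≤_) (sym W≡) (opCost≤ o a≤ b≤)

    bits≤W : ∀ {v} → v ≤ n → bits v ≤ W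
    bits≤W {v} v≤n = subst (bits v ≤_) (sym W≡)
      (≤-trans (bits-mono {v} (≤-trans v≤n n≤n*n)) (≤-trans (m≤m+n _ (bits (n * n))) (m≤quasilinear _)))

    1≤W : 1 ≤ W
    1≤W = ≤-trans (s≤s z≤n) (bits≤W {0} z≤n)

    record Good (μ : Memory) : Set where
      constructor good
      field
        cell₀ : μ 0 ≡ n
        cell₁ : μ 1 ≡ 1
        cell₂ : μ 2 ≡ 2
        cell₃ : μ 3 ≡ 0
        bound : ∀ x → μ x ≤ n
    open Good public

    good-update : ∀ {μ} x v {x>3 : T (3 <ᵇ x)} → Good μ → v ≤ n → Good (μ [ x ↦ v ])
    good-update {μ} x@(suc (suc (suc (suc _)))) v (good c₀ c₁ c₂ c₃ b) v≤n = good c₀ c₁ c₂ c₃ below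
      where
      below : ∀ y → (μ [ x ↦ v ]) y ≤ n
      below y with x ≡ᵇ y
      ... | true  = v≤n
      ... | false = b y

    good-update₂ : ∀ {μ} x u v {x>3 : T (3 <ᵇ x)} → Good μ → v ≤ n → Good (μ [ x ↦ u ] [ x ↦ v ])
    good-update₂ {μ} x@(suc (suc (suc (suc _)))) u v (good c₀ c₁ c₂ c₃ b) v≤n = good c₀ c₁ c₂ c₃ below
      where
      below : ∀ y → (μ [ x ↦ u ] [ x ↦ v ]) y ≤ n
      below y with x ≡ᵇ y
      ... | true  = v≤n
      ... | false = b y

    0<n : 0 < n
    0<n = ≤-trans (s≤s z≤n) 3≤n

    mod≤n : ∀ {μ} a → Good μ → apply rem a (μ 0) ≤ n
    mod≤n a g rewrite cell₀ g = <⇒≤ (apply-rem< a 0<n)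

    good-exec₁ : ∀ s {μ} → Good μ → Good (exec₁ s μ)
    good-exec₁ (put x k {x>3} {k≤2}) g       = good-update x k {x>3} g (≤-trans (≤ᵇ⇒≤ k 2 k≤2) (≤-trans (s≤s (s≤s z≤n)) 3≤n))
    good-exec₁ (minus x y z {x>3}) {μ} g     = good-update x _ {x>3} g (≤-trans (m∸n≤m (μ y) (μ z)) (bound g y))
    good-exec₁ (quotient x y z {x>3}) {μ} g  = good-update x _ {x>3} g (≤-trans (apply-quo≤ (μ y) (μ z)) (bound g y))
    good-exec₁ (remainder x y z {x>3}) {μ} g = good-update x _ {x>3} g (≤-trans (apply-rem≤ (μ y) (μ z)) (bound g y))
    good-exec₁ (mulMod x y z {x>3}) {μ} g    = good-update₂ x _ _ {x>3} g (mod≤n (μ y * μ z) g)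
    good-exec₁ (addMod x y z {x>3}) {μ} g    = good-update₂ x _ _ {x>3} g (mod≤n (μ y + μ z) g)

    good-exec : ∀ ss {μ} → Good μ → Good (exec ss μ)
    good-exec []       g = g
    good-exec (s ∷ ss) g = good-exec ss (good-exec₁ s g)

    private variable
      p q : Program
      μ   : Memory
      K L : ℕ
      Q R : Memory → Set

    -- Deterministic total correctness with running time at most K * W, in
    -- continuation-passing style: whatever is guaranteed for the rest of the
    -- program after p is guaranteed from the start.
    record Det (p : Program) (μ : Memory) (K : ℕ) (Q : Memory → Set) : Set₁ where
      constructor det
      field
        continue : ∀ {rest P A B} →
          (∀ {ν} → Good ν → Frame p μ ν → Q ν → Outcome ⟨ rest , ν ⟩ P A B) →
          Outcome ⟨ p ++ rest , μ ⟩ P (K * W + A) (fromℕ (K * W) ℚ.+ B)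
    open Det public

    private
      cost-+ : ∀ K L A → K * W + (L * W + A) ≡ (K + L) * W + A
      cost-+ K L A = lemma K L A W
        where
        lemma : ∀ K L A W → K * W + (L * W + A) ≡ (K + L) * W + A
        lemma = solve-∀

      cost-+ℚ : ∀ K L B → fromℕ (K * W) ℚ.+ (fromℕ (L * W) ℚ.+ B) ≡ fromℕ ((K + L) * W) ℚ.+ B
      cost-+ℚ K L B = trans (sym (ℚ.+-assoc (fromℕ (K * W)) (fromℕ (L * W)) B))
        (cong (ℚ._+ B) (trans (sym (fromℕ-+ (K * W) (L * W))) (cong fromℕ (sym (*-distribʳ-+ W K L)))))

      cost≤ : ∀ {k} → k ≤ W → k ≤ 1 * W
      cost≤ h = ≤-trans h (≤-reflexive (sym (+-identityʳ W)))

    delay : ∀ {τ P A B K L} → Outcome′ τ P (K * W + (L * W + A)) (fromℕ (K * W) ℚ.+ (fromℕ (L * W) ℚ.+ B)) →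
            Outcome′ τ P ((K + L) * W + A) (fromℕ ((K + L) * W) ℚ.+ B)
    delay {A = A} {B} {K} {L} = weaken (≤-reflexive (cost-+ K L A)) (ℚ.≤-reflexive (cost-+ℚ K L B))

    charge : ∀ {τ P A B} → K ≤ L → Outcome′ τ P (K * W + A) (fromℕ (K * W) ℚ.+ B) →
             Outcome′ τ P (L * W + A) (fromℕ (L * W) ℚ.+ B)
    charge {A = A} {B} K≤L = weaken (+-monoˡ-≤ A (*-monoˡ-≤ W K≤L)) (ℚ.+-monoˡ-≤ B (fromℕ-mono (*-monoˡ-≤ W K≤L)))

    one : ∀ {k c P A B} → k ≤ W → Outcome c P A B → Outcome′ (proceed k c) P (1 * W + A) (fromℕ (1 * W) ℚ.+ B)
    one k≤W = proceeding (cost≤ k≤W)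

    consequence : Det p μ K Q → K ≤ L → (∀ {ν} → Good ν → Frame p μ ν → Q ν → R ν) → Det p μ L R
    consequence d K≤L Q⇒R .continue k = charge K≤L (d .continue λ g f q → k g f (Q⇒R g f q))

    skip : Good μ → Q μ → Det [] μ 0 Q
    skip g q .continue {B = B} k = weaken ≤-refl (ℚ.≤-reflexive (sym (ℚ.+-identityˡ B))) (k g (λ _ _ → refl) q)

    seq : Det p μ K Q → (∀ {ν} → Good ν → Frame p μ ν → Q ν → Det q ν L R) → Det (p ++ q) μ (K + L) R
    seq {p} {μ} {K} {q = q} {L} d d′ .continue {rest} {P} {A} {B} k =
      subst (λ r → Outcome ⟨ r , μ ⟩ P ((K + L) * W + A) (fromℕ ((K + L) * W) ℚ.+ B)) (sym (++-assoc p q rest))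
        (delay {K = K} {L} (d .continue λ g f x → d′ g f x .continue λ g′ f′ y → k g′ (frame-++ {p} {q} f f′) y))

    statement : ∀ s → Good μ → Det (compile₁ s) μ 2 (_≡ exec₁ s μ)
    statement {μ} s g .continue {rest} {P} {A} {B} k = go s (k (good-exec₁ s g) (frame-exec₁ s μ) refl)
      where
      n² : ∀ {v} → v ≤ n → v ≤ n * n
      n² h = ≤-trans h n≤n*n
      go : ∀ s → Outcome ⟨ rest , exec₁ s μ ⟩ P A B →
           Outcome ⟨ compile₁ s ++ rest , μ ⟩ P (2 * W + A) (fromℕ (2 * W) ℚ.+ B)
      go (put x k {k≤2 = k≤2}) o     = charge {K = 1} {L = 2} (s≤s z≤n) (one (bits≤W (≤-trans (≤ᵇ⇒≤ k 2 k≤2) (≤-trans (s≤s (s≤s z≤n)) 3≤n))) o)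
      go (minus x y z) o       = charge {K = 1} {L = 2} (s≤s z≤n) (one (opCost≤W sub (n² (bound g y)) (n² (bound g z))) o)
      go (quotient x y z) o    = charge {K = 1} {L = 2} (s≤s z≤n) (one (opCost≤W quo (n² (bound g y)) (n² (bound g z))) o)
      go (remainder x y z) o   = charge {K = 1} {L = 2} (s≤s z≤n) (one (opCost≤W rem (n² (bound g y)) (n² (bound g z))) o)
      -- With a successor as target, the lookup of the modulus in cell 0 computes through the first
      -- write.
      go (mulMod x@(suc _) y z) o = delay {K = 1} {1} (one (opCost≤W mul (n² (bound g y)) (n² (bound g z)))
        (one (opCost≤W rem (subst (_≤ n * n) (sym (update-same μ x v)) (*-mono-≤ (bound g y) (bound g z))) (n² (bound g 0)))
          (subst (λ w → Outcome ⟨ rest , μ [ x ↦ v ] [ x ↦ apply rem w (μ 0) ] ⟩ P A B) (sym (update-same μ x v)) o)))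
        where
        v : ℕ
        v = μ y * μ z
      go (addMod x@(suc _) y z) o = delay {K = 1} {1} (one (opCost≤W add (n² (bound g y)) (n² (bound g z)))
        (one (opCost≤W rem (subst (_≤ n * n) (sym (update-same μ x v)) (≤-trans (+-mono-≤ (bound g y) (bound g z)) 2n≤n²)) (n² (bound g 0)))
          (subst (λ w → Outcome ⟨ rest , μ [ x ↦ v ] [ x ↦ apply rem w (μ 0) ] ⟩ P A B) (sym (update-same μ x v)) o)))
        where
        v : ℕ
        v = μ y + μ z
        2n≤n² : n + n ≤ n * n
        2n≤n² = ≤-trans (≤-reflexive (cong (λ m → n + m) (sym (+-identityʳ n)))) (*-monoˡ-≤ n (≤-trans (s≤s (s≤s z≤n)) 3≤n))

    blockCost : List Stmt → ℕ
    blockCost []       = 0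
    blockCost (s ∷ ss) = 2 + blockCost ss

    block′ : ∀ ss → Good μ → Det (compile ss) μ (blockCost ss) (_≡ exec ss μ)
    block′ []       g = skip g refl
    block′ (s ∷ ss) g = seq {p = compile₁ s} (statement s g) λ { g′ _ refl → block′ ss g′ }

    block : ∀ ss → Good μ → Q (exec ss μ) → Det (compile ss) μ (blockCost ss) Q
    block {Q = Q} ss g q = consequence {p = compile ss} (block′ ss g) ≤-refl λ { _ _ refl → q }

    choose : ∀ x → Good μ → (μ x ≢ 0 → Det p μ K Q) → (μ x ≡ 0 → Det q μ K Q) →
             Det (branch x p q ∷ []) μ (1 + K) Q
    choose {μ} {p} {K} {Q} {q} x g d d′ .continue {rest} k with μ x in eq | bound g x
    ... | zero  | _ = delay {K = 1} {K} (one 1≤W (d′ refl .continue λ g′ f → k g′ λ y u →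
      f y (proj₂ (∧-true {untouched y p} (trans (sym (∧-identityʳ _)) u)))))
    ... | suc m | b = delay {K = 1} {K} (one (bits≤W b) (d (λ ()) .continue λ g′ f → k g′ λ y u →
      f y (proj₁ (∧-true {untouched y p} (trans (sym (∧-identityʳ _)) u)))))

    -- The index of `J` is the number of iterations still allowed, not a value that the program
    -- knows: the guard may vanish early, hence the existential index in the conclusion. Each
    -- iteration pays one unit for its guard, and the last guard gives the leading 1.
    loop : ∀ x (J : ℕ → Memory → Set) → Good μ →
           (∀ {ν} → J 0 ν → ν x ≡ 0) →
           (∀ r {ν} → Good ν → Frame p μ ν → J (suc r) ν → ν x ≢ 0 → Det p ν K (J r)) →
           ∀ r → J r μ → Det (while x p ∷ []) μ (1 + r * (1 + K)) (λ ν → ν x ≡ 0 × ∃[ r′ ] J r′ ν)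
    loop {μ} {p} {K} x J g stop body r j .continue {rest} {P} {A} {B} k = go r g (λ _ _ → refl) j
      where
      go : ∀ r {ν} → Good ν → Frame p μ ν → J r ν →
           Outcome ⟨ while x p ∷ rest , ν ⟩ P ((1 + r * (1 + K)) * W + A) (fromℕ ((1 + r * (1 + K)) * W) ℚ.+ B)
      go r {ν} g f j with ν x in eq | bound g x
      go r {ν} g f j | zero | _ = charge {K = 1} {L = 1 + r * (1 + K)} (s≤s z≤n) (one 1≤W (k g (λ y u → f y (trans (sym (∧-identityʳ _)) u)) (eq , r , j)))
      go zero {ν} g f j | suc m | b = contradiction (trans (sym eq) (stop j)) λ ()
      go (suc r) {ν} g f j | suc m | b = charge (≤-reflexive (cong suc (lemma K (r * suc K))))
        (delay {K = 1} {K + (1 + r * (1 + K))} (one (bits≤W b)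
          (delay {K = K} {1 + r * (1 + K)} (body r g f j (λ z → contradiction (trans (sym eq) z) λ ()) .continue λ g′ f′ j′ → go r g′ (frame-trans {p} f f′) j′))))
        where
        lemma : ∀ K s → K + suc s ≡ suc (K + s)
        lemma = solve-∀

-- The program

module Algorithm where

  open Machine
  open import Data.Nat using (ℕ)
  open import Data.List using (List; []; _∷_; _++_)

  #n #one #two #zero #e #t #a #f #c #ok #d #β #b #y #s #u₀ #u₁ #w₀ #w₁ #z #g #h #k #B #q₀ #q₁ #r₀ #r₁ : ℕ
  #n    = 0
  #one  = 1
  #two  = 2
  #zero = 3
  #e    = 4
  #t    = 5
  #a    = 6
  #f    = 7
  #c    = 8
  #ok   = 9
  #d    = 10
  #β    = 11
  #b    = 12
  #y    = 13
  #s    = 14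
  #u₀   = 15
  #u₁   = 16
  #w₀   = 17
  #w₁   = 18
  #z    = 19
  #g    = 20
  #h    = 21
  #k    = 22
  #B    = 23
  #q₀   = 24
  #q₁   = 25
  #r₀   = 26
  #r₁   = 27

  -- Arithmetic in (ℤ/n)[X]/(X² - B): the pairs (q₀ , q₁) and (r₀ , r₁) stand
  -- for q₀ + q₁X and r₀ + r₁X.
  multiply square : List Stmt
  multiply =
      mulMod #g #r₁ #q₁ ∷ mulMod #g #g #B
    ∷ mulMod #h #r₀ #q₁ ∷ mulMod #r₁ #r₁ #q₀ ∷ addMod #r₁ #r₁ #h
    ∷ mulMod #r₀ #r₀ #q₀ ∷ addMod #r₀ #r₀ #g ∷ []
  square =
      mulMod #g #q₁ #q₁ ∷ mulMod #g #g #B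
    ∷ mulMod #q₁ #q₀ #q₁ ∷ addMod #q₁ #q₁ #q₁
    ∷ mulMod #q₀ #q₀ #q₀ ∷ addMod #q₀ #q₀ #g
    ∷ quotient #k #k #two ∷ []

  power-init power-parity : List Stmt
  power-init   = put #r₀ 1 ∷ put #r₁ 0 ∷ []
  power-parity = remainder #f #k #two ∷ []

  power-body power : Program
  power-body = compile power-parity ++ (branch #f (compile multiply) [] ∷ []) ++ compile square
  power      = compile power-init ++ (while #k power-body ∷ [])

  -- Recovers e and t by halving n - 1 until it is odd. The flag `#f` is 1 while the number is even,
  -- which it is at the outset as n is odd. `#c` receives the number 2e of tosses.
  setup-init setup-body setup-final : List Stmt
  setup-init  = minus #k #n #one ∷ put #e 0 ∷ put #f 1 ∷ []
  setup-body  = addMod #e #e #one ∷ quotient #k #k #two ∷ remainder #f #k #two ∷ minus #f #one #f ∷ []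
  setup-final = addMod #t #k #zero ∷ put #a 0 ∷ addMod #c #e #e ∷ []

  setup : Program
  setup = compile setup-init ++ (while #f (compile setup-body) ∷ []) ++ compile setup-final

  -- Since 2 ^ (2e) exceeds n, the sample is close to uniform modulo n.
  sample-update : List Stmt
  sample-update = addMod #a #a #a ∷ addMod #a #a #f ∷ minus #c #c #one ∷ []

  sample-body sample : Program
  sample-body = toss #f ∷ compile sample-update
  sample      = while #c sample-body ∷ []

  -- `#y` runs through the iterated squares of b = x ^ t, and `#d` is the number of square root
  -- steps still due. Rejection is provisional: it is written before the search and overwritten by
  -- `level-found`. If b is idempotent, the climb starts from -1 at level 0, that is, with β = 1.
  level-power level-init level-reject level-accept level-test level-found level-next : List Stmt
  level-power  = put #B 0 ∷ addMod #q₀ #a #zero ∷ put #q₁ 0 ∷ addMod #k #t #zero ∷ []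
  level-init   =
      addMod #b #r₀ #zero ∷ addMod #y #r₀ #zero ∷ addMod #c #e #zero
    ∷ mulMod #g #b #b ∷ minus #h #n #b ∷ addMod #g #g #h ∷ []
  level-reject = put #ok 0 ∷ put #d 0 ∷ []
  level-accept = put #ok 1 ∷ minus #d #e #one ∷ put #β 1 ∷ []
  level-test   = addMod #g #y #one ∷ []
  level-found  = put #ok 1 ∷ minus #d #c #one ∷ minus #β #n #b ∷ []
  level-next   = mulMod #y #y #y ∷ minus #c #c #one ∷ []

  level-body level : Program
  level-body = compile level-test ++ (branch #g [] (compile level-found) ∷ []) ++ compile level-next
  level      =
       compile level-power ++ power
    ++ compile level-init ++ (branch #g (compile level-reject) (compile level-accept) ∷ [])
    ++ (while #c level-body ∷ [])

  -- All 2t + 2 candidates are tried in descending order without an early exit; a later success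
  -- overwrites an earlier one.
  shift-init shift-power shift-test shift-good shift-next : List Stmt
  shift-init  = addMod #s #t #t ∷ addMod #s #s #two ∷ addMod #B #β #zero ∷ []
  shift-power = addMod #q₀ #s #zero ∷ put #q₁ 1 ∷ addMod #k #t #zero ∷ []
  shift-test  =
      mulMod #g #s #s ∷ minus #h #n #β ∷ addMod #g #g #h
    ∷ mulMod #g #g #r₀ ∷ mulMod #g #g #r₁ ∷ []
  shift-good  = addMod #u₀ #r₀ #zero ∷ addMod #u₁ #r₁ #zero ∷ []
  shift-next  = minus #s #s #one ∷ []

  shift-body shift : Program
  shift-body = compile shift-power ++ power ++ compile shift-test
            ++ (branch #g (compile shift-good) [] ∷ []) ++ compile shift-next
  shift      = compile shift-init ++ (while #s shift-body ∷ [])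

  -- The tested value u₀² + βu₁² is also the constant coefficient of (u₀ + u₁X)², so `#g` is reused
  -- as the next u₀.
  squares-init squares-test squares-found squares-next : List Stmt
  squares-init  = addMod #c #e #zero ∷ []
  squares-test  = mulMod #g #u₁ #u₁ ∷ mulMod #g #g #β ∷ mulMod #h #u₀ #u₀ ∷ addMod #g #h #g ∷ []
  squares-found = addMod #w₀ #u₀ #zero ∷ addMod #w₁ #u₁ #zero ∷ []
  squares-next  = mulMod #u₁ #u₀ #u₁ ∷ addMod #u₁ #u₁ #u₁ ∷ addMod #u₀ #g #zero ∷ minus #c #c #one ∷ []

  squares-body squares : Program
  squares-body = compile squares-test ++ (branch #g [] (compile squares-found) ∷ []) ++ compile squares-next
  squares      = compile squares-init ++ (while #c squares-body ∷ [])

  -- Division by w₁ is multiplication by its power n - 2, an inverse for n prime and w₁ nonzero. The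
  -- test of z² + β makes the outcome trustworthy for every n.
  root-power root-test root-fail root-success : List Stmt
  root-power   = put #B 0 ∷ addMod #q₀ #w₁ #zero ∷ put #q₁ 0 ∷ minus #k #n #two ∷ []
  root-test    = mulMod #z #w₀ #r₀ ∷ mulMod #g #z #z ∷ addMod #g #g #β ∷ []
  root-fail    = put #ok 0 ∷ put #d 0 ∷ []
  root-success = addMod #β #z #zero ∷ minus #d #d #one ∷ []

  root root-step chain main : Program
  root      = compile root-power ++ power ++ compile root-test
           ++ (branch #g (compile root-fail) (compile root-success) ∷ [])
  root-step = shift ++ squares ++ root
  chain     = while #d root-step ∷ []
  main      = level ++ chain

  proth-test : Program
  proth-test = const #one 1 ∷ const #two 2 ∷ setup ++ sample ++ main ++ (arith add #n #ok #zero ∷ [])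

-- Arithmetic modulo n and fast exponentiation

module Power where

  open Congruence
  open Machine
  open Algorithm
  open import Data.Integer using (ℤ; +_; _+_; _*_; _-_; -_; _^_; 0ℤ; 1ℤ)
  import Data.Integer.Properties as ℤ
  open import Data.Integer.Tactic.RingSolver using (solve-∀)
  open import Data.Nat as ℕ using (ℕ; zero; suc; _∸_; _≤_; _<_)
  import Data.Nat.Properties as ℕ
  import Data.Nat.DivMod as ℕ

  open import Data.Bool using (true; false; if_then_else_)
  open import Data.List using (List; []; _∷_)
  open import Data.Product using (_×_; _,_)

  open import Relation.Nullary using (contradiction)
  open import Relation.Binary.PropositionalEquality hiding (J)

  ≈%  : ∀ a n → + apply rem a n ≈ + a [ n ]
  ≈% a zero    = ≈-refl
  ≈% a (suc n) = ≈-sym (cong-by (+ (a ℕ./ suc n)) (trans (cong +_ (ℕ.m≡m%n+[m/n]*n a (suc n)))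
    (trans (ℤ.pos-+ (a ℕ.% suc n) _) (cong (λ z → + (a ℕ.% suc n) + z) (ℤ.pos-* (a ℕ./ suc n) (suc n))))))

  *-^0 : ∀ x y {k} → k ≡ 0 → x ≡ x * y ^ k
  *-^0 x y refl = sym (ℤ.*-identityʳ x)

  *-^1 : ∀ x y {k} → k ≡ 1 → x * y ≡ x * y ^ k
  *-^1 x y refl = cong (x *_) (sym (ℤ.*-identityʳ y))

  -- One binary digit: j is the digit moved into the accumulator r, and k the remaining exponent of
  -- the squared base.
  shift-exponent : ∀ {n r r′ q s} j k → r′ ≈ r * q ^ j [ n ] → s ≈ q * q [ n ] →
                   r′ * s ^ k ≈ r * q ^ (j ℕ.+ k ℕ.* 2) [ n ]
  shift-exponent {r = r} {q = q} j k r′≈ s≈ = ≈-trans (*-cong r′≈ (^-cong k s≈)) (≈-reflexive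
    (trans (ℤ.*-assoc r (q ^ j) ((q * q) ^ k)) (cong (r *_)
      (trans (cong (q ^ j *_) (trans (cong (λ x → (q * x) ^ k) (sym (ℤ.*-identityʳ q))) (trans (ℤ.^-*-assoc q 2 k) (cong (q ^_) (ℕ.*-comm 2 k)))))
        (sym (ℤ.^-distribˡ-+-* q j (k ℕ.* 2)))))))

  small-rem : ∀ {a n} → a < n → apply rem a n ≡ a
  small-rem {n = suc n} lt = ℕ.m<n⇒m%n≡m lt

  _[_↦_]ᶻ : (ℕ → ℤ) → ℕ → ℤ → (ℕ → ℤ)
  (ρ [ x ↦ v ]ᶻ) y = if x ℕ.≡ᵇ y then v else ρ y

  -- Symbolic execution over ℤ, valid modulo n.
  residues₁ : Stmt → Memory → (ℕ → ℤ) → (ℕ → ℤ)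
  residues₁ (mulMod x y z)    μ ρ = ρ [ x ↦ ρ y * ρ z ]ᶻ
  residues₁ (addMod x y z)    μ ρ = ρ [ x ↦ ρ y + ρ z ]ᶻ
  residues₁ (minus x zero z)  μ ρ = ρ [ x ↦ - ρ z ]ᶻ
  residues₁ (put x k)         μ ρ = ρ [ x ↦ + k ]ᶻ
  residues₁ s@(minus x _ _)     μ ρ = ρ [ x ↦ + exec₁ s μ x ]ᶻ
  residues₁ s@(quotient x _ _)  μ ρ = ρ [ x ↦ + exec₁ s μ x ]ᶻ
  residues₁ s@(remainder x _ _) μ ρ = ρ [ x ↦ + exec₁ s μ x ]ᶻ

  residues′ : List Stmt → Memory → (ℕ → ℤ) → (ℕ → ℤ)
  residues′ []       μ ρ = ρ
  residues′ (s ∷ ss) μ ρ = residues′ ss (exec₁ s μ) (residues₁ s μ ρ)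

  residues : List Stmt → Memory → ℕ → ℤ
  residues ss μ = residues′ ss μ (λ x → + μ x)

  module PowerSpec (n : ℕ) (3≤n : 3 ≤ n) (W : ℕ) (W≡ : W ≡ unitCost n) where
    open Bounded n 3≤n W W≡

    Represents : Memory → (ℕ → ℤ) → Set
    Represents μ ρ = ∀ x → + μ x ≈ ρ x [ n ]

    represents-update : ∀ {μ ρ} x {v w} → Represents μ ρ → + v ≈ w [ n ] → Represents (μ [ x ↦ v ]) (ρ [ x ↦ w ]ᶻ)
    represents-update x r h y with x ℕ.≡ᵇ y
    ... | true  = h
    ... | false = r y

    represents-update₂ : ∀ {μ ρ} x u {v w} → Represents μ ρ → + v ≈ w [ n ] → Represents (μ [ x ↦ u ] [ x ↦ v ]) (ρ [ x ↦ w ]ᶻ)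
    represents-update₂ x u r h y with x ℕ.≡ᵇ y
    ... | true  = h
    ... | false = r y

    rem≈ : ∀ {μ} → Good μ → ∀ a → + apply rem a (μ 0) ≈ + a [ n ]
    rem≈ g a = subst (λ m → + apply rem a m ≈ + a [ n ]) (sym (cell₀ g)) (≈% a n)

    -- No truncation occurs because every cell is at most n. This is why `residues₁` may treat
    -- subtraction from cell 0, and no other subtraction, as an operation modulo n.
    neg≈ : ∀ {μ} → Good μ → ∀ x → + (μ 0 ∸ μ x) ≈ - (+ μ x) [ n ]
    neg≈ {μ} g x = subst (λ m → + (m ∸ μ x) ≈ - (+ μ x) [ n ]) (sym (cell₀ g))
      (cong-by 1ℤ (trans (sym (trans (ℤ.m-n≡m⊖n n (μ x)) (ℤ.⊖-≥ (bound g x)))) (lemma (+ n) (+ μ x))))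
      where
      lemma : ∀ n x → n - x ≡ - x + 1ℤ * n
      lemma = solve-∀

    represents-exec₁ : ∀ s {μ ρ} → Good μ → Represents μ ρ → Represents (exec₁ s μ) (residues₁ s μ ρ)
    represents-exec₁ (mulMod x y z) {μ} g r = represents-update₂ x _ r
      (≈-trans (rem≈ g (μ y ℕ.* μ z)) (≈-trans (≈-reflexive (ℤ.pos-* (μ y) (μ z))) (*-cong (r y) (r z))))
    represents-exec₁ (addMod x y z) {μ} g r = represents-update₂ x _ r
      (≈-trans (rem≈ g (μ y ℕ.+ μ z)) (≈-trans (≈-reflexive (ℤ.pos-+ (μ y) (μ z))) (+-cong (r y) (r z))))
    represents-exec₁ (minus x zero z) g r  = represents-update x r (≈-trans (neg≈ g z) (-‿cong (r z)))
    represents-exec₁ (put x k) g r         = represents-update x r ≈-refl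
    represents-exec₁ s@(minus x (suc y) z) {μ} g r = represents-update x r (≈-reflexive (cong +_ (sym (update-same μ x _))))
    represents-exec₁ (quotient x y z)  {μ} g r = represents-update x r (≈-reflexive (cong +_ (sym (update-same μ x _))))
    represents-exec₁ (remainder x y z) {μ} g r = represents-update x r (≈-reflexive (cong +_ (sym (update-same μ x _))))

    represents-exec′ : ∀ ss {μ ρ} → Good μ → Represents μ ρ → Represents (exec ss μ) (residues′ ss μ ρ)
    represents-exec′ []       g r = r
    represents-exec′ (s ∷ ss) g r = represents-exec′ ss (good-exec₁ s g) (represents-exec₁ s g r)

    represents-exec : ∀ ss {μ} → Good μ → Represents (exec ss μ) (residues ss μ)
    represents-exec ss g = represents-exec′ ss g (λ _ → ≈-refl)

    exec-multiply : ∀ {μ} → Good μ → ∀ {α} → α * α ≈ + μ #B [ n ] →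
      + exec multiply μ #r₀ + + exec multiply μ #r₁ * α ≈ (+ μ #r₀ + + μ #r₁ * α) * (+ μ #q₀ + + μ #q₁ * α) [ n ]
    exec-multiply {μ} g {α} α² = ≈-trans
      (+-cong (represents-exec multiply g #r₀) (*-cong (represents-exec multiply g #r₁) (≈-refl {α})))
      (combine (- (+ μ #r₁ * + μ #q₁)) α² (lemma (+ μ #r₀) (+ μ #r₁) (+ μ #q₀) (+ μ #q₁) (+ μ #B) α))
      where
      lemma : ∀ r₀ r₁ q₀ q₁ B α → r₀ * q₀ + r₁ * q₁ * B + (r₁ * q₀ + r₀ * q₁) * α ≡
              (r₀ + r₁ * α) * (q₀ + q₁ * α) + - (r₁ * q₁) * (α * α - B)
      lemma = solve-∀

    exec-square : ∀ {μ} → Good μ → ∀ {α} → α * α ≈ + μ #B [ n ] →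
      + exec square μ #q₀ + + exec square μ #q₁ * α ≈ (+ μ #q₀ + + μ #q₁ * α) * (+ μ #q₀ + + μ #q₁ * α) [ n ]
    exec-square {μ} g {α} α² = ≈-trans
      (+-cong (represents-exec square g #q₀) (*-cong (represents-exec square g #q₁) (≈-refl {α})))
      (combine (- (+ μ #q₁ * + μ #q₁)) α² (lemma (+ μ #q₀) (+ μ #q₁) (+ μ #B) α))
      where
      lemma : ∀ q₀ q₁ B α → q₀ * q₀ + q₁ * q₁ * B + (q₀ * q₁ + q₀ * q₁) * α ≡
              (q₀ + q₁ * α) * (q₀ + q₁ * α) + - (q₁ * q₁) * (α * α - B)
      lemma = solve-∀

    -- `power-init` costs 4 and the last guard 1. A binary digit costs 32: its guard 1, the parity
    -- 2, the branch with the seven statements of `multiply` 15, and the seven statements of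
    -- `square` 14.
    powerCost : ℕ → ℕ
    powerCost L = 5 ℕ.+ L ℕ.* 32

    -- An identity modulo n and X² - B, tested at every square root α of B. Taking B = 0, q₁ = 0 and
    -- α = 0 recovers ordinary powers modulo n.
    Power : Memory → ℕ → Memory → Set
    Power μ k ν = ∀ α → α * α ≈ + μ #B [ n ] → + ν #r₀ + + ν #r₁ * α ≈ (+ μ #q₀ + + μ #q₁ * α) ^ k [ n ]

    power-spec : ∀ {μ} → Good μ → ∀ L → μ #k < 2 ℕ.^ L → Det power μ (powerCost L) (Power μ (μ #k))
    power-spec {μ} g L k<2^L = consequence (seq {p = compile power-init} (block′ power-init g) λ { g₁ f₁ refl →
        loop {K = 31} #k J g₁ (λ { (k<1 , _) → ℕ.n<1⇒n≡0 k<1 }) body L (k<2^L , start) })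
        ℕ.≤-refl λ { {ν} g f (k≡0 , _ , _ , inv) α α² → ≈-trans (≈-reflexive (*-^0 (+ ν #r₀ + + ν #r₁ * α) (+ ν #q₀ + + ν #q₁ * α) k≡0)) (inv α α²) }
      where
      Invariant : Memory → Set
      Invariant ν = ∀ α → α * α ≈ + μ #B [ n ] →
        (+ ν #r₀ + + ν #r₁ * α) * (+ ν #q₀ + + ν #q₁ * α) ^ ν #k ≈ (+ μ #q₀ + + μ #q₁ * α) ^ μ #k [ n ]
      J : ℕ → Memory → Set
      J r ν = ν #k < 2 ℕ.^ r × Invariant ν
      start : Invariant (exec power-init μ)
      start α _ = ≈-reflexive (lemma α ((+ μ #q₀ + + μ #q₁ * α) ^ μ #k))
        where
        lemma : ∀ α x → (1ℤ + 0ℤ * α) * x ≡ x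
        lemma = solve-∀
      body : ∀ r {ν} → Good ν → Frame power-body (exec power-init μ) ν → J (suc r) ν → ν #k ≢ 0 → Det power-body ν 31 (J r)
      body r {ν} g f (k< , inv) _ = seq {p = compile power-parity} (block′ power-parity g) λ { g₁ _ refl →
        seq {p = branch #f (compile multiply) [] ∷ []}
          (choose {Q = Multiplied} #f g₁
            (λ odd → block multiply g₁ (refl , refl , refl , refl , λ α α² → ≈-trans (exec-multiply g₁ α²)
              (≈-reflexive (*-^1 (+ ν #r₀ + + ν #r₁ * α) (+ ν #q₀ + + ν #q₁ * α) (odd-bit odd)))))
            (λ even → consequence {K = 0} (skip g₁ (refl , refl , refl , refl , λ α _ →
              ≈-reflexive (*-^0 (+ ν #r₀ + + ν #r₁ * α) (+ ν #q₀ + + ν #q₁ * α) (trans (sym bit≡) even)))) ℕ.z≤n λ _ _ q → q))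
          λ { {ξ} g₂ _ q → block square g₂ (advance g₂ q) } }
        where
        bit : ℕ
        bit = ν #k ℕ.% 2
        bit≡ : apply rem (ν #k) (ν #two) ≡ bit
        bit≡ = cong (apply rem (ν #k)) (cell₂ g)
        odd-bit : apply rem (ν #k) (ν #two) ≢ 0 → bit ≡ 1
        odd-bit odd with bit | bit≡ | ℕ.m%n<n (ν #k) 2
        ... | 0 | eq | _ = contradiction eq odd
        ... | 1 | _  | _ = refl
        ... | suc (suc _) | _ | ℕ.s≤s (ℕ.s≤s ())
        Multiplied : Memory → Set
        Multiplied ξ = ξ #k ≡ ν #k × ξ #q₀ ≡ ν #q₀ × ξ #q₁ ≡ ν #q₁ × ξ #B ≡ ν #B ×
          (∀ α → α * α ≈ + ν #B [ n ] → + ξ #r₀ + + ξ #r₁ * α ≈ (+ ν #r₀ + + ν #r₁ * α) * (+ ν #q₀ + + ν #q₁ * α) ^ bit [ n ])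
        advance : ∀ {ξ} → Good ξ → Multiplied ξ → J r (exec square ξ)
        advance {ξ} g₂ (k≡ , q₀≡ , q₁≡ , B≡ , r≈) = subst (_< 2 ℕ.^ r) (sym half≡) half< , inv′
          where
          half : ℕ
          half = ν #k ℕ./ 2
          half≡ : exec square ξ #k ≡ half
          half≡ = trans (cong (apply quo (ξ #k)) (cell₂ g₂)) (cong (ℕ._/ 2) k≡)
          half< : half < 2 ℕ.^ r
          half< = ℕ.m<n*o⇒m/o<n (subst (ν #k <_) (ℕ.*-comm 2 (2 ℕ.^ r)) k<)
          inv′ : Invariant (exec square ξ)
          inv′ α α²≈B = ≈-trans
            (subst (λ k → R′ * S ^ k ≈ R * Q ^ (bit ℕ.+ half ℕ.* 2) [ n ]) (sym half≡)
              (shift-exponent {n} {R} {R′} {Q} {S} bit half (r≈ α α²≈νB)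
                (subst₂ (λ a b → S ≈ (+ a + + b * α) * (+ a + + b * α) [ n ]) q₀≡ q₁≡ (exec-square g₂ α²≈ξB))))
            (subst (λ k → R * Q ^ k ≈ (+ μ #q₀ + + μ #q₁ * α) ^ μ #k [ n ]) (ℕ.m≡m%n+[m/n]*n (ν #k) 2) (inv α α²≈B))
            where
            νB : ν #B ≡ μ #B
            νB = f #B refl
            α²≈νB : α * α ≈ + ν #B [ n ]
            α²≈νB = subst (λ v → α * α ≈ + v [ n ]) (sym νB) α²≈B
            α²≈ξB : α * α ≈ + ξ #B [ n ]
            α²≈ξB = subst (λ v → α * α ≈ + v [ n ]) (sym (trans B≡ νB)) α²≈B
            R R′ Q S : ℤ
            R  = + ν #r₀ + + ν #r₁ * α
            R′ = + ξ #r₀ + + ξ #r₁ * α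
            Q  = + ν #q₀ + + ν #q₁ * α
            S  = + exec square ξ #q₀ + + exec square ξ #q₁ * α

-- Why the searches cannot fail for a prime

module Completeness where

  open Congruence
  open NumberTheory
  open ProthPrimes
  open import Data.Integer using (ℤ; +_; _+_; _*_; _-_; -_; _^_; 0ℤ; 1ℤ; -1ℤ; ∣_∣)
  import Data.Integer.Properties as ℤ
  open import Data.Integer.Tactic.RingSolver using (solve-∀)
  open import Data.Nat as ℕ using (ℕ; suc)
  import Data.Nat.Properties as ℕ
  open import Data.Nat.Divisibility as ℕ using (_∣_)
  open import Data.Nat.Primality using (Prime)
  open import Data.Product using (_×_; _,_; ∃-syntax)
  open import Data.Sum using (inj₁; inj₂; [_,_]′)
  open import Relation.Nullary using (¬_)
  open import Relation.Binary.PropositionalEquality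

  -- x + yX = (s + X) ^ t, respectively (u + vX) ^ (2 ^ i), modulo n and X² - β.
  Shifted : (n t : ℕ) (β s x y : ℤ) → Set
  Shifted n t β s x y = ∀ α → α * α ≈ β [ n ] → x + y * α ≈ (s + α) ^ t [ n ]

  Squared : (n : ℕ) (β u v : ℤ) (i : ℕ) (x y : ℤ) → Set
  Squared n β u v i x y = ∀ α → α * α ≈ β [ n ] → x + y * α ≈ (u + v * α) ^ (2 ℕ.^ i) [ n ]

  -- Several zero tests in one: modulo a prime it vanishes only if s ≈ ± a or x * y ≈ 0, and the
  -- latter makes the squares of (s + a) ^ t and (s - a) ^ t coincide.
  shiftTest : (β s x y : ℤ) → ℤ
  shiftTest β s x y = (s * s + - β) * x * y

  opposite⇒sum-squares≈0 : ∀ {p u v} i → u ^ (2 ℕ.^ suc i) ≈ - (v ^ (2 ℕ.^ suc i)) [ p ] →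
    u ^ (2 ℕ.^ i) * u ^ (2 ℕ.^ i) + v ^ (2 ℕ.^ i) * v ^ (2 ℕ.^ i) ≈ 0ℤ [ p ]
  opposite⇒sum-squares≈0 {p} {u} {v} i h = subst₂ (λ x y → x + y ≈ 0ℤ [ p ]) (^2^suc u i) (^2^suc v i)
    (combine 1ℤ h (lemma (u ^ (2 ℕ.^ suc i)) (v ^ (2 ℕ.^ suc i))))
    where
    lemma : ∀ u v → u + v ≡ 0ℤ + 1ℤ * (u - - v)
    lemma = solve-∀

  -- Not the norm of x + yX modulo X² - β, which has a minus sign, but the constant coefficient of
  -- its square: half the sum of the squares of its two components.
  norm : (β x y : ℤ) → ℤ
  norm β x y = x * x + y * y * β

  module _ {p} (pr : Prime p) (p∤2 : ¬ p ∣ 2) (e t : ℕ) (p-1≡ : p ℕ.∸ 1 ≡ 2 ℕ.^ suc e ℕ.* t)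
    {β : ℤ} {j : ℕ} (level : (- β) ^ (2 ℕ.^ j) ≈ -1ℤ [ p ]) (j<e : suc j ℕ.≤ e) where

    open ProthPrime pr p∤2 e t p-1≡

    -- The even exponent 2 ^ (j + 1) absorbs the sign of -β, so it sends β to 1; below the top level
    -- this is enough for `sqrt`.
    level⇒square : ∃[ a ] a * a ≈ β [ p ]
    level⇒square = sqrt β (suc j) j<e (≈-trans (≈-reflexive same) (combine ((- β) ^ (2 ℕ.^ j) - 1ℤ) level (lemma ((- β) ^ (2 ℕ.^ j)))))
      where
      lemma : ∀ x → x * x ≡ 1ℤ + (x - 1ℤ) * (x - -1ℤ)
      lemma = solve-∀
      even : ∀ x → - x * - x ≡ x * x
      even = solve-∀
      same : β ^ (2 ℕ.^ suc j) ≡ (- β) ^ (2 ℕ.^ j) * (- β) ^ (2 ℕ.^ j)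
      same = trans (^2^suc β j) (trans (sym (^-distrib-* β β (2 ℕ.^ j)))
        (trans (cong (_^ (2 ℕ.^ j)) (sym (even β))) (^-distrib-* (- β) (- β) (2 ℕ.^ j))))

  module WithSquareRoot {p} (pr : Prime p) (p∤2 : ¬ p ∣ 2) (e t : ℕ) (p-1≡ : p ℕ.∸ 1 ≡ 2 ℕ.^ suc e ℕ.* t)
    (0<t : 0 ℕ.< t) (T<p : suc (suc (t ℕ.+ t)) ℕ.< p)
    {β : ℤ} {j : ℕ} (level : (- β) ^ (2 ℕ.^ j) ≈ -1ℤ [ p ]) {a : ℤ} (a²≈β : a * a ≈ β [ p ]) where

    open ProthPrime pr p∤2 e t p-1≡

    -a²≈β : - a * - a ≈ β [ p ]
    -a²≈β = ≈-trans (≈-reflexive (lemma a)) a²≈β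
      where
      lemma : ∀ x → - x * - x ≡ x * x
      lemma = solve-∀

    a≉0 : a ≉ 0ℤ [ p ]
    a≉0 a≈0 = power≈-1⇒≉0 pr (ℕ.m^n>0 2 j) level (combine₂ 1ℤ (- a) a²≈β a≈0 (lemma a β))
      where
      lemma : ∀ a β → - β ≡ 0ℤ + (1ℤ * (a * a - β) + - a * (a - 0ℤ))
      lemma = solve-∀

    open SquareRoot a≉0

    -- With this identity and `sum-squares`, the tests that the program performs on coefficients
    -- become comparisons of the squares of the components at a and -a.
    difference-squares : ∀ {x y X Y} → x + y * a ≈ X [ p ] → x + y * - a ≈ Y [ p ] →
            + 4 * a * (x * y) ≈ X * X - Y * Y [ p ]
    difference-squares {x} {y} {X} {Y} h k = ≈-trans (≈-reflexive (lemma x y a))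
      (+-cong (*-cong h h) (-‿cong (*-cong k k)))
      where
      lemma : ∀ x y a → + 4 * a * (x * y) ≡ (x + y * a) * (x + y * a) - (x + y * - a) * (x + y * - a)
      lemma = solve-∀

    sum-squares : ∀ {x y X Y} → x + y * a ≈ X [ p ] → x + y * - a ≈ Y [ p ] →
                  + 2 * norm β x y ≈ X * X + Y * Y [ p ]
    sum-squares {x} {y} h k = ≈-trans (combine (- (+ 2 * y * y)) a²≈β (lemma x y a β))
      (+-cong (*-cong h h) (*-cong k k))
      where
      lemma : ∀ x y a β → + 2 * (x * x + y * y * β) ≡
        (x + y * a) * (x + y * a) + (x + y * - a) * (x + y * - a) + - (+ 2 * y * y) * (a * a - β)
      lemma = solve-∀

    4a≉0 : + 4 * a ≉ 0ℤ [ p ]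
    4a≉0 = *-≉0 pr (*-≉0 pr {+ 2} {+ 2} 2≉0 2≉0) a≉0

    shift-bad : ∀ {s x y} → Shifted p t β s x y → shiftTest β s x y ≈ 0ℤ [ p ] → Bad s
    shift-bad {s} {x} {y} shifted test≈0 =
      [ (λ h → inj₁ (combine₂ 1ℤ -1ℤ h a²≈β (lemma₀ s a β))) , (λ h → inj₂ (same h)) ]′
        (x*y≈0⇒x≈0⊎y≈0 pr (s * s + - β) (x * y) (≈-trans (≈-reflexive (sym (ℤ.*-assoc (s * s + - β) x y))) test≈0))
      where
      lemma₀ : ∀ s a β → s * s ≡ a * a + (1ℤ * (s * s + - β - 0ℤ) + -1ℤ * (a * a - β))
      lemma₀ = solve-∀
      U V : ℤ
      U = (s + a) ^ t
      V = (s + - a) ^ t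
      U²≈V² : x * y ≈ 0ℤ [ p ] → U * U ≈ V * V [ p ]
      U²≈V² xy≈0 = combine₂ -1ℤ (+ 4 * a) (difference-squares {x} {y} {U} {V} (shifted a a²≈β) (shifted (- a) -a²≈β)) xy≈0 (lemma U V a (x * y))
        where
        lemma : ∀ U V a m → U * U ≡ V * V + (-1ℤ * (+ 4 * a * m - (U * U - V * V)) + + 4 * a * (m - 0ℤ))
        lemma = solve-∀
      same : x * y ≈ 0ℤ [ p ] → (s + a) ^ (t ℕ.+ t) ≈ (s - a) ^ (t ℕ.+ t) [ p ]
      same xy≈0 = ≈-trans (≈-reflexive (ℤ.^-distribˡ-+-* (s + a) t t))
        (≈-trans (U²≈V² xy≈0) (≈-reflexive (sym (ℤ.^-distribˡ-+-* (s + - a) t t))))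

    -- The negated form fits the specification of the loop: if it stores no success, it has recorded
    -- a failing coefficient pair for each candidate.
    shift-complete : ¬ (∀ i → i ℕ.< suc (suc (t ℕ.+ t)) →
      ∃[ x ] ∃[ y ] Shifted p t β (+ suc i) x y × shiftTest β (+ suc i) x y ≈ 0ℤ [ p ])
    shift-complete all =
      let i , i<T , good = good-shift 0<t T<p
          x , y , shifted , test≈0 = all i i<T
      in good (shift-bad {+ suc i} {x} {y} shifted test≈0)

    module _ {s u₀ u₁ : ℤ} (shifted : Shifted p t β s u₀ u₁) (test≉0 : shiftTest β s u₀ u₁ ≉ 0ℤ [ p ]) where

      private
        U V : ℤ
        U = u₀ + u₁ * a
        V = u₀ + u₁ * - a

        s²≉β : s * s + - β ≉ 0ℤ [ p ]
        s²≉β h = test≉0 (combine (u₀ * u₁) h (lemma (s * s + - β) u₀ u₁))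
          where
          lemma : ∀ x u v → x * u * v ≡ 0ℤ + u * v * (x - 0ℤ)
          lemma = solve-∀

        s±a≉0 : ∀ {b} → b * b ≈ β [ p ] → s + b ≉ 0ℤ [ p ]
        s±a≉0 {b} b² h = s²≉β (combine₂ (s - b) 1ℤ h b² (lemma s b β))
          where
          lemma : ∀ s b β → s * s + - β ≡ 0ℤ + ((s - b) * (s + b - 0ℤ) + 1ℤ * (b * b - β))
          lemma = solve-∀

        unit-power : ∀ {b} → b * b ≈ β [ p ] → (u₀ + u₁ * b) ^ (2 ℕ.^ suc e) ≈ 1ℤ [ p ]
        unit-power {b} b² = ≈-trans (^-cong (2 ℕ.^ suc e) (shifted b b²)) (fermat-proth (s±a≉0 b²))

        U≉0 : ∀ {b} → b * b ≈ β [ p ] → u₀ + u₁ * b ≉ 0ℤ [ p ]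
        U≉0 {b} b² h = ^-≉0 pr t (s±a≉0 b²) (≈-trans (≈-sym (shifted b b²)) h)

        U²≉V² : ¬ (U * U ≈ V * V [ p ])
        U²≉V² h = *-≉0 pr 4a≉0 u₀u₁≉0 (combine₂ 1ℤ 1ℤ (difference-squares {u₀} {u₁} {U} {V} ≈-refl ≈-refl) h (lemma U V a (u₀ * u₁)))
          where
          u₀u₁≉0 : u₀ * u₁ ≉ 0ℤ [ p ]
          u₀u₁≉0 h = test≉0 (combine (s * s + - β) h (lemma₀ (s * s + - β) u₀ u₁))
            where
            lemma₀ : ∀ x u v → x * u * v ≡ 0ℤ + x * (u * v - 0ℤ)
            lemma₀ = solve-∀
          lemma : ∀ U V a m → + 4 * a * m ≡ 0ℤ + (1ℤ * (+ 4 * a * m - (U * U - V * V)) + 1ℤ * (U * U - V * V))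
          lemma = solve-∀

      -- Both components are t-th powers of units, so their 2 ^ (e + 1)-th powers are 1 and agree,
      -- while their squares differ by the unit 4 * a * u₀ * u₁. Hence `opposite-powers` supplies an
      -- iterated square with vanishing `norm`.
      squares-complete : ¬ (∀ i → i ℕ.< suc e → ∃[ x ] ∃[ y ] Squared p β u₀ u₁ i x y × norm β x y ≉ 0ℤ [ p ])
      squares-complete all =
        let i , i<e , opposite = opposite-powers {U} {V} e U²≉V² (≈-trans (unit-power a²≈β) (≈-sym (unit-power -a²≈β)))
            x , y , squared , norm≉0 = all i (ℕ.m<n⇒m<1+n i<e)
        in *-≉0 pr {+ 2} {norm β x y} 2≉0 norm≉0
             (≈-trans (sum-squares {x} {y} {U ^ (2 ℕ.^ i)} {V ^ (2 ℕ.^ i)} (squared a a²≈β) (squared (- a) -a²≈β))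
               (opposite⇒sum-squares≈0 {p} {U} {V} i opposite))

      root-complete : ∀ {i w₀ w₁} → Squared p β u₀ u₁ i w₀ w₁ → norm β w₀ w₁ ≈ 0ℤ [ p ] →
                      w₀ * w₁ ^ (p ℕ.∸ 2) * (w₀ * w₁ ^ (p ℕ.∸ 2)) + β ≈ 0ℤ [ p ]
      root-complete {i} {w₀} {w₁} squared norm≈0 = combine₂ (w₁ ⁻¹ * w₁ ⁻¹) (- (β * (w₁ * w₁ ⁻¹ + 1ℤ))) norm≈0 (*-inverse w₁≉0)
        (lemma w₀ w₁ β (w₁ ⁻¹))
        where
        lemma : ∀ w v β i → w * i * (w * i) + β ≡
          0ℤ + (i * i * (w * w + v * v * β - 0ℤ) + - (β * (v * i + 1ℤ)) * (v * i - 1ℤ))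
        lemma = solve-∀
        -- If w₁ vanished, the vanishing `norm` would make w₀ vanish too, and with them the
        -- component at a, which is a power of a unit.
        w₁≉0 : w₁ ≉ 0ℤ [ p ]
        w₁≉0 w₁≈0 = ^-≉0 pr (2 ℕ.^ i) (U≉0 a²≈β) (≈-trans (≈-sym (squared a a²≈β))
          (combine₂ 1ℤ a w₀≈0 w₁≈0 (lemma₁ w₀ w₁ a)))
          where
          lemma₀ : ∀ w v β → w * w ≡ 0ℤ + (1ℤ * (w * w + v * v * β - 0ℤ) + - (v * β) * (v - 0ℤ))
          lemma₀ = solve-∀
          lemma₁ : ∀ w v a → w + v * a ≡ 0ℤ + (1ℤ * (w - 0ℤ) + a * (v - 0ℤ))
          lemma₁ = solve-∀
          w₀≈0 : w₀ ≈ 0ℤ [ p ]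
          w₀≈0 = [ (λ h → h) , (λ h → h) ]′ (x*y≈0⇒x≈0⊎y≈0 pr w₀ w₀ (combine₂ 1ℤ (- (w₁ * β)) norm≈0 w₁≈0 (lemma₀ w₀ w₁ β)))

-- The square root step for an arbitrary modulus

module RootStep where

  open Congruence
  open NumberTheory
  open Machine
  open Algorithm
  open Power
  open Completeness
  open import Data.Integer using (ℤ; +_; _+_; _*_; _-_; -_; _^_; 0ℤ; 1ℤ)
  import Data.Integer.Properties as ℤ
  open import Data.Integer.Tactic.RingSolver using (solve-∀)
  open import Data.Nat as ℕ using (ℕ; suc; _∸_; _≤_; _<_)
  import Data.Nat.Properties as ℕ
  open import Data.List using ([]; _∷_)
  open import Data.Product using (_×_; _,_; ∃-syntax)
  open import Data.Sum using (_⊎_; inj₁; inj₂)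
  open import Relation.Nullary using (contradiction; yes; no)
  open import Relation.Binary.PropositionalEquality hiding (J)

  -- Here `e` is the full Proth exponent, later instantiated by `suc e`. Nothing in this module
  -- assumes n prime.
  module StepSpec (n : ℕ) (3≤n : 3 ≤ n) (W : ℕ) (W≡ : W ≡ unitCost n) (e t ℓ : ℕ)
    (t<2^ℓ : t < 2 ℕ.^ ℓ) (n<2^2e : n ∸ 2 < 2 ℕ.^ (2 ℕ.* e)) (e<n : e < n) (t<n : t < n) where
    open Bounded n 3≤n W W≡ public
    open PowerSpec n 3≤n W W≡ public

    private variable
      μ : Memory

    rem<n : Good μ → ∀ {a} → apply rem a (μ 0) < n
    rem<n {μ} g {a} = subst (λ m → apply rem a m < n) (sym (cell₀ g)) (apply-rem< a 0<n)

    copy≡ : Good μ → ∀ {x} → x < n → apply rem (x ℕ.+ μ 3) (μ 0) ≡ x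
    copy≡ {μ} g {x} x<n rewrite cell₀ g | cell₃ g | ℕ.+-identityʳ x = small-rem x<n

    copy≈ : Good μ → ∀ x → + apply rem (x ℕ.+ μ 3) (μ 0) ≈ + x [ n ]
    copy≈ {μ} g x rewrite cell₃ g | ℕ.+-identityʳ x = rem≈ g x

    +cell₃ : Good μ → ∀ x → x + + μ 3 ≈ x [ n ]
    +cell₃ {μ} g x = ≈-reflexive (trans (cong (λ v → x + + v) (cell₃ g)) (ℤ.+-identityʳ x))

    zero-test : ∀ {v X} → v ≡ 0 → + v ≈ X [ n ] → X ≈ 0ℤ [ n ]
    zero-test refl h = ≈-sym h

    nonzero-test : ∀ {v X} → v < n → v ≢ 0 → + v ≈ X [ n ] → X ≉ 0ℤ [ n ]
    nonzero-test v<n v≢0 h X≈0 = v≢0 (small≈⇒≡ v<n 0<n (≈-trans h X≈0))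

    record Fixed (μ : Memory) : Set where
      constructor fixed
      field
        cell-e : μ #e ≡ e
        cell-t : μ #t ≡ t
    open Fixed public

    T : ℕ
    T = suc (suc (t ℕ.+ t))

    ShiftBad : Memory → ℕ → Set
    ShiftBad μ s = ∃[ x ] ∃[ y ] Shifted n t (+ μ #β) (+ s) x y × shiftTest (+ μ #β) (+ s) x y ≈ 0ℤ [ n ]

    ShiftGood : Memory → Memory → Set
    ShiftGood μ ν = ∃[ s ] Shifted n t (+ μ #β) s (+ ν #u₀) (+ ν #u₁) × shiftTest (+ μ #β) s (+ ν #u₀) (+ ν #u₁) ≉ 0ℤ [ n ]

    -- In the first case nothing is claimed about `#u₀` and `#u₁`. The later stages still run on
    -- whatever these cells hold, which is harmless because the resulting root is verified.
    ShiftPost : Memory → Memory → Set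
    ShiftPost μ ν = (∀ i → i < T → ShiftBad μ (suc i)) ⊎ ShiftGood μ ν

    shiftBodyCost shiftCost : ℕ
    shiftBodyCost = 6 ℕ.+ (powerCost ℓ ℕ.+ (10 ℕ.+ (5 ℕ.+ 2)))
    shiftCost     = 6 ℕ.+ (1 ℕ.+ T ℕ.* (1 ℕ.+ shiftBodyCost))

    shift-spec : Good μ → Fixed μ → T < n → Det shift μ shiftCost (ShiftPost μ)
    shift-spec {μ} g fx T<n = seq {p = compile shift-init} (block′ shift-init g) λ { g₁ f₁ refl →
        consequence (loop #s J g₁ (λ (s≡0 , _) → s≡0) body T (start g₁)) ℕ.≤-refl
          λ { {ν} _ _ (s≡0 , r , s≡r , _ , post) → finish {ν} (trans (sym s≡r) s≡0) post } }
      where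
      μ₁ : Memory
      μ₁ = exec shift-init μ
      Tested : ℕ → Memory → Set
      Tested r ν = (∀ i → r ≤ i → i < T → ShiftBad μ (suc i)) ⊎ ShiftGood μ ν
      J : ℕ → Memory → Set
      J r ν = ν #s ≡ r × r ≤ T × Tested r ν
      start : Good μ₁ → J T μ₁
      start g₁ = s≡T , ℕ.≤-refl , inj₁ λ i T≤i i<T → contradiction i<T (ℕ.≤⇒≯ T≤i)
        where
        s≡T : apply rem (apply rem (μ #t ℕ.+ μ #t) (μ 0) ℕ.+ μ 2) (μ 0) ≡ T
        s≡T rewrite cell₀ g | cell₂ g | cell-t fx
          | small-rem {t ℕ.+ t} (ℕ.<-trans (ℕ.n<1+n _) (ℕ.<-trans (ℕ.n<1+n _) T<n)) | ℕ.+-comm (t ℕ.+ t) 2 = small-rem T<n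
      finish : ∀ {ν r} → r ≡ 0 → Tested r ν → ShiftPost μ ν
      finish refl (inj₁ all)  = inj₁ λ i → all i ℕ.z≤n
      finish refl (inj₂ some) = inj₂ some
      body : ∀ r {ν} → Good ν → Frame shift-body μ₁ ν → J (suc r) ν → ν #s ≢ 0 → Det shift-body ν shiftBodyCost (J r)
      body r {ν} g₁ f₁ (s≡ , r< , tested) _ = seq {p = compile shift-power} (block′ shift-power g₁) λ { g₂ f₂ refl →
        seq {p = power} (power-spec g₂ ℓ (subst (_< 2 ℕ.^ ℓ) (sym k≡t) t<2^ℓ)) λ { {ξ} g₃ f₃ pow →
        seq {p = compile shift-test} (block′ shift-test g₃) λ { g₄ f₄ refl →
        seq {p = branch #g (compile shift-good) [] ∷ []}
          (choose {K = 4} {Q = Chosen} #g g₄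
            (λ nz → block shift-good g₄ (trans (f₃ #s refl) s≡ , inj₂ (+ suc r , chosen g₃ g₄ f₃ pow nz)))
            (λ z → consequence {K = 0} (skip g₄ (trans (f₃ #s refl) s≡ , rejected g₃ f₃ pow z)) ℕ.z≤n λ _ _ q → q))
          λ { {ζ} g₅ _ (s≡′ , tested′) → block shift-next g₅ (dec g₅ s≡′ , ℕ.<⇒≤ r< , tested′) } } } }
        where
        ν₂ : Memory
        ν₂ = exec shift-power ν
        νβ : ν #β ≡ μ #β
        νβ = f₁ #β refl
        k≡t : apply rem (ν #t ℕ.+ ν 3) (ν 0) ≡ t
        k≡t = trans (cong (λ x → apply rem (x ℕ.+ ν 3) (ν 0)) (trans (f₁ #t refl) (cell-t fx))) (copy≡ g₁ t<n)
        Chosen : Memory → Set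
        Chosen ζ = ζ #s ≡ suc r × Tested r ζ
        shifted : ∀ {ξ} → Power ν₂ (ν₂ #k) ξ → Shifted n t (+ μ #β) (+ suc r) (+ ξ #r₀) (+ ξ #r₁)
        shifted {ξ} pow α α² = ≈-trans (pow α (≈-trans α² β≈))
          (≈-trans (^-cong (ν₂ #k) base) (≈-reflexive (cong ((+ suc r + α) ^_) k≡t)))
          where
          β≈ : + μ #β ≈ + ν₂ #B [ n ]
          β≈ = subst (λ v → + v ≈ + ν₂ #B [ n ]) νβ (subst (λ v → + ν #β ≈ + v [ n ]) (sym (f₁ #B refl)) (β′ g))
            where
            β′ : Good μ → + ν #β ≈ + μ₁ #B [ n ]
            β′ g = subst (λ v → + v ≈ + μ₁ #B [ n ]) (sym νβ) (≈-sym (copy≈ g (μ #β)))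
          base : + ν₂ #q₀ + 1ℤ * α ≈ + suc r + α [ n ]
          base = +-cong (subst (λ v → + ν₂ #q₀ ≈ + v [ n ]) s≡ (copy≈ g₁ (ν #s))) (≈-reflexive (ℤ.*-identityˡ α))
        test≈ : ∀ {ξ} → Good ξ → Frame power ν₂ ξ →
                + exec shift-test ξ #g ≈ shiftTest (+ μ #β) (+ suc r) (+ ξ #r₀) (+ ξ #r₁) [ n ]
        test≈ {ξ} g₃ f₃ = ≈-trans (represents-exec shift-test g₃ #g)
          (≈-reflexive (cong₂ (λ s b → (+ s * + s + - (+ b)) * + ξ #r₀ * + ξ #r₁)
            (trans (f₃ #s refl) s≡) (trans (f₃ #β refl) νβ)))
        chosen : ∀ {ξ} → Good ξ → Good (exec shift-test ξ) → Frame power ν₂ ξ → Power ν₂ (ν₂ #k) ξ →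
                 exec shift-test ξ #g ≢ 0 →
                 let ζ = exec shift-good (exec shift-test ξ) in
                 Shifted n t (+ μ #β) (+ suc r) (+ ζ #u₀) (+ ζ #u₁) ×
                 shiftTest (+ μ #β) (+ suc r) (+ ζ #u₀) (+ ζ #u₁) ≉ 0ℤ [ n ]
        chosen {ξ} g₃ g₄ f₃ pow nz =
          (λ α α² → ≈-trans (+-cong u₀≈ (*-cong u₁≈ (≈-refl {α}))) (shifted {ξ} pow α α²)) ,
          λ h → nonzero-test (rem<n g₃) nz (test≈ g₃ f₃) (≈-trans
            (*-cong (*-cong (≈-refl {+ suc r * + suc r + - (+ μ #β)}) (≈-sym u₀≈)) (≈-sym u₁≈)) h)
          where
          u₀≈ : + exec shift-good (exec shift-test ξ) #u₀ ≈ + ξ #r₀ [ n ]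
          u₀≈ = ≈-trans (represents-exec shift-good g₄ #u₀) (+cell₃ g₄ (+ ξ #r₀))
          u₁≈ : + exec shift-good (exec shift-test ξ) #u₁ ≈ + ξ #r₁ [ n ]
          u₁≈ = ≈-trans (represents-exec shift-good g₄ #u₁) (+cell₃ g₄ (+ ξ #r₁))
        rejected : ∀ {ξ} → Good ξ → Frame power ν₂ ξ → Power ν₂ (ν₂ #k) ξ →
                   exec shift-test ξ #g ≡ 0 → Tested r (exec shift-test ξ)
        rejected {ξ} g₃ f₃ pow z = extend tested
          where
          bad : ShiftBad μ (suc r)
          bad = + ξ #r₀ , + ξ #r₁ , shifted {ξ} pow , zero-test z (test≈ g₃ f₃)
          extend : Tested (suc r) ν → Tested r (exec shift-test ξ)
          extend (inj₂ (s , sh , nz)) = inj₂ (s , subst₂ (λ u v → Shifted n t (+ μ #β) s (+ u) (+ v)) (sym (f₃ #u₀ refl)) (sym (f₃ #u₁ refl)) sh ,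
            subst₂ (λ u v → shiftTest (+ μ #β) s (+ u) (+ v) ≉ 0ℤ [ n ]) (sym (f₃ #u₀ refl)) (sym (f₃ #u₁ refl)) nz)
          extend (inj₁ all) = inj₁ go
            where
            go : ∀ i → r ≤ i → i < T → ShiftBad μ (suc i)
            go i r≤i i<T with r ℕ.≟ i
            ... | yes refl = bad
            ... | no  r≢i  = all i (ℕ.≤∧≢⇒< r≤i r≢i) i<T
        dec : ∀ {ζ} → Good ζ → ζ #s ≡ suc r → ζ #s ∸ ζ 1 ≡ r
        dec g₅ s≡′ rewrite cell₁ g₅ | s≡′ = refl

    SquaresBad : Memory → ℕ → Set
    SquaresBad μ i = ∃[ x ] ∃[ y ] Squared n (+ μ #β) (+ μ #u₀) (+ μ #u₁) i x y × norm (+ μ #β) x y ≉ 0ℤ [ n ]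

    SquaresGood : Memory → Memory → Set
    SquaresGood μ ν = ∃[ i ] Squared n (+ μ #β) (+ μ #u₀) (+ μ #u₁) i (+ ν #w₀) (+ ν #w₁) ×
                             norm (+ μ #β) (+ ν #w₀) (+ ν #w₁) ≈ 0ℤ [ n ]

    SquaresPost : Memory → Memory → Set
    SquaresPost μ ν = (∀ i → i < e → SquaresBad μ i) ⊎ SquaresGood μ ν

    squaresCost : ℕ
    squaresCost = 2 ℕ.+ (1 ℕ.+ e ℕ.* (1 ℕ.+ (8 ℕ.+ (5 ℕ.+ 8))))

    squares-spec : Good μ → Fixed μ → Det squares μ squaresCost (SquaresPost μ)
    squares-spec {μ} g fx = seq {p = compile squares-init} (block′ squares-init g) λ { g₁ f₁ refl →
        consequence (loop #c J g₁ (λ (c≡0 , _) → c≡0) body e start) ℕ.≤-refl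
          λ { {ν} _ _ (c≡0 , r , c≡r , i , i+r≡e , _ , post) →
            finish {ν} (trans (sym (ℕ.+-identityʳ i)) (trans (cong (i ℕ.+_) (trans (sym c≡0) c≡r)) i+r≡e)) post } }
      where
      μ₁ : Memory
      μ₁ = exec squares-init μ
      Tested : ℕ → Memory → Set
      Tested i ν = (∀ i′ → i′ < i → SquaresBad μ i′) ⊎ SquaresGood μ ν
      Current : ℕ → Memory → Set
      Current i ν = Squared n (+ μ #β) (+ μ #u₀) (+ μ #u₁) i (+ ν #u₀) (+ ν #u₁)
      J : ℕ → Memory → Set
      J r ν = ν #c ≡ r × ∃[ i ] i ℕ.+ r ≡ e × Current i ν × Tested i ν
      start : J e μ₁
      start = c≡e , 0 , refl , (λ α _ → ≈-reflexive (sym (ℤ.*-identityʳ (+ μ #u₀ + + μ #u₁ * α)))) , inj₁ λ _ ()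
        where
        c≡e : apply rem (μ #e ℕ.+ μ 3) (μ 0) ≡ e
        c≡e = trans (cong (λ x → apply rem (x ℕ.+ μ 3) (μ 0)) (cell-e fx)) (copy≡ g e<n)
      finish : ∀ {ν i} → i ≡ e → Tested i ν → SquaresPost μ ν
      finish refl post = post
      body : ∀ r {ν} → Good ν → Frame squares-body μ₁ ν → J (suc r) ν → ν #c ≢ 0 → Det squares-body ν 21 (J r)
      body r {ν} g₁ f₁ (c≡ , i , i+r≡ , current , tested) _ =
        seq {p = compile squares-test} (block′ squares-test g₁) λ { g₂ f₂ refl →
        seq {p = branch #g [] (compile squares-found) ∷ []}
          (choose {K = 4} {Q = Chosen} #g g₂
            (λ nz → consequence {K = 0} (skip g₂ (refl , refl , refl , refl , refl , rejected nz)) ℕ.z≤n λ _ _ q → q)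
            (λ z → block squares-found g₂ (refl , refl , refl , refl , refl , inj₂ (i , found g₂ z))))
          λ { {ζ} g₃ _ q → block squares-next g₃ (advance g₃ q) } }
        where
        ν₂ : Memory
        ν₂ = exec squares-test ν
        νβ : ν #β ≡ μ #β
        νβ = f₁ #β refl
        g≈ : + ν₂ #g ≈ norm (+ μ #β) (+ ν #u₀) (+ ν #u₁) [ n ]
        g≈ = ≈-trans (represents-exec squares-test g₁ #g)
          (≈-reflexive (cong (λ b → + ν #u₀ * + ν #u₀ + + ν #u₁ * + ν #u₁ * + b) νβ))
        Chosen : Memory → Set
        Chosen ζ = ζ #c ≡ ν #c × ζ #u₀ ≡ ν #u₀ × ζ #u₁ ≡ ν #u₁ × ζ #g ≡ ν₂ #g × ζ #β ≡ ν #β × Tested (suc i) ζ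
        rejected : ν₂ #g ≢ 0 → Tested (suc i) ν₂
        rejected nz = extend tested
          where
          bad : SquaresBad μ i
          bad = + ν #u₀ , + ν #u₁ , current , nonzero-test (rem<n g₁) nz g≈
          extend : Tested i ν → Tested (suc i) ν₂
          extend (inj₂ some) = inj₂ some
          extend (inj₁ all)  = inj₁ go
            where
            go : ∀ i′ → i′ < suc i → SquaresBad μ i′
            go i′ (ℕ.s≤s i′≤i) with i′ ℕ.≟ i
            ... | yes refl = bad
            ... | no  i′≢i = all i′ (ℕ.≤∧≢⇒< i′≤i i′≢i)
        found : Good ν₂ → ν₂ #g ≡ 0 → let ζ = exec squares-found ν₂ in
                Squared n (+ μ #β) (+ μ #u₀) (+ μ #u₁) i (+ ζ #w₀) (+ ζ #w₁) × norm (+ μ #β) (+ ζ #w₀) (+ ζ #w₁) ≈ 0ℤ [ n ]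
        found g₂ z = (λ α α² → ≈-trans (+-cong w₀≈ (*-cong w₁≈ (≈-refl {α}))) (current α α²)) ,
          ≈-trans (+-cong (*-cong w₀≈ w₀≈) (*-cong (*-cong w₁≈ w₁≈) (≈-refl {+ μ #β}))) (zero-test z g≈)
          where
          w₀≈ : + exec squares-found ν₂ #w₀ ≈ + ν #u₀ [ n ]
          w₀≈ = ≈-trans (represents-exec squares-found g₂ #w₀) (+cell₃ g₂ (+ ν #u₀))
          w₁≈ : + exec squares-found ν₂ #w₁ ≈ + ν #u₁ [ n ]
          w₁≈ = ≈-trans (represents-exec squares-found g₂ #w₁) (+cell₃ g₂ (+ ν #u₁))
        advance : ∀ {ζ} → Good ζ → Chosen ζ → J r (exec squares-next ζ)
        advance {ζ} g₃ (c≡′ , u₀≡ , u₁≡ , g≡ , β≡ , tested′) =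
          trans (cong₂ _∸_ (trans c≡′ c≡) (cell₁ g₃)) refl , suc i , trans (sym (ℕ.+-suc i r)) i+r≡ , squared , tested′
          where
          x y b : ℤ
          x = + ν #u₀
          y = + ν #u₁
          b = + μ #β
          u₀≈ : + exec squares-next ζ #u₀ ≈ norm b x y [ n ]
          u₀≈ = ≈-trans (represents-exec squares-next g₃ #u₀)
            (≈-trans (+cell₃ g₃ (+ ζ #g)) (≈-trans (≈-reflexive (cong +_ g≡)) g≈))
          u₁≈ : + exec squares-next ζ #u₁ ≈ x * y + x * y [ n ]
          u₁≈ = ≈-trans (represents-exec squares-next g₃ #u₁) (≈-reflexive (cong₂ (λ x y → + x * + y + + x * + y) u₀≡ u₁≡))
          squared : Current (suc i) (exec squares-next ζ)
          squared α α² = ≈-trans (+-cong u₀≈ (*-cong u₁≈ (≈-refl {α})))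
            (≈-trans (combine (- (y * y)) α² (lemma x y b α))
              (≈-trans (*-cong (current α α²) (current α α²)) (≈-reflexive (sym (^2^suc (+ μ #u₀ + + μ #u₁ * α) i)))))
            where
            lemma : ∀ x y b α → x * x + y * y * b + (x * y + x * y) * α ≡ (x + y * α) * (x + y * α) + - (y * y) * (α * α - b)
            lemma = solve-∀

    Quotient² : Memory → ℤ
    Quotient² μ = + μ #w₀ * (+ μ #w₁) ^ (n ∸ 2) * (+ μ #w₀ * (+ μ #w₁) ^ (n ∸ 2))

    -- Success carries the verified equation and so is sound for every n. Failure records only that
    -- the test failed; compositeness is inferred later, with the results of both searches.
    data RootPost (μ ν : Memory) : Set where
      failure : ν #ok ≡ 0 → ν #d ≡ 0 → Quotient² μ + + μ #β ≉ 0ℤ [ n ] → RootPost μ ν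
      success : ν #ok ≡ μ #ok → ν #d ≡ μ #d ∸ 1 → + ν #β * + ν #β ≈ - (+ μ #β) [ n ] → RootPost μ ν

    rootCost : ℕ
    rootCost = 8 ℕ.+ (powerCost (2 ℕ.* e) ℕ.+ (6 ℕ.+ 5))

    root-spec : Good μ → Det root μ rootCost (RootPost μ)
    root-spec {μ} g = seq {p = compile root-power} (block′ root-power g) λ { g₁ f₁ refl →
      seq {p = power} (power-spec g₁ (2 ℕ.* e) (subst (_< 2 ℕ.^ (2 ℕ.* e)) (sym k≡) n<2^2e)) λ { {ξ} g₂ f₂ pow →
      seq {p = compile root-test} (block′ root-test g₂) λ { g₃ f₃ refl →
        choose {K = 4} #g g₃
          (λ nz → block root-fail g₃ (failure refl refl λ h → nonzero-test (rem<n g₂) nz (g≈ g₂ f₂ pow) h))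
          (λ z → block root-success g₃ (success (f₂ #ok refl)
            (cong₂ _∸_ (f₂ #d refl) (cell₁ g₃))
            (root≈ g₂ g₃ f₂ pow z))) } } }
      where
      μ₁ : Memory
      μ₁ = exec root-power μ
      k≡ : μ 0 ∸ μ 2 ≡ n ∸ 2
      k≡ = cong₂ _∸_ (cell₀ g) (cell₂ g)
      inverse : ∀ {ξ} → Power μ₁ (μ₁ #k) ξ → + ξ #r₀ ≈ (+ μ #w₁) ^ (n ∸ 2) [ n ]
      -- Since B = 0 and q₁ = 0, evaluation at the square root α = 0 gives the plain power of w₁.
      inverse {ξ} pow = ≈-trans (≈-reflexive (lemma (+ ξ #r₀) (+ ξ #r₁))) (≈-trans (pow 0ℤ ≈-refl)
        (≈-trans (^-cong (μ₁ #k) (≈-trans (≈-reflexive (ℤ.+-identityʳ (+ μ₁ #q₀))) (copy≈ g (μ #w₁))))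
          (≈-reflexive (cong ((+ μ #w₁) ^_) k≡))))
        where
        lemma : ∀ x y → x ≡ x + y * 0ℤ
        lemma = solve-∀
      z≈ : ∀ {ξ} → Frame power μ₁ ξ → Power μ₁ (μ₁ #k) ξ → + ξ #w₀ * + ξ #r₀ ≈ + μ #w₀ * (+ μ #w₁) ^ (n ∸ 2) [ n ]
      z≈ {ξ} f₂ pow = *-cong (≈-reflexive (cong +_ (f₂ #w₀ refl))) (inverse {ξ} pow)
      g≈ : ∀ {ξ} → Good ξ → Frame power μ₁ ξ → Power μ₁ (μ₁ #k) ξ → + exec root-test ξ #g ≈ Quotient² μ + + μ #β [ n ]
      g≈ {ξ} g₂ f₂ pow = ≈-trans (represents-exec root-test g₂ #g)
        (+-cong (*-cong (z≈ {ξ} f₂ pow) (z≈ {ξ} f₂ pow)) (≈-reflexive (cong +_ (f₂ #β refl))))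
      root≈ : ∀ {ξ} → Good ξ → Good (exec root-test ξ) → Frame power μ₁ ξ → Power μ₁ (μ₁ #k) ξ → exec root-test ξ #g ≡ 0 →
              let ζ = exec root-success (exec root-test ξ) in + ζ #β * + ζ #β ≈ - (+ μ #β) [ n ]
      root≈ {ξ} g₂ g₃ f₂ pow z = ≈-trans (*-cong β≈ β≈)
        (combine 1ℤ (zero-test z (g≈ {ξ} g₂ f₂ pow)) (lemma (Quotient² μ) (+ μ #β)))
        where
        lemma : ∀ q b → q ≡ - b + 1ℤ * (q + b - 0ℤ)
        lemma = solve-∀
        β≈ : + exec root-success (exec root-test ξ) #β ≈ + μ #w₀ * (+ μ #w₁) ^ (n ∸ 2) [ n ]
        β≈ = ≈-trans (represents-exec root-success g₃ #β) (≈-trans (+cell₃ g₃ (+ exec root-test ξ #z))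
          (≈-trans (represents-exec root-test g₂ #z) (z≈ {ξ} f₂ pow)))

-- The climb, its correctness and its number of steps

module Chain where

  open Congruence
  open NumberTheory
  open ProthPrimes
  open Machine
  open Algorithm
  open Completeness
  open RootStep
  open import Data.Integer using (ℤ; +_; _+_; _*_; _-_; -_; _^_; 0ℤ; 1ℤ; -1ℤ; ∣_∣)
  import Data.Integer.Properties as ℤ
  open import Data.Integer.Tactic.RingSolver using (solve-∀)
  open import Data.Nat as ℕ using (ℕ; suc; _∸_; _≤_; _<_)
  import Data.Nat.Properties as ℕ
  open import Data.Nat.Divisibility using (_∣_)
  open import Data.Nat.Primality using (Prime)
  open import Data.Empty using (⊥)
  open import Data.List using ([]; _∷_)
  open import Data.Product using (_×_; _,_; ∃-syntax; proj₁; proj₂)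
  open import Data.Sum using (_⊎_; inj₁; inj₂)
  open import Relation.Nullary using (¬_; contradiction; yes; no)
  open import Relation.Binary.PropositionalEquality hiding (J)

  module MainSpec (n : ℕ) (3≤n : 3 ≤ n) (W : ℕ) (W≡ : W ≡ unitCost n) (e t ℓ : ℕ)
    (t<2^ℓ : t < 2 ℕ.^ ℓ) (n<2^2e : n ∸ 2 < 2 ℕ.^ (2 ℕ.* suc e)) (e<n : suc e < n) (t<n : t < n)
    (n≡ : n ≡ 2 ℕ.^ suc e ℕ.* t ℕ.+ 1) (0<t : 0 < t) (t<2^e : t < 2 ℕ.^ suc e) where
    open StepSpec n 3≤n W W≡ (suc e) t ℓ t<2^ℓ n<2^2e e<n t<n public

    private variable
      μ : Memory

    n∤2 : ¬ n ∣ 2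
    n∤2 d = ℕ.<⇒≱ 3≤n (∣⇒≤ d)
      where open import Data.Nat.Divisibility using (∣⇒≤)

    n-1≡ : n ∸ 1 ≡ 2 ℕ.^ suc e ℕ.* t
    n-1≡ = trans (cong (_∸ 1) n≡) (ℕ.m+n∸n≡m (2 ℕ.^ suc e ℕ.* t) 1)

    -- The candidates must be distinct modulo n, and 2t + 3 ≤ 4t + 1 ≤ n. For e = 0 the claim is
    -- false, as n = 3 and T = 4, but then no root step is due.
    T<n : 1 ≤ e → T < n
    T<n (ℕ.s≤s {n = e′} _) = subst (suc T ≤_) (sym n≡) (begin
      suc (suc (suc (t ℕ.+ t)))         ≤⟨ ℕ.s≤s (ℕ.+-monoˡ-≤ (t ℕ.+ t) (ℕ.+-mono-≤ 0<t 0<t)) ⟩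
      suc (t ℕ.+ t ℕ.+ (t ℕ.+ t))       ≡⟨ lemma t ⟩
      2 ℕ.^ 2 ℕ.* t ℕ.+ 1               ≤⟨ ℕ.+-monoˡ-≤ 1 (ℕ.*-monoˡ-≤ t (ℕ.^-monoʳ-≤ 2 {2} {suc (suc e′)} (ℕ.s≤s (ℕ.s≤s ℕ.z≤n)))) ⟩
      2 ℕ.^ suc (suc e′) ℕ.* t ℕ.+ 1     ∎)
      where
      open ℕ.≤-Reasoning
      open import Data.Nat.Tactic.RingSolver using () renaming (solve-∀ to solveℕ-∀)
      lemma : ∀ t → suc (t ℕ.+ t ℕ.+ (t ℕ.+ t)) ≡ 4 ℕ.* t ℕ.+ 1
      lemma = solveℕ-∀

    Level : ℕ → ℕ → Set
    Level β j = (- (+ β)) ^ (2 ℕ.^ j) ≈ -1ℤ [ n ]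

    -- Used contrapositively: for n prime neither search can have come up empty, so the verification
    -- of the root must succeed, and a failed one refutes primality.
    complete : Prime n → ∀ {j} β u₀ u₁ w₀ w₁ → (- β) ^ (2 ℕ.^ j) ≈ -1ℤ [ n ] → suc j ≤ e →
      (∀ i → i < T → ∃[ x ] ∃[ y ] Shifted n t β (+ suc i) x y × shiftTest β (+ suc i) x y ≈ 0ℤ [ n ])
        ⊎ (∃[ s ] Shifted n t β s u₀ u₁ × shiftTest β s u₀ u₁ ≉ 0ℤ [ n ]) →
      (∀ i → i < suc e → ∃[ x ] ∃[ y ] Squared n β u₀ u₁ i x y × norm β x y ≉ 0ℤ [ n ])
        ⊎ (∃[ i ] Squared n β u₀ u₁ i w₀ w₁ × norm β w₀ w₁ ≈ 0ℤ [ n ]) →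
      w₀ * w₁ ^ (n ∸ 2) * (w₀ * w₁ ^ (n ∸ 2)) + β ≈ 0ℤ [ n ]
    complete pr {j} β u₀ u₁ w₀ w₁ level j<e = go (level⇒square pr n∤2 e t n-1≡ {β} {j} level j<e)
      where
      go : ∃[ a ] a * a ≈ β [ n ] → _ → _ → _
      go (a , a²) = conclude
        where
        open WithSquareRoot pr n∤2 e t n-1≡ 0<t (T<n (ℕ.≤-trans (ℕ.s≤s ℕ.z≤n) j<e)) {β} {j} level {a} a²
        conclude :
          (∀ i → i < T → ∃[ x ] ∃[ y ] Shifted n t β (+ suc i) x y × shiftTest β (+ suc i) x y ≈ 0ℤ [ n ])
            ⊎ (∃[ s ] Shifted n t β s u₀ u₁ × shiftTest β s u₀ u₁ ≉ 0ℤ [ n ]) →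
          (∀ i → i < suc e → ∃[ x ] ∃[ y ] Squared n β u₀ u₁ i x y × norm β x y ≉ 0ℤ [ n ])
            ⊎ (∃[ i ] Squared n β u₀ u₁ i w₀ w₁ × norm β w₀ w₁ ≈ 0ℤ [ n ]) →
          w₀ * w₁ ^ (n ∸ 2) * (w₀ * w₁ ^ (n ∸ 2)) + β ≈ 0ℤ [ n ]
        conclude (inj₁ none) _ = contradiction none shift-complete
        conclude (inj₂ (s , sh , nz)) (inj₁ none) = contradiction none (squares-complete {s} {u₀} {u₁} sh nz)
        conclude (inj₂ (s , sh , nz)) (inj₂ (i , sq , nm)) = root-complete {s} {u₀} {u₁} sh nz {i} {w₀} {w₁} sq nm

    data StepPost (μ ν : Memory) : Set where
      failure : ν #ok ≡ 0 → ν #d ≡ 0 → ¬ Prime n → StepPost μ ν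
      success : ν #ok ≡ μ #ok → ν #d ≡ μ #d ∸ 1 → + ν #β * + ν #β ≈ - (+ μ #β) [ n ] → StepPost μ ν

    stepCost : ℕ
    stepCost = shiftCost ℕ.+ (squaresCost ℕ.+ rootCost)

    step-spec : Good μ → Fixed μ → ∀ {j} → Level (μ #β) j → suc j ≤ e → Det root-step μ stepCost (StepPost μ)
    step-spec {μ} g fx {j} level j<e =
      seq {p = shift} (shift-spec g fx (T<n (ℕ.≤-trans (ℕ.s≤s ℕ.z≤n) j<e))) λ { {ν₁} g₁ f₁ shiftPost →
      seq {p = squares} (squares-spec g₁ (fixed (trans (f₁ #e refl) (cell-e fx)) (trans (f₁ #t refl) (cell-t fx)))) λ { {ν₂} g₂ f₂ squaresPost →
      consequence (root-spec g₂) ℕ.≤-refl λ { {ν₃} _ _ rootPost → conclude {ν₁} {ν₂} {ν₃} f₁ f₂ shiftPost squaresPost rootPost } } }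
      where
      conclude : ∀ {ν₁ ν₂ ν₃} → Frame shift μ ν₁ → Frame squares ν₁ ν₂ → ShiftPost μ ν₁ → SquaresPost ν₁ ν₂ → RootPost ν₂ ν₃ → StepPost μ ν₃
      conclude {ν₁} {ν₂} f₁ f₂ _ _ (success ok≡ d≡ β²) =
        success (trans ok≡ (trans (f₂ #ok refl) (f₁ #ok refl))) (trans d≡ (cong (_∸ 1) (trans (f₂ #d refl) (f₁ #d refl))))
          (≈-trans β² (≈-reflexive (cong (λ b → - (+ b)) (trans (f₂ #β refl) (f₁ #β refl)))))
      conclude {ν₁} {ν₂} f₁ f₂ shiftPost squaresPost (failure ok≡ d≡ nz) = failure ok≡ d≡ λ pr → nz
        (subst (λ b → Quotient² ν₂ + + b ≈ 0ℤ [ n ]) (sym (trans (f₂ #β refl) (f₁ #β refl)))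
          (complete pr {j} (+ μ #β) (+ ν₁ #u₀) (+ ν₁ #u₁) (+ ν₂ #w₀) (+ ν₂ #w₁) level j<e shiftPost
            (subst (λ b → (∀ i → i < suc e → ∃[ x ] ∃[ y ] Squared n (+ b) (+ ν₁ #u₀) (+ ν₁ #u₁) i x y × norm (+ b) x y ≉ 0ℤ [ n ])
                          ⊎ (∃[ i ] Squared n (+ b) (+ ν₁ #u₀) (+ ν₁ #u₁) i (+ ν₂ #w₀) (+ ν₂ #w₁) × norm (+ b) (+ ν₂ #w₀) (+ ν₂ #w₁) ≈ 0ℤ [ n ]))
              (f₁ #β refl) squaresPost)))

    -- What an accepted sample x reveals about the order of x ^ t.
    Start : ℤ → ℕ → Set
    Start x j = x ^ t * x ^ t ≈ x ^ t [ n ] ⊎ (x ^ t) ^ (2 ℕ.^ suc j) ≈ 1ℤ [ n ]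

    -- The equation makes `#d` the distance from level j to the top level e, where `pocklington`
    -- applies.
    data Active (ν : Memory) (j : ℕ) : Set where
      active : ν #ok ≡ 1 → ν #d ℕ.+ suc j ≡ suc e → Level (ν #β) j → Active ν j

    Rejected : Memory → Set
    Rejected ν = ν #ok ≡ 0 × ν #d ≡ 0 × ¬ Prime n

    LevelPost : ℤ → Memory → Set
    LevelPost x ν = (∃[ j ] Active ν j × Start x j) ⊎ Rejected ν

    levelCost : ℕ
    levelCost = 8 ℕ.+ (powerCost ℓ ℕ.+ (12 ℕ.+ ((1 ℕ.+ 6) ℕ.+ (1 ℕ.+ suc e ℕ.* (1 ℕ.+ (2 ℕ.+ ((1 ℕ.+ 6) ℕ.+ 4)))))))

    level-spec : Good μ → Fixed μ → Det level μ levelCost (LevelPost (+ μ #a))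
    level-spec {μ} g fx = seq {p = compile level-power} (block′ level-power g) λ { g₁ f₁ refl →
      seq {p = power} (power-spec g₁ ℓ (subst (_< 2 ℕ.^ ℓ) (sym k≡t) t<2^ℓ)) λ { {ξ} g₂ f₂ pow →
      seq {p = compile level-init} (block′ level-init g₂) λ { g₃ f₃ refl →
      seq {p = branch #g (compile level-reject) (compile level-accept) ∷ []}
        (choose {K = 6} {Q = J (suc e)} #g g₃
          (λ nz → consequence {K = 4} (block {Q = J (suc e)} level-reject g₃
            (c≡e g₂ f₂ , 0 , refl , y≈ g₂ pow , b≈ g₂ pow , inj₂ (refl , refl , (λ h → nonzero-test (rem<n g₂) nz (≈-trans (g≈ g₂ pow) (idempotent h)) ≈-refl) , λ _ ())))
            (ℕ.m≤m+n 4 2) λ _ _ q → q)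
          -- For β = 1 the element -β is -1, of level 0, and e steps remain.
          (λ z → block {Q = J (suc e)} level-accept g₃
            (c≡e g₂ f₂ , 0 , refl , y≈ g₂ pow , b≈ g₂ pow , inj₁ (0 ,
              active refl (trans (cong (ℕ._+ 1) (cong₂ _∸_ (trans (f₂ #e refl) (cell-e fx)) (cell₁ g₂))) (ℕ.+-comm e 1)) (≈-reflexive refl) ,
              inj₁ (combine 1ℤ (zero-test z (g≈ g₂ pow)) (lemma₁ X))))))
        λ { g₄ _ j → consequence (loop {p = level-body} #c J g₄ (λ (c≡0 , _) → c≡0) (λ r g _ j _ → body r g j) (suc e) j) ℕ.≤-refl
          λ { {ν} _ _ (c≡0 , r , c≡r , i , i+r≡e , _ , _ , status) →
            finish {ν} (trans (sym (ℕ.+-identityʳ i)) (trans (cong (i ℕ.+_) (trans (sym c≡0) c≡r)) i+r≡e)) status } } } } }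
      where
      μ₁ : Memory
      μ₁ = exec level-power μ
      X : ℤ
      X = (+ μ #a) ^ t
      lemma₁ : ∀ X → X * X ≡ X + 1ℤ * (X * X + - X - 0ℤ)
      lemma₁ = solve-∀
      idempotent : X * X ≈ X [ n ] → X * X + - X ≈ 0ℤ [ n ]
      idempotent h = combine 1ℤ h (lemma X)
        where
        lemma : ∀ X → X * X + - X ≡ 0ℤ + 1ℤ * (X * X - X)
        lemma = solve-∀
      k≡t : μ₁ #k ≡ t
      k≡t = trans (cong (λ x → apply rem (x ℕ.+ μ 3) (μ 0)) (cell-t fx)) (copy≡ g t<n)
      r≈ : ∀ {ξ} → Power μ₁ (μ₁ #k) ξ → + ξ #r₀ ≈ X [ n ]
      r≈ {ξ} pow = ≈-trans (≈-reflexive (lemma (+ ξ #r₀) (+ ξ #r₁))) (≈-trans (pow 0ℤ ≈-refl)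
        (≈-trans (^-cong (μ₁ #k) (≈-trans (≈-reflexive (ℤ.+-identityʳ (+ μ₁ #q₀))) (copy≈ g (μ #a))))
          (≈-reflexive (cong ((+ μ #a) ^_) k≡t))))
        where
        lemma : ∀ x y → x ≡ x + y * 0ℤ
        lemma = solve-∀
      c≡e : ∀ {ξ} → Good ξ → Frame power μ₁ ξ → apply rem (ξ #e ℕ.+ ξ 3) (ξ 0) ≡ suc e
      c≡e {ξ} g₂ f₂ = trans (cong (λ x → apply rem (x ℕ.+ ξ 3) (ξ 0)) (trans (f₂ #e refl) (cell-e fx))) (copy≡ g₂ e<n)
      b≈ : ∀ {ξ} → Good ξ → Power μ₁ (μ₁ #k) ξ → + exec level-init ξ #b ≈ X [ n ]
      b≈ {ξ} g₂ pow = ≈-trans (represents-exec level-init g₂ #b) (≈-trans (+cell₃ g₂ (+ ξ #r₀)) (r≈ {ξ} pow))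
      y≈ : ∀ {ξ} → Good ξ → Power μ₁ (μ₁ #k) ξ → + exec level-init ξ #y ≈ X ^ 1 [ n ]
      y≈ {ξ} g₂ pow = ≈-trans (represents-exec level-init g₂ #y) (≈-trans (+cell₃ g₂ (+ ξ #r₀))
        (≈-trans (r≈ {ξ} pow) (≈-reflexive (sym (ℤ.*-identityʳ X)))))
      g≈ : ∀ {ξ} → Good ξ → Power μ₁ (μ₁ #k) ξ → + exec level-init ξ #g ≈ X * X + - X [ n ]
      g≈ {ξ} g₂ pow = ≈-trans (represents-exec level-init g₂ #g) (+-cong (*-cong b b) (-‿cong b))
        where
        b : + ξ #r₀ + + ξ #zero ≈ X [ n ]
        b = ≈-trans (+cell₃ g₂ (+ ξ #r₀)) (r≈ {ξ} pow)
      Status : ℕ → Memory → Set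
      Status i ν = (∃[ j ] Active ν j × Start (+ μ #a) j) ⊎
        (ν #ok ≡ 0 × ν #d ≡ 0 × ¬ (X * X ≈ X [ n ]) × (∀ i′ → i′ < i → X ^ (2 ℕ.^ i′) ≉ -1ℤ [ n ]))
      J : ℕ → Memory → Set
      J r ν = ν #c ≡ r × ∃[ i ] i ℕ.+ r ≡ suc e × (+ ν #y ≈ X ^ (2 ℕ.^ i) [ n ]) × (+ ν #b ≈ X [ n ]) × Status i ν
      finish : ∀ {ν i} → i ≡ suc e → Status i ν → LevelPost (+ μ #a) ν
      finish refl (inj₁ ready) = inj₁ ready
      finish refl (inj₂ (ok≡ , d≡ , X²≉X , none)) = inj₂ (ok≡ , d≡ , λ pr → composite pr)
        where
        composite : Prime n → ⊥
        composite pr with ProthPrime.initial-level pr n∤2 e t n-1≡ 0<t (+ μ #a)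
        ... | inj₁ h             = X²≉X h
        ... | inj₂ (i , i<e , h) = none i i<e h
      body : ∀ r {ν} → Good ν → J (suc r) ν → Det level-body ν 13 (J r)
      body r {ν} g₁ (c≡ , i , i+r≡ , y≈ , b≈ , status) =
        seq {p = compile level-test} (block′ level-test g₁) λ { g₂ f₂ refl →
        seq {p = branch #g [] (compile level-found) ∷ []}
          (choose {K = 6} {Q = Chosen} #g g₂
            (λ nz → consequence {K = 0} (skip {Q = Chosen} g₂ (refl , refl , refl , rejected nz)) ℕ.z≤n λ _ _ q → q)
            (λ z → block {Q = Chosen} level-found g₂ (refl , refl , refl , inj₁ (i , found g₂ z))))
          λ { {ζ} g₃ _ q → block {Q = J r} level-next g₃ (advance g₃ q) } }
        where
        ν₂ : Memory
        ν₂ = exec level-test ν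
        g≈′ : + ν₂ #g ≈ X ^ (2 ℕ.^ i) + 1ℤ [ n ]
        g≈′ = ≈-trans (represents-exec level-test g₁ #g) (+-cong y≈ (≈-reflexive (cong +_ (cell₁ g₁))))
        Chosen : Memory → Set
        Chosen ζ = ζ #c ≡ ν #c × ζ #y ≡ ν #y × ζ #b ≡ ν #b × Status (suc i) ζ
        rejected : ν₂ #g ≢ 0 → Status (suc i) ν₂
        rejected nz = extend status
          where
          extend : Status i ν → Status (suc i) ν₂
          extend (inj₁ (j , active a b c , s)) = inj₁ (j , active a b c , s)
          extend (inj₂ (ok≡ , d≡ , X²≉X , none)) = inj₂ (ok≡ , d≡ , X²≉X , go)
            where
            go : ∀ i′ → i′ < suc i → X ^ (2 ℕ.^ i′) ≉ -1ℤ [ n ]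
            go i′ (ℕ.s≤s i′≤i) h with i′ ℕ.≟ i
            ... | yes refl = nonzero-test (rem<n g₁) nz g≈′ (+-cong h ≈-refl)
            ... | no  i′≢i = none i′ (ℕ.≤∧≢⇒< i′≤i i′≢i) h
        found : Good ν₂ → ν₂ #g ≡ 0 → Active (exec level-found ν₂) i × Start (+ μ #a) i
        found g₂ z = active refl d≡ lvl , inj₂ (≈-trans (≈-reflexive (^2^suc X i)) (*-cong h h))
          where
          h : X ^ (2 ℕ.^ i) ≈ -1ℤ [ n ]
          h = combine 1ℤ (zero-test z g≈′) (lemma (X ^ (2 ℕ.^ i)))
            where
            lemma : ∀ y → y ≡ -1ℤ + 1ℤ * (y + 1ℤ - 0ℤ)
            lemma = solve-∀
          d≡ : ν #c ∸ ν 1 ℕ.+ suc i ≡ suc e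
          d≡ = trans (cong (ℕ._+ suc i) (cong₂ _∸_ c≡ (cell₁ g₁))) (trans (ℕ.+-comm r (suc i)) (trans (sym (ℕ.+-suc i r)) i+r≡))
          lvl : Level (exec level-found ν₂ #β) i
          lvl = ≈-trans (^-cong (2 ℕ.^ i) (≈-trans (-‿cong (≈-trans (represents-exec level-found g₂ #β) (-‿cong b≈))) (≈-reflexive (ℤ.neg-involutive X)))) h
        advance : ∀ {ζ} → Good ζ → Chosen ζ → J r (exec level-next ζ)
        advance {ζ} g₃ (c≡′ , y≡ , b≡ , status′) =
          cong₂ _∸_ (trans c≡′ c≡) (cell₁ g₃) , suc i , trans (sym (ℕ.+-suc i r)) i+r≡ ,
          ≈-trans (represents-exec level-next g₃ #y) (≈-trans (≈-reflexive (cong (λ y → + y * + y) y≡))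
            (≈-trans (*-cong y≈ y≈) (≈-reflexive (sym (^2^suc X i))))) ,
          subst (λ v → + v ≈ X [ n ]) (sym b≡) b≈ , carry status′
          where
          carry : Status (suc i) ζ → Status (suc i) (exec level-next ζ)
          carry (inj₁ (j , active a b c , s)) = inj₁ (j , active a b c , s)
          carry (inj₂ s) = inj₂ s

    Answer : Memory → Set
    Answer ν = (ν #ok ≡ 1 × Prime n) ⊎ (ν #ok ≡ 0 × ¬ Prime n)

    module _ (f : ℕ) (limit : ∀ {β j} → Level β j → suc j ≤ f) where

      mainCost : ℕ → ℕ
      mainCost R = levelCost ℕ.+ (1 ℕ.+ R ℕ.* (1 ℕ.+ stepCost))

      -- The budget is measured by f, not by `#d`. A successful step raises j and lowers the
      -- remaining budget r, preserving `f ≤ r + j`; at r = 0 an active state would contradict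
      -- `limit`. Hence for composite n the chain fails within the budget.
      main-spec : ∀ R → Good μ → Fixed μ → (∀ {j} → Start (+ μ #a) j → f ≤ R ℕ.+ j) → Det main μ (mainCost R) Answer
      main-spec {μ} R g fx bound = seq {p = level} (level-spec g fx) λ { {μ₁} g₁ f₁ post →
          consequence (loop #d J g₁ (λ {ν} → stop {ν}) (body {μ₁} (fixed (trans (f₁ #e refl) (cell-e fx)) (trans (f₁ #t refl) (cell-t fx)))) R (start {μ₁} post))
            ℕ.≤-refl λ { {ν} _ _ (d≡0 , r , status) → finish {ν} d≡0 status } }
        where
        J : ℕ → Memory → Set
        J r ν = (∃[ j ] Active ν j × f ≤ r ℕ.+ j) ⊎ Rejected ν
        start : ∀ {ν} → LevelPost (+ μ #a) ν → J R ν
        start (inj₁ (j , act , s)) = inj₁ (j , act , bound s)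
        start (inj₂ rejected)      = inj₂ rejected
        stop : ∀ {ν} → J 0 ν → ν #d ≡ 0
        stop {ν} (inj₁ (j , active _ _ level , f≤j)) = contradiction f≤j (ℕ.<⇒≱ (limit {ν #β} {j} level))
        stop (inj₂ (_ , d≡0 , _)) = d≡0
        finish : ∀ {ν r} → ν #d ≡ 0 → J r ν → Answer ν
        finish _ (inj₂ (ok≡0 , _ , composite)) = inj₂ (ok≡0 , composite)
        finish {ν} d≡0 (inj₁ (j , active ok≡1 d+j≡e level , _)) = inj₁ (ok≡1 , subst Prime (sym n≡) (pocklington e t t<2^e 0<t
          (subst (λ m → (- (+ ν #β)) ^ (2 ℕ.^ e) ≈ -1ℤ [ m ]) n≡ (subst (λ j → Level (ν #β) j) (ℕ.suc-injective (trans (cong (ℕ._+ suc j) (sym d≡0)) d+j≡e)) level))))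
        body : ∀ {μ₁} → Fixed μ₁ → ∀ r {ν} → Good ν → Frame root-step μ₁ ν → J (suc r) ν → ν #d ≢ 0 → Det root-step ν stepCost (J r)
        body fx₁ r g₂ f₂ (inj₂ (_ , d≡0 , _)) d≢0 = contradiction d≡0 d≢0
        body fx₁ r {ν} g₂ f₂ (inj₁ (j , active ok≡1 d+j≡e level , f≤)) d≢0 =
          consequence (step-spec g₂ (fixed (trans (f₂ #e refl) (cell-e fx₁)) (trans (f₂ #t refl) (cell-t fx₁))) {j} level j<e) ℕ.≤-refl
            λ { _ _ (failure ok≡0 d≡0 composite) → inj₂ (ok≡0 , d≡0 , composite)
              ; {ξ} _ _ (success ok≡ d≡ β²) → inj₁ (suc j , active (trans ok≡ ok≡1) (d+ d≡) (next-level {ξ} β²) , subst (f ≤_) (sym (ℕ.+-suc r j)) f≤) }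
          where
          d-view : ∃[ d ] ν #d ≡ suc d
          d-view = ℕ.pred (ν #d) , sym (ℕ.suc-pred (ν #d) {{ℕ.≢-nonZero d≢0}})
          d : ℕ
          d = proj₁ d-view
          e≡ : suc (d ℕ.+ suc j) ≡ suc e
          e≡ = trans (cong (ℕ._+ suc j) (sym (proj₂ d-view))) d+j≡e
          j<e : suc j ≤ e
          j<e = subst (suc j ≤_) (ℕ.suc-injective e≡) (ℕ.m≤n+m (suc j) d)
          d+ : ∀ {d′} → d′ ≡ ν #d ∸ 1 → d′ ℕ.+ suc (suc j) ≡ suc e
          d+ refl = trans (cong (λ x → x ∸ 1 ℕ.+ suc (suc j)) (proj₂ d-view)) (trans (ℕ.+-suc d (suc j)) e≡)
          next-level : ∀ {ξ} → + ξ #β * + ξ #β ≈ - (+ ν #β) [ n ] → Level (ξ #β) (suc j)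
          next-level {ξ} β² = ≈-trans (≈-reflexive (trans (^2^suc (- b) j) (trans (sym (^-distrib-* (- b) (- b) (2 ℕ.^ j))) (cong (_^ (2 ℕ.^ j)) (lemma b)))))
            (≈-trans (^-cong (2 ℕ.^ j) β²) level)
            where
            b : ℤ
            b = + ξ #β
            lemma : ∀ b → - b * - b ≡ b * b
            lemma = solve-∀

-- Counting samples with a low starting level

module Counting where

  open Congruence
  open NumberTheory
  open import Data.Integer as ℤ using (ℤ; +_; 0ℤ; 1ℤ; -1ℤ)
  import Data.Integer.Properties as ℤ
  open import Data.Integer.Tactic.RingSolver using () renaming (solve-∀ to solveℤ-∀)
  open import Data.Nat
  open import Data.Nat.Properties
  open import Data.Nat.Divisibility using (_∣_; divides; _∣?_; ∣-trans; *-cancelˡ-∣; m∣m*n)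
  open import Data.Nat.DivMod using (m≡m%n+[m/n]*n; m%n<n; m/n*n≤m)
  open import Data.Nat.Induction using (<-rec)
  open import Data.Nat.Primality using (Prime)
  open import Data.Nat.Tactic.RingSolver using (solve-∀)
  open import Data.List using (List; []; _∷_; length)
  open import Data.List.Relation.Unary.All using (All; []; _∷_)
  open import Data.List.Relation.Unary.AllPairs using ([]; _∷_)
  open import Data.Product using (_×_; _,_; ∃-syntax)
  open import Data.Sum using (_⊎_; inj₁; inj₂)
  open import Relation.Nullary using (¬_; Dec; yes; no; contradiction)
  open import Relation.Nullary.Decidable using (_⊎-dec_)
  open import Relation.Binary.PropositionalEquality

  rangeSum : (ℕ → ℕ) → ℕ → ℕ → ℕ
  rangeSum F b zero    = 0
  rangeSum F b (suc l) = F b + rangeSum F (suc b) l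

  rangeSum-split : ∀ F b l k → rangeSum F b (l + k) ≡ rangeSum F b l + rangeSum F (b + l) k
  rangeSum-split F b zero    k = cong (λ c → rangeSum F c k) (sym (+-identityʳ b))
  rangeSum-split F b (suc l) k = trans (cong (λ x → F b + x) (trans (rangeSum-split F (suc b) l k)
    (cong (λ c → rangeSum F (suc b) l + rangeSum F c k) (sym (+-suc b l))))) (sym (+-assoc (F b) _ _))

  rangeSum-mono : ∀ F b {l k} → l ≤ k → rangeSum F b l ≤ rangeSum F b k
  rangeSum-mono F b {l} {k} l≤k = subst (λ k → rangeSum F b l ≤ rangeSum F b k) (m+[n∸m]≡n l≤k)
    (≤-trans (m≤m+n _ _) (≤-reflexive (sym (rangeSum-split F b l (k ∸ l)))))

  rangeSum-+ : ∀ F G b l → rangeSum (λ x → F x + G x) b l ≡ rangeSum F b l + rangeSum G b l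
  rangeSum-+ F G b zero    = refl
  rangeSum-+ F G b (suc l) = trans (cong (λ x → F b + G b + x) (rangeSum-+ F G (suc b) l)) (lemma (F b) (G b) _ _)
    where
    lemma : ∀ a b c d → a + b + (c + d) ≡ a + c + (b + d)
    lemma = solve-∀

  rangeSum-const : ∀ c b l → rangeSum (λ _ → c) b l ≡ l * c
  rangeSum-const c b zero    = refl
  rangeSum-const c b (suc l) = cong (λ x → c + x) (rangeSum-const c (suc b) l)

  rangeSum-cong : ∀ F G → (∀ x → F x ≡ G x) → ∀ b l → rangeSum F b l ≡ rangeSum G b l
  rangeSum-cong F G h b zero    = refl
  rangeSum-cong F G h b (suc l) = cong₂ _+_ (h b) (rangeSum-cong F G h (suc b) l)

  rangeSum-* : ∀ F c b l → rangeSum (λ x → F x * c) b l ≡ rangeSum F b l * c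
  rangeSum-* F c b zero    = refl
  rangeSum-* F c b (suc l) = trans (cong (λ x → F b * c + x) (rangeSum-* F c (suc b) l)) (sym (*-distribʳ-+ c (F b) _))

  rangeSum-blocks : ∀ F p D → (∀ b → rangeSum F b p ≤ D) → ∀ K b → rangeSum F b (K * p) ≤ K * D
  rangeSum-blocks F p D h zero    b = z≤n
  rangeSum-blocks F p D h (suc K) b = subst (_≤ suc K * D) (sym (rangeSum-split F b p (K * p)))
    (+-mono-≤ (h b) (rangeSum-blocks F p D h K (b + p)))

  upto : (ℕ → ℕ → ℕ) → ℕ → ℕ → ℕ
  upto χ zero    x = 0
  upto χ (suc k) x = upto χ k x + χ (suc k) x

  -- The geometric sum of B / 2 ^ i for i from 1 to k is B - B / 2 ^ k. Scaling by 2 ^ k and moving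
  -- the negative term to the left gives a form over ℕ that is inductive.
  upto-geometric : ∀ χ B b l k → (∀ i → i ≤ k → rangeSum (χ i) b l * 2 ^ i ≤ B) →
                   rangeSum (upto χ k) b l * 2 ^ k + B ≤ B * 2 ^ k
  upto-geometric χ B b l zero h rewrite rangeSum-const 0 b l | *-zeroʳ l = ≤-reflexive (sym (*-identityʳ B))
  upto-geometric χ B b l (suc k) h = begin
    rangeSum (upto χ (suc k)) b l * 2 ^ suc k + B   ≡⟨ cong (λ z → z * 2 ^ suc k + B) (rangeSum-+ (upto χ k) (χ (suc k)) b l) ⟩
    (S + s) * 2 ^ suc k + B                         ≡⟨ lemma₁ S s (2 ^ k) B ⟩
    2 * (S * 2 ^ k) + s * (2 * 2 ^ k) + B           ≤⟨ +-monoˡ-≤ B (+-monoʳ-≤ (2 * (S * 2 ^ k)) (h (suc k) ≤-refl)) ⟩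
    2 * (S * 2 ^ k) + B + B                         ≡⟨ lemma₂ (S * 2 ^ k) B ⟩
    2 * (S * 2 ^ k + B)                             ≤⟨ *-monoʳ-≤ 2 (upto-geometric χ B b l k (λ i i≤k → h i (m≤n⇒m≤1+n i≤k))) ⟩
    2 * (B * 2 ^ k)                                 ≡⟨ lemma₃ B (2 ^ k) ⟩
    B * 2 ^ suc k                                   ∎
    where
    open ≤-Reasoning
    S s : ℕ
    S = rangeSum (upto χ k) b l
    s = rangeSum (χ (suc k)) b l
    lemma₁ : ∀ S s x B → (S + s) * (2 * x) + B ≡ 2 * (S * x) + s * (2 * x) + B
    lemma₁ = solve-∀
    lemma₂ : ∀ S B → 2 * S + B + B ≡ 2 * (S + B)
    lemma₂ = solve-∀
    lemma₃ : ∀ B x → 2 * (B * x) ≡ B * (2 * x)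
    lemma₃ = solve-∀

  upto≤ : ∀ χ → (∀ i x → χ i x ≤ 1) → ∀ k x → upto χ k x ≤ k
  upto≤ χ h zero    x = z≤n
  upto≤ χ h (suc k) x = subst (upto χ k x + χ (suc k) x ≤_) (+-comm k 1) (+-mono-≤ (upto≤ χ h k x) (h (suc k) x))

  upto≥ : ∀ χ x k m → m ≤ k → (∀ i → 1 ≤ i → i ≤ m → 1 ≤ χ i x) → m ≤ upto χ k x
  upto≥ χ x zero    zero    _ h = z≤n
  upto≥ χ x (suc k) m m≤ h with m ≟ suc k
  ... | no  m≢ = ≤-trans (upto≥ χ x k m (s≤s⁻¹ (≤∧≢⇒< m≤ m≢)) h) (m≤m+n _ _)
  ... | yes refl = subst (_≤ upto χ k x + χ (suc k) x) (+-comm k 1)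
    (+-mono-≤ (upto≥ χ x k k ≤-refl (λ i 1≤i i≤k → h i 1≤i (m≤n⇒m≤1+n i≤k))) (h (suc k) (s≤s z≤n) ≤-refl))

  2-adic : ∀ m → 0 < m → ∃[ f ] ∃[ u ] m ≡ 2 ^ f * u × ¬ 2 ∣ u
  2-adic = <-rec _ go
    where
    go : ∀ m → (∀ {k} → k < m → 0 < k → ∃[ f ] ∃[ u ] k ≡ 2 ^ f * u × ¬ 2 ∣ u) → 0 < m → ∃[ f ] ∃[ u ] m ≡ 2 ^ f * u × ¬ 2 ∣ u
    go m rec 0<m with 2 ∣? m
    ... | no  odd = 0 , m , sym (+-identityʳ m) , odd
    ... | yes (divides zero refl) = contradiction 0<m λ ()
    ... | yes (divides k@(suc _) refl) with rec {k} (m<m*n k 2 (s≤s (s≤s z≤n))) (s≤s z≤n)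
    ... | f , u , eq , odd = suc f , u , trans (cong (_* 2) eq) (lemma (2 ^ f) u) , odd
      where
      lemma : ∀ x u → x * u * 2 ≡ 2 * x * u
      lemma = solve-∀

  2^∣⇒≤ : ∀ {k f u} → ¬ 2 ∣ u → 2 ^ k ∣ 2 ^ f * u → k ≤ f
  2^∣⇒≤ {k} {f} {u} odd d = ≮⇒≥ λ f<k → odd (*-cancelˡ-∣ (2 ^ f) {{m^n≢0 2 f}} (∣-trans
    (subst (2 ^ f * 2 ∣_) (trans (lemma (2 ^ f) (2 ^ (k ∸ suc f))) (trans (sym (^-distribˡ-+-* 2 (suc f) (k ∸ suc f))) (cong (2 ^_) (m+[n∸m]≡n f<k)))) (m∣m*n (2 ^ (k ∸ suc f)))) d))
    where
    lemma : ∀ x y → x * 2 * y ≡ 2 * x * y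
    lemma = solve-∀

  module RootCount {p} (pr : Prime p) where

    -- The zeros of X * (X ^ D - 1). Samples divisible by p are included because they give no lower
    -- bound for the starting level: the idempotent 0 starts at level 0.
    Root : ℕ → ℕ → Set
    Root D x = + x ≈ 0ℤ [ p ] ⊎ (+ x) ℤ.^ D ≈ 1ℤ [ p ]

    root? : ∀ D x → Dec (Root D x)
    root? D x = (_ ≈? _ [ p ]) ⊎-dec (_ ≈? _ [ p ])

    isRoot : ℕ → ℕ → ℕ
    isRoot D x with root? D x
    ... | yes _ = 1
    ... | no  _ = 0

    isRoot≤1 : ∀ D x → isRoot D x ≤ 1
    isRoot≤1 D x with root? D x
    ... | yes _ = s≤s z≤n
    ... | no  _ = z≤n

    isRoot≥1 : ∀ {D x} → Root D x → 1 ≤ isRoot D x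
    isRoot≥1 {D} {x} r with root? D x
    ... | yes _ = s≤s z≤n
    ... | no ¬r = contradiction r ¬r

    roots : ℕ → ℕ → ℕ → List ℤ
    roots D b zero = []
    roots D b (suc l) with root? D b
    ... | yes _ = + b ∷ roots D (suc b) l
    ... | no  _ = roots D (suc b) l

    length-roots : ∀ D b l → length (roots D b l) ≡ rangeSum (isRoot D) b l
    length-roots D b zero = refl
    length-roots D b (suc l) with root? D b
    ... | yes _ = cong suc (length-roots D (suc b) l)
    ... | no  _ = length-roots D (suc b) l

    poly : ℕ → List ℤ
    poly D = 0ℤ ∷ unityPoly D

    root⇒ : ∀ D x → Root (suc D) x → ⟦ poly D ⟧ (+ x) ≈ 0ℤ [ p ]
    root⇒ D x r = go (+ x) (⟦ unityPoly D ⟧ (+ x)) (cases r)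
      where
      cases : Root (suc D) x → + x ≈ 0ℤ [ p ] ⊎ ⟦ unityPoly D ⟧ (+ x) ≈ 0ℤ [ p ]
      cases (inj₁ h) = inj₁ h
      cases (inj₂ h) = inj₂ (≈1⇒root D (+ x) h)
      go : ∀ x y → x ≈ 0ℤ [ p ] ⊎ y ≈ 0ℤ [ p ] → 0ℤ ℤ.+ x ℤ.* y ≈ 0ℤ [ p ]
      go x y (inj₁ h) = combine y h (lemma x y)
        where
        lemma : ∀ x y → 0ℤ ℤ.+ x ℤ.* y ≡ 0ℤ ℤ.+ y ℤ.* (x ℤ.- 0ℤ)
        lemma = solveℤ-∀
      go x y (inj₂ h) = combine x h (lemma x y)
        where
        lemma : ∀ x y → 0ℤ ℤ.+ x ℤ.* y ≡ 0ℤ ℤ.+ x ℤ.* (y ℤ.- 0ℤ)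
        lemma = solveℤ-∀

    roots-All : ∀ {P : ℕ → Set} {Q : ℤ → Set} D b l → (∀ i → b ≤ i → i < b + l → Root D i → Q (+ i)) → All Q (roots D b l)
    roots-All D b zero h = []
    roots-All {P} {Q} D b (suc l) h with root? D b | roots-All {P} {Q} D (suc b) l (λ i b<i i< → h i (<⇒≤ b<i) (subst (i <_) (sym (+-suc b l)) i<))
    ... | yes r | all = h b ≤-refl (m<m+n b (s≤s z≤n)) r ∷ all
    ... | no  _ | all = all

    ≉-in-block : ∀ {i j} → i < j → j < i + p → + i ≉ + j [ p ]
    ≉-in-block {i} {j} i<j j<i+p h = <⇒≱ i<j (≤-reflexive (m∸n≡0⇒m≤n′ (small≈⇒≡ {p} {j ∸ i} {0} j-i<p 0<p diff)))
      where
      j-i<p : j ∸ i < p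
      j-i<p = +-cancelˡ-< i (j ∸ i) p (subst (_< i + p) (sym (m+[n∸m]≡n (<⇒≤ i<j))) j<i+p)
      0<p : 0 < p
      0<p = ≤-<-trans z≤n j-i<p
      m∸n≡0⇒m≤n′ : j ∸ i ≡ 0 → j ≡ i
      m∸n≡0⇒m≤n′ eq = ≤-antisym (m∸n≡0⇒m≤n eq) (<⇒≤ i<j)
      diff : + (j ∸ i) ≈ + 0 [ p ]
      diff = combine -1ℤ h (trans (sym (ℤ.⊖-≥ (<⇒≤ i<j))) (trans (sym (ℤ.m-n≡m⊖n j i)) (lemma (+ i) (+ j))))
        where
        lemma : ∀ i j → j ℤ.- i ≡ 0ℤ ℤ.+ -1ℤ ℤ.* (i ℤ.- j)
        lemma = solveℤ-∀

    roots-distinct : ∀ D b l → l ≤ p → Distinct p (roots D b l)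
    roots-distinct D b zero    _   = []
    roots-distinct D b (suc l) l<p with root? D b
    ... | yes _ = roots-All {λ _ → ℕ} D (suc b) l (λ i b<i i< _ → ≉-in-block b<i
                    (<-≤-trans (subst (i <_) (sym (+-suc b l)) i<) (+-monoʳ-≤ b l<p))) ∷ roots-distinct D (suc b) l (<⇒≤ l<p)
    ... | no  _ = roots-distinct D (suc b) l (<⇒≤ l<p)

    block-count : ∀ D b → rangeSum (isRoot (suc D)) b p ≤ suc (suc D)
    block-count D b = subst₂ _≤_ (length-roots (suc D) b p) (cong suc (length-unityPoly D))
      (lagrange pr (poly D) (roots (suc D) b p) (roots-distinct (suc D) b p ≤-refl)
        (roots-All {λ _ → ℕ} (suc D) b p λ i _ _ r → root⇒ D i r))

    -- The range is covered by M / p + 1 windows of p consecutive integers, at most 2M / p of them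
    -- as p ≤ M, and each window contains at most D + 1 ≤ 2D zeros.
    count : ∀ D M → 0 < D → p ≤ M → rangeSum (isRoot D) 0 M * p ≤ 4 * M * D
    count (suc D) M _ p≤M = begin
      rangeSum (isRoot (suc D)) 0 M * p        ≤⟨ *-monoˡ-≤ p (≤-trans (rangeSum-mono (isRoot (suc D)) 0 M≤Kp) (rangeSum-blocks (isRoot (suc D)) p (suc (suc D)) (block-count D) K 0)) ⟩
      K * suc (suc D) * p                      ≡⟨ lemma₁ K (suc (suc D)) p ⟩
      K * p * suc (suc D)                      ≤⟨ *-mono-≤ Kp≤2M 2+D≤ ⟩
      2 * M * (2 * suc D)                      ≡⟨ lemma₂ M (suc D) ⟩
      4 * M * suc D                            ∎
      where
      open ≤-Reasoning
      instance
        p≢0 : NonZero p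
        p≢0 = Data.Nat.Primality.prime⇒nonZero pr
          where import Data.Nat.Primality
      K : ℕ
      K = suc (M / p)
      M≤Kp : M ≤ K * p
      M≤Kp = ≤-trans (≤-reflexive (m≡m%n+[m/n]*n M p)) (+-monoˡ-≤ (M / p * p) (<⇒≤ (m%n<n M p)))
      Kp≤2M : K * p ≤ 2 * M
      Kp≤2M = +-mono-≤ p≤M (≤-trans (m/n*n≤m M p) (≤-reflexive (sym (+-identityʳ M))))
      2+D≤ : suc (suc D) ≤ 2 * suc D
      2+D≤ = s≤s (≤-trans (s≤s (m≤m+n D 0)) (m≤n+m (suc (D + 0)) D))
      lemma₁ : ∀ a b c → a * b * c ≡ a * c * b
      lemma₁ = solve-∀
      lemma₂ : ∀ M D → 2 * M * (2 * D) ≡ 4 * M * D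
      lemma₂ = solve-∀

  -- With p - 1 = 2 ^ f * u, attempts x bounds the number of square root steps
  -- needed after the sample x: χ i x tells whether the level of x is at most f - i,
  -- or p ∣ x.
  module Attempts {n p} (pr : Prime p) (p∤2 : ¬ p ∣ 2) (p∣n : p ∣ n) {f u} (p-1≡ : p ∸ 1 ≡ 2 ^ f * u) (u-odd : ¬ 2 ∣ u) where
    open RootCount pr
    open OddPrime pr p∤2

    χ : ℕ → ℕ → ℕ
    χ i = isRoot (2 ^ (f ∸ i) * u)

    attempts : ℕ → ℕ
    attempts x = 1 + upto χ f x

    attempts≤ : ∀ x → attempts x ≤ suc f
    attempts≤ x = s≤s (upto≤ χ (λ i → isRoot≤1 (2 ^ (f ∸ i) * u)) f x)

    -- The level is read modulo the chosen prime divisor, which caps the climb for composite n as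
    -- well.
    limit : ∀ {x j} → x ℤ.^ (2 ^ j) ≈ -1ℤ [ n ] → suc j ≤ f
    limit {x} {j} h = 2^∣⇒≤ u-odd (subst (2 ^ suc j ∣_) p-1≡ (2^∣order {x} j h′ (fermat pr x≉0)))
      where
      h′ : x ℤ.^ (2 ^ j) ≈ -1ℤ [ p ]
      h′ = ≈-weaken p∣n h
      x≉0 : x ≉ 0ℤ [ p ]
      x≉0 = power≈-1⇒≉0 pr (m^n>0 2 j) h′

    -- By `power-residue`, a start at level j makes x count for every i ≤ f - j - 1. The summand 1
    -- in `attempts` pays for a step at level f - 1, which cannot lead any higher.
    attempts≥ : ∀ {t} → ¬ 2 ∣ t → ∀ x j → (+ x) ℤ.^ t ℤ.* (+ x) ℤ.^ t ≈ (+ x) ℤ.^ t [ n ] ⊎ ((+ x) ℤ.^ t) ℤ.^ (2 ^ suc j) ≈ 1ℤ [ n ] →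
                f ≤ attempts x + j
    attempts≥ {t} t-odd x j start with ≤-total f (suc j)
    ... | inj₁ f≤ = ≤-trans f≤ (s≤s (m≤n+m j _))
    ... | inj₂ j<f = subst (_≤ attempts x + j) (trans (sym (+-suc (f ∸ suc j) j)) (m∸n+n≡m j<f))
          (s≤s (+-monoˡ-≤ j (upto≥ χ x f (f ∸ suc j) (m∸n≤m f (suc j)) λ i _ i≤ → isRoot≥1 (root i i≤))))
      where
      X : ℤ
      X = (+ x) ℤ.^ t
      unity : X ℤ.* X ≈ X [ n ] ⊎ X ℤ.^ (2 ^ suc j) ≈ 1ℤ [ n ] → + x ≉ 0ℤ [ p ] → X ℤ.^ (2 ^ suc j) ≈ 1ℤ [ p ]
      unity (inj₂ h) x≉0 = ≈-weaken p∣n h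
      -- An idempotent that is a unit modulo p is 1.
      unity (inj₁ h) x≉0 = ≈1⇒^≈1 (2 ^ suc j) (*-cancelˡ-≈ pr (^-≉0 pr t x≉0) (≈-trans (≈-weaken p∣n h) (≈-reflexive (sym (ℤ.*-identityʳ X)))))
      root : ∀ i → i ≤ f ∸ suc j → Root (2 ^ (f ∸ i) * u) x
      root i i≤ with + x ≈? 0ℤ [ p ]
      ... | yes x≈0 = inj₁ x≈0
      ... | no  x≉0 = inj₂ (power-residue {a = + x} {t} {u} {f} {i} {suc j} t-odd p-1≡
            (≤-trans (+-monoˡ-≤ (suc j) i≤) (≤-reflexive (m∸n+n≡m j<f))) x≉0
            (≈-trans (≈-reflexive (sym (ℤ.^-*-assoc (+ x) t (2 ^ suc j)))) (unity start x≉0)))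

    -- Since 2 ^ (f - i) * u * 2 ^ i = p - 1, the count for level f - i is at most 4M / 2 ^ i. The
    -- geometric series contributes 4M, and the constant summand M.
    attempts-total : ∀ M → p ≤ M → rangeSum attempts 0 M ≤ 5 * M
    attempts-total M p≤M = begin
      rangeSum attempts 0 M                              ≡⟨ rangeSum-+ (λ _ → 1) (upto χ f) 0 M ⟩
      rangeSum (λ _ → 1) 0 M + rangeSum (upto χ f) 0 M   ≤⟨ +-mono-≤ (≤-reflexive (trans (rangeSum-const 1 0 M) (*-identityʳ M))) total ⟩
      5 * M                                              ∎
      where
      open ≤-Reasoning
      total : rangeSum (upto χ f) 0 M ≤ 4 * M
      total = *-cancelʳ-≤ _ _ (2 ^ f) {{m^n≢0 2 f}} (≤-trans (m≤m+n _ (4 * M)) (upto-geometric χ (4 * M) 0 M f each))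
        where
        p-1>0 : 0 < p ∸ 1
        p-1>0 = m<n⇒0<n∸m (<-trans (s≤s (s≤s z≤n)) 2<p)
        each : ∀ i → i ≤ f → rangeSum (χ i) 0 M * 2 ^ i ≤ 4 * M
        each i i≤f = *-cancelʳ-≤ _ _ p (begin
          s * 2 ^ i * p                          ≡⟨ lemma₁ s (2 ^ i) p ⟩
          s * p * 2 ^ i                          ≤⟨ *-monoˡ-≤ (2 ^ i) (count D M D>0 p≤M) ⟩
          4 * M * D * 2 ^ i                      ≡⟨ lemma₂ (4 * M) (2 ^ (f ∸ i)) u (2 ^ i) ⟩
          4 * M * (2 ^ (f ∸ i) * 2 ^ i * u)      ≡⟨ cong (4 * M *_) D*2^i≡ ⟩
          4 * M * (p ∸ 1)                        ≤⟨ *-monoʳ-≤ (4 * M) (m∸n≤m p 1) ⟩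
          4 * M * p                              ∎)
          where
          s D : ℕ
          s = rangeSum (χ i) 0 M
          D = 2 ^ (f ∸ i) * u
          lemma₁ : ∀ a b c → a * b * c ≡ a * c * b
          lemma₁ = solve-∀
          lemma₂ : ∀ a b u d → a * (b * u) * d ≡ a * (b * d * u)
          lemma₂ = solve-∀
          D*2^i≡ : 2 ^ (f ∸ i) * 2 ^ i * u ≡ p ∸ 1
          D*2^i≡ = trans (cong (_* u) (trans (sym (^-distribˡ-+-* 2 (f ∸ i) i)) (cong (2 ^_) (m∸n+n≡m i≤f)))) (sym p-1≡)
          u>0 : 0 < u
          u>0 = n≢0⇒n>0 λ u≡0 → <⇒≢ p-1>0 (sym (trans p-1≡ (trans (cong (2 ^ f *_) u≡0) (*-zeroʳ (2 ^ f)))))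
          D>0 : 0 < D
          D>0 = *-mono-≤ (m^n>0 2 (f ∸ i)) u>0

-- Random sampling and the expected cost of a run

module Sampling where

  open Congruence
  open Machine
  open Algorithm
  open Power
  open RootStep
  open Chain
  open Counting using (rangeSum; rangeSum-split; rangeSum-+; rangeSum-const; rangeSum-*; rangeSum-cong)
  open import Data.Integer as ℤ using (ℤ; +_)
  import Data.Integer.Properties as ℤ
  open import Data.Nat
  open import Data.Nat.Properties
  open import Data.Nat.DivMod using (m*n/n≡m; m*n%n≡0)
  open import Data.Nat.Divisibility using (_∣_; m%n≡0⇒n∣m)

  open import Data.Nat.Tactic.RingSolver using (solve-∀)
  open import Data.List using ([]; _∷_; _++_)

  open import Data.Product using (_×_; _,_)
  open import Data.Rational as ℚ using (ℚ; ½; 0ℚ)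
  import Data.Rational.Properties as ℚ
  open import Data.Rational.Solver using (module +-*-Solver)
  open import Data.Sum using (inj₁; inj₂)
  open import Relation.Nullary using (¬_; contradiction)
  open import Relation.Binary.PropositionalEquality hiding (J)

  module RunSpec (n : ℕ) (3≤n : 3 ≤ n) (W : ℕ) (W≡ : W ≡ unitCost n) (e t ℓ : ℕ)
    (t<2^ℓ : t < 2 ^ ℓ) (n<2^2e : n ∸ 2 < 2 ^ (2 * suc e)) (2e<n : suc e + suc e < n) (t<n : t < n)
    (n≡ : n ≡ 2 ^ suc e * t + 1) (0<t : 0 < t) (t<2^e : t < 2 ^ suc e) (t-odd : ¬ 2 ∣ t) where

    e<n : suc e < n
    e<n = ≤-<-trans (m≤m+n (suc e) (suc e)) 2e<n

    open MainSpec n 3≤n W W≡ e t ℓ t<2^ℓ n<2^2e e<n t<n n≡ 0<t t<2^e public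

    private variable
      μ : Memory

    setupCost : ℕ
    setupCost = 6 + ((1 + suc e * (1 + 8)) + 6)

    data SetupPost (ν : Memory) : Set where
      ready : Fixed ν → ν #c ≡ suc e + suc e → ν #a ≡ 0 → SetupPost ν

    setup-spec : Good μ → Det setup μ setupCost SetupPost
    setup-spec {μ} g = seq {p = compile setup-init} (block′ setup-init g) λ { g₁ f₁ refl →
      seq {p = while #f (compile setup-body) ∷ []}
        (loop {p = compile setup-body} #f J g₁ (λ {ν} → stop {ν}) (λ r {ν} g f j _ → block setup-body g (body r {ν} g j)) (suc e) start)
        λ { {ν} g₂ f₂ (f≡0 , r , j) → block setup-final g₂ (finish {ν} g₂ f≡0 r j) } }
      where
      J : ℕ → Memory → Set
      J r ν = ν #e + r ≡ suc e × ν #k ≡ 2 ^ r * t × ν #f ≡ 1 ∸ apply rem (2 ^ r * t) 2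
      even : ∀ r → apply rem (2 ^ suc r * t) 2 ≡ 0
      even r = trans (cong (_% 2) (lemma (2 ^ r) t)) (m*n%n≡0 (2 ^ r * t) 2)
        where
        lemma : ∀ x t → 2 * x * t ≡ x * t * 2
        lemma = solve-∀
      half : ∀ r → apply quo (2 ^ suc r * t) 2 ≡ 2 ^ r * t
      half r = trans (cong (_/ 2) (lemma (2 ^ r) t)) (m*n/n≡m (2 ^ r * t) 2)
        where
        lemma : ∀ x t → 2 * x * t ≡ x * t * 2
        lemma = solve-∀
      start : J (suc e) (exec setup-init μ)
      start = refl , trans (cong₂ _∸_ (cell₀ g) (cell₁ g)) n-1≡ , sym (cong (1 ∸_) (even e))
      stop : ∀ {ν} → J 0 ν → ν #f ≡ 0
      stop {ν} (_ , _ , f≡) = trans f≡ (odd (1 * t) (λ d → t-odd (subst (2 ∣_) (+-identityʳ t) d)))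
        where
        odd : ∀ m → ¬ 2 ∣ m → 1 ∸ m % 2 ≡ 0
        odd m ¬d with m % 2 in eq
        ... | zero  = contradiction (m%n≡0⇒n∣m m 2 eq) ¬d
        ... | suc r = 0∸n≡0 r
      body : ∀ r {ν} → Good ν → J (suc r) ν → J r (exec setup-body ν)
      body r {ν} g (e≡ , k≡ , _) = trans (cong (_+ r) e′) (trans (sym (+-suc (ν #e) r)) e≡) , k′ ,
        cong₂ _∸_ (cell₁ g) (cong₂ (apply rem) k′ (cell₂ g))
        where
        k′ : apply quo (ν #k) (ν 2) ≡ 2 ^ r * t
        k′ = trans (cong₂ (apply quo) k≡ (cell₂ g)) (half r)
        e′ : apply rem (ν #e + ν 1) (ν 0) ≡ suc (ν #e)
        e′ rewrite cell₀ g | cell₁ g = trans (small-rem (≤-<-trans (≤-trans (≤-reflexive (+-comm (ν #e) 1))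
          (≤-trans (s≤s (m≤m+n (ν #e) r)) (≤-reflexive (trans (sym (+-suc (ν #e) r)) e≡)))) e<n)) (+-comm (ν #e) 1)
      finish : ∀ {ν} → Good ν → ν #f ≡ 0 → ∀ r → J r ν → SetupPost (exec setup-final ν)
      finish {ν} g f≡0 (suc r) (_ , _ , f≡) = contradiction (trans (sym f≡0) (trans f≡ (cong (1 ∸_) (even r)))) λ ()
      finish {ν} g f≡0 zero (e≡ , k≡ , _) = ready (fixed e′ t′) c′ refl
        where
        e′ : ν #e ≡ suc e
        e′ = trans (sym (+-identityʳ (ν #e))) e≡
        t′ : apply rem (ν #k + ν 3) (ν 0) ≡ t
        t′ = trans (cong (λ k → apply rem (k + ν 3) (ν 0)) (trans k≡ (+-identityʳ t))) (copy≡ g t<n)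
        c′ : apply rem (ν #e + ν #e) (ν 0) ≡ suc e + suc e
        c′ rewrite cell₀ g | e′ = small-rem 2e<n

    -- Expected cost of m further tosses when x has been sampled so far.
    sampleTime : (ℕ → ℕ) → ℕ → ℕ → ℚ
    sampleTime G zero    x = fromℕ (1 * W) ℚ.+ fromℕ (G x)
    sampleTime G (suc m) x = fromℕ W ℚ.+ (fromℕ W ℚ.+ ½ ℚ.*
      ((fromℕ (6 * W) ℚ.+ sampleTime G m (2 * x)) ℚ.+ (fromℕ (6 * W) ℚ.+ sampleTime G m (2 * x + 1))))

    sampleWorst : ℕ → ℕ → ℕ
    sampleWorst A zero    = 1 * W + A
    sampleWorst A (suc m) = W + (W + (6 * W + sampleWorst A m))

    -- Here x is the integer spelled by the tosses so far, while the program stores only its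
    -- residue. The cost bound `G` depends on the integer, so the average can be taken over an
    -- interval.
    sample-outcome : ∀ {rest P A} (G : ℕ → ℕ) →
      (∀ x {ν} → Good ν → Fixed ν → + ν #a ≈ + x [ n ] → Outcome ⟨ rest , ν ⟩ P A (fromℕ (G x))) →
      ∀ m x {μ} → Good μ → Fixed μ → μ #c ≡ m → + μ #a ≈ + x [ n ] →
      Outcome ⟨ sample ++ rest , μ ⟩ P (sampleWorst A m) (sampleTime G m x)
    sample-outcome G k m x {μ} g fx c≡ a≈ with μ #c in eq
    sample-outcome G k zero x {μ} g fx c≡ a≈ | zero = one 1≤W (k x g fx a≈)
    sample-outcome G k (suc m) x {μ} g fx c≡ a≈ | suc c =
      proceeding (subst (λ v → bits v ≤ W) eq (bits≤W (bound g #c)))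
        (tossing 1≤W
          (block′ sample-update (good-update #f 0 g z≤n) .continue λ { g₁ f₁ refl →
            sample-outcome G k m (2 * x) g₁ (fixed (cell-e fx) (cell-t fx)) (c′ eq) (a′ 0 (2 * x) (good-update #f 0 g z≤n) (+-identityʳ (2 * x))) })
          (block′ sample-update (good-update #f 1 g (≤-trans (s≤s z≤n) 3≤n)) .continue λ { g₁ f₁ refl →
            sample-outcome G k m (2 * x + 1) g₁ (fixed (cell-e fx) (cell-t fx)) (c′ eq) (a′ 1 (2 * x + 1) (good-update #f 1 g (≤-trans (s≤s z≤n) 3≤n)) refl) }))
      where
      c′ : μ #c ≡ suc c → μ #c ∸ μ 1 ≡ m
      c′ eq = trans (cong₂ _∸_ (trans eq c≡) (cell₁ g)) refl
      a′ : ∀ b y → Good (μ [ #f ↦ b ]) → 2 * x + b ≡ y → + exec sample-update (μ [ #f ↦ b ]) #a ≈ + y [ n ]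
      a′ b y g₁ refl = ≈-trans (represents-exec sample-update g₁ #a)
        (≈-trans (+-cong (+-cong a≈ a≈) (≈-refl {+ b})) (≈-reflexive (trans
          (cong (ℤ._+ + b) (trans (sym (ℤ.pos-+ x x)) (cong (λ z → + (x + z)) (sym (+-identityʳ x))))) (sym (ℤ.pos-+ (2 * x) b)))))

    -- The 2 ^ m equally likely completions of the prefix x are the integers from x * 2 ^ m up to,
    -- but excluding, (x + 1) * 2 ^ m. A toss costs 8 units: guard, toss and three statements; the
    -- last guard costs 1.
    sampleTime-total : ∀ G m x → fromℕ (2 ^ m) ℚ.* sampleTime G m x ≡
                       fromℕ (2 ^ m * ((8 * m + 1) * W) + rangeSum G (x * 2 ^ m) (2 ^ m))
    sampleTime-total G zero x = trans (ℚ.*-identityˡ _) (trans (sym (fromℕ-+ (1 * W) (G x)))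
      (cong fromℕ (cong₂ _+_ (sym (*-identityˡ (1 * W))) (trans (cong G (sym (*-identityʳ x))) (sym (+-identityʳ _))))))
    sampleTime-total G (suc m) x = begin
      fromℕ (2 ^ suc m) ℚ.* sampleTime G (suc m) x
        ≡⟨ cong₂ (λ a b → a ℚ.* sampleTime′ b) (fromℕ-* 2 (2 ^ m)) (fromℕ-* 6 W) ⟩
      fromℕ 2 ℚ.* M ℚ.* sampleTime′ (fromℕ 6 ℚ.* w)
        ≡⟨ rational M w E₀ E₁ ⟩
      (fromℕ 16 ℚ.* (M ℚ.* w) ℚ.+ (M ℚ.* E₀ ℚ.+ M ℚ.* E₁))
        ≡⟨ cong₂ (λ a b → fromℕ 16 ℚ.* (M ℚ.* w) ℚ.+ (a ℚ.+ b)) (sampleTime-total G m (2 * x)) (sampleTime-total G m (2 * x + 1)) ⟩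
      (fromℕ 16 ℚ.* (M ℚ.* w) ℚ.+ (fromℕ (c + S₀) ℚ.+ fromℕ (c + S₁)))
        ≡⟨ cong₂ (λ a b → fromℕ 16 ℚ.* a ℚ.+ b) (sym (fromℕ-* (2 ^ m) W)) (sym (fromℕ-+ (c + S₀) (c + S₁))) ⟩
      (fromℕ 16 ℚ.* fromℕ (2 ^ m * W) ℚ.+ fromℕ (c + S₀ + (c + S₁)))
        ≡⟨ cong (ℚ._+ fromℕ (c + S₀ + (c + S₁))) (sym (fromℕ-* 16 (2 ^ m * W))) ⟩
      (fromℕ (16 * (2 ^ m * W)) ℚ.+ fromℕ (c + S₀ + (c + S₁)))
        ≡⟨ sym (fromℕ-+ (16 * (2 ^ m * W)) (c + S₀ + (c + S₁))) ⟩
      fromℕ (16 * (2 ^ m * W) + (c + S₀ + (c + S₁)))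
        ≡⟨ cong fromℕ (trans (lemma (2 ^ m) m W S₀ S₁) (cong (λ s → 2 ^ suc m * ((8 * suc m + 1) * W) + s) sums)) ⟩
      fromℕ (2 ^ suc m * ((8 * suc m + 1) * W) + rangeSum G (x * 2 ^ suc m) (2 ^ suc m)) ∎
      where
      open ≡-Reasoning
      M w E₀ E₁ : ℚ
      M  = fromℕ (2 ^ m)
      w  = fromℕ W
      E₀ = sampleTime G m (2 * x)
      E₁ = sampleTime G m (2 * x + 1)
      sampleTime′ : ℚ → ℚ
      sampleTime′ s = w ℚ.+ (w ℚ.+ ½ ℚ.* ((s ℚ.+ E₀) ℚ.+ (s ℚ.+ E₁)))
      c S₀ S₁ : ℕ
      c  = 2 ^ m * ((8 * m + 1) * W)
      S₀ = rangeSum G (2 * x * 2 ^ m) (2 ^ m)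
      S₁ = rangeSum G ((2 * x + 1) * 2 ^ m) (2 ^ m)
      rational : ∀ M w E₀ E₁ → fromℕ 2 ℚ.* M ℚ.* (w ℚ.+ (w ℚ.+ ½ ℚ.* ((fromℕ 6 ℚ.* w ℚ.+ E₀) ℚ.+ (fromℕ 6 ℚ.* w ℚ.+ E₁))))
                 ≡ fromℕ 16 ℚ.* (M ℚ.* w) ℚ.+ (M ℚ.* E₀ ℚ.+ M ℚ.* E₁)
      rational = solve 4 (λ M w E₀ E₁ → con (fromℕ 2) :* M :* (w :+ (w :+ con ½ :* ((con (fromℕ 6) :* w :+ E₀) :+ (con (fromℕ 6) :* w :+ E₁))))
                 := con (fromℕ 16) :* (M :* w) :+ (M :* E₀ :+ M :* E₁)) refl
        where open +-*-Solver
      lemma : ∀ M m W S₀ S₁ → 16 * (M * W) + (M * ((8 * m + 1) * W) + S₀ + (M * ((8 * m + 1) * W) + S₁)) ≡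
                              2 * M * ((8 * (1 + m) + 1) * W) + (S₀ + S₁)
      lemma = solve-∀
      sums : S₀ + S₁ ≡ rangeSum G (x * 2 ^ suc m) (2 ^ suc m)
      sums = trans (cong₂ (λ a b → rangeSum G a (2 ^ m) + rangeSum G b (2 ^ m)) (lemma₁ x (2 ^ m)) (lemma₂ x (2 ^ m)))
        (trans (sym (rangeSum-split G (x * 2 ^ suc m) (2 ^ m) (2 ^ m))) (cong (rangeSum G (x * 2 ^ suc m)) (cong (λ z → 2 ^ m + z) (sym (+-identityʳ (2 ^ m))))))
        where
        lemma₁ : ∀ x M → 2 * x * M ≡ x * (2 * M)
        lemma₁ = solve-∀
        lemma₂ : ∀ x M → (2 * x + 1) * M ≡ x * (2 * M) + M
        lemma₂ = solve-∀

    start-cong : ∀ {x y} j → x ≈ y [ n ] → Start x j → Start y j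
    start-cong j h (inj₁ s) = inj₁ (≈-trans (≈-sym (*-cong (^-cong t h) (^-cong t h))) (≈-trans s (^-cong t h)))
    start-cong j h (inj₂ s) = inj₂ (≈-trans (≈-sym (^-cong (2 ^ suc j) (^-cong t h))) s)

    sampleWorst≡ : ∀ A m → sampleWorst A m ≡ (8 * m + 1) * W + A
    sampleWorst≡ A zero    = refl
    sampleWorst≡ A (suc m) = trans (cong (λ s → W + (W + (6 * W + s))) (sampleWorst≡ A m)) (lemma W m A)
      where
      lemma : ∀ W m A → W + (W + (6 * W + ((8 * m + 1) * W + A))) ≡ (8 * (1 + m) + 1) * W + A
      lemma = solve-∀

    start-memory : Memory
    start-memory = input n [ #one ↦ 1 ] [ #two ↦ 2 ]

    good-start : Good start-memory
    good-start = good refl refl refl refl below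
      where
      below : ∀ x → start-memory x ≤ n
      below 0 = ≤-refl
      below 1 = ≤-trans (s≤s z≤n) 3≤n
      below 2 = ≤-trans (s≤s (s≤s z≤n)) 3≤n
      below (suc (suc (suc x))) = z≤n

    module _ (f : ℕ) (limit : ∀ {β j} → Level β j → suc j ≤ f)
      (R : ℕ → ℕ) (enough : ∀ x j → Start (+ x) j → f ≤ R x + j)
      (Rmax : ℕ) (R≤ : ∀ x → R x ≤ Rmax) (total : rangeSum R 0 (2 ^ (suc e + suc e)) ≤ 5 * 2 ^ (suc e + suc e)) where

      m : ℕ
      m = suc e + suc e

      G : ℕ → ℕ
      G x = mainCost f limit (R x) * W + 1 * W

      worstUnits expectedUnits : ℕ
      worstUnits    = 2 + (setupCost + (8 * m + 1 + (mainCost f limit Rmax + 1)))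
      expectedUnits = 2 + (setupCost + (8 * m + 1 + (mainCost f limit 5 + 1)))

      final-outcome : ∀ {ν} → Good ν → Answer ν →
        Outcome ⟨ arith add #n #ok #zero ∷ [] , ν ⟩ (CorrectAnswer n) (1 * W + 0) (fromℕ (1 * W) ℚ.+ 0ℚ)
      final-outcome {ν} g a = one (opCost≤W add (≤-trans (bound g #ok) n≤n*n) (≤-trans (bound g #zero) n≤n*n)) (halting (answer a))
        where
        ok≡ : ∀ {v} → ν #ok ≡ v → ν #ok + ν #zero ≡ v
        ok≡ eq = trans (cong (λ z → ν #ok + z) (cell₃ g)) (trans (+-identityʳ (ν #ok)) eq)
        answer : Answer ν → CorrectAnswer n (ν [ #n ↦ ν #ok + ν #zero ])
        answer (inj₁ (ok≡1 , pr)) = inj₁ (ok≡ ok≡1 , pr)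
        answer (inj₂ (ok≡0 , ¬pr)) = inj₂ (ok≡ ok≡0 , ¬pr)

      sampled-outcome : ∀ x {ν} → Good ν → Fixed ν → + ν #a ≈ + x [ n ] →
        Outcome ⟨ main ++ (arith add #n #ok #zero ∷ []) , ν ⟩ (CorrectAnswer n) ((mainCost f limit Rmax + 1) * W) (fromℕ (G x))
      sampled-outcome x {ν} g fx a≈ = weaken worst≤ expected≤
        (main-spec f limit (R x) g fx (λ {j} s → enough x j (start-cong j a≈ s)) .continue λ g′ _ a → final-outcome g′ a)
        where
        worst≤ : mainCost f limit (R x) * W + (1 * W + 0) ≤ (mainCost f limit Rmax + 1) * W
        worst≤ = ≤-trans (+-mono-≤ (*-monoˡ-≤ W (+-monoʳ-≤ levelCost (s≤s (*-monoˡ-≤ (1 + stepCost) (R≤ x))))) (≤-reflexive (+-identityʳ (1 * W))))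
          (≤-reflexive (sym (*-distribʳ-+ W (mainCost f limit Rmax) 1)))
        expected≤ : fromℕ (mainCost f limit (R x) * W) ℚ.+ (fromℕ (1 * W) ℚ.+ 0ℚ) ℚ.≤ fromℕ (G x)
        expected≤ = ℚ.≤-reflexive (trans (cong (fromℕ (mainCost f limit (R x) * W) ℚ.+_) (ℚ.+-identityʳ (fromℕ (1 * W)))) (sym (fromℕ-+ (mainCost f limit (R x) * W) (1 * W))))

      -- `mainCost` is affine in the number of root steps, so averaging it amounts to inserting the
      -- average number, at most 5.
      G-total : rangeSum G 0 (2 ^ m) ≤ 2 ^ m * ((mainCost f limit 5 + 1) * W)
      G-total = begin
        rangeSum G 0 M                                          ≡⟨ rangeSum-cong G G′ (λ x → lemma₁ levelCost (R x) stepCost W) 0 M ⟩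
        rangeSum G′ 0 M                                         ≡⟨ rangeSum-+ (λ _ → (levelCost + 2) * W) (λ x → R x * ((1 + stepCost) * W)) 0 M ⟩
        rangeSum (λ _ → (levelCost + 2) * W) 0 M + rangeSum (λ x → R x * ((1 + stepCost) * W)) 0 M
          ≡⟨ cong₂ _+_ (rangeSum-const ((levelCost + 2) * W) 0 M) (rangeSum-* R ((1 + stepCost) * W) 0 M) ⟩
        M * ((levelCost + 2) * W) + rangeSum R 0 M * ((1 + stepCost) * W)
          ≤⟨ +-monoʳ-≤ (M * ((levelCost + 2) * W)) (*-monoˡ-≤ ((1 + stepCost) * W) total) ⟩
        M * ((levelCost + 2) * W) + 5 * M * ((1 + stepCost) * W) ≡⟨ lemma₂ M levelCost stepCost W ⟩
        M * ((mainCost f limit 5 + 1) * W)                      ∎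
        where
        open ≤-Reasoning
        M : ℕ
        M = 2 ^ m
        G′ : ℕ → ℕ
        G′ x = (levelCost + 2) * W + R x * ((1 + stepCost) * W)
        lemma₁ : ∀ L r S W → (L + (1 + r * (1 + S))) * W + 1 * W ≡ (L + 2) * W + r * ((1 + S) * W)
        lemma₁ = solve-∀
        lemma₂ : ∀ M L S W → M * ((L + 2) * W) + 5 * M * ((1 + S) * W) ≡ M * ((L + (1 + 5 * (1 + S)) + 1) * W)
        lemma₂ = solve-∀

      sampleTime≤ : sampleTime G m 0 ℚ.≤ fromℕ ((8 * m + 1 + (mainCost f limit 5 + 1)) * W)
      sampleTime≤ = ℚ.*-cancelˡ-≤-pos (fromℕ (2 ^ m)) {{positive}} (ℚ.≤-trans (ℚ.≤-reflexive (sampleTime-total G m 0))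
        (ℚ.≤-trans (fromℕ-mono scaled) (ℚ.≤-reflexive (fromℕ-* (2 ^ m) _))))
        where
        positive : ℚ.Positive (fromℕ (2 ^ m))
        positive = ℚ.normalize-pos (2 ^ m) 1 {{_}} {{m^n≢0 2 m}}
        scaled : 2 ^ m * ((8 * m + 1) * W) + rangeSum G 0 (2 ^ m) ≤ 2 ^ m * ((8 * m + 1 + (mainCost f limit 5 + 1)) * W)
        scaled = ≤-trans (+-monoʳ-≤ (2 ^ m * ((8 * m + 1) * W)) G-total)
          (≤-reflexive (lemma (2 ^ m) (8 * m + 1) (mainCost f limit 5 + 1) W))
          where
          lemma : ∀ M a b W → M * (a * W) + M * (b * W) ≡ M * ((a + b) * W)
          lemma = solve-∀

      proth-outcome : Outcome ⟨ proth-test , input n ⟩ (CorrectAnswer n) (worstUnits * W) (fromℕ (expectedUnits * W))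
      proth-outcome = weaken worst≤ expected≤
        (one (bits≤W (≤-trans (s≤s z≤n) 3≤n)) (one (bits≤W (≤-trans (s≤s (s≤s z≤n)) 3≤n))
          (setup-spec good-start .continue λ { g _ (ready fx c≡ a≡) →
            sample-outcome G sampled-outcome m 0 g fx c≡ (≈-reflexive (cong +_ a≡)) })))
        where
        worst≤ : 1 * W + (1 * W + (setupCost * W + sampleWorst ((mainCost f limit Rmax + 1) * W) m)) ≤ worstUnits * W
        worst≤ = ≤-reflexive (trans (cong (λ s → 1 * W + (1 * W + (setupCost * W + s))) (sampleWorst≡ _ m)) (lemma setupCost (8 * m + 1) (mainCost f limit Rmax + 1) W))
          where
          lemma : ∀ s a b W → 1 * W + (1 * W + (s * W + (a * W + b * W))) ≡ (2 + (s + (a + b))) * W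
          lemma = solve-∀
        expected≤ : fromℕ (1 * W) ℚ.+ (fromℕ (1 * W) ℚ.+ (fromℕ (setupCost * W) ℚ.+ sampleTime G m 0)) ℚ.≤ fromℕ (expectedUnits * W)
        expected≤ = ℚ.≤-trans (ℚ.+-monoʳ-≤ (fromℕ (1 * W)) (ℚ.+-monoʳ-≤ (fromℕ (1 * W)) (ℚ.+-monoʳ-≤ (fromℕ (setupCost * W)) sampleTime≤)))
          (ℚ.≤-reflexive (trans (cong (λ q → fromℕ (1 * W) ℚ.+ (fromℕ (1 * W) ℚ.+ q)) (sym (fromℕ-+ (setupCost * W) (b * W))))
            (trans (cong (fromℕ (1 * W) ℚ.+_) (sym (fromℕ-+ (1 * W) (setupCost * W + b * W))))
              (trans (sym (fromℕ-+ (1 * W) _)) (cong fromℕ (lemma setupCost b W))))))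
          where
          b : ℕ
          b = 8 * m + 1 + (mainCost f limit 5 + 1)
          lemma : ∀ s b W → 1 * W + (1 * W + (s * W + b * W)) ≡ (2 + (s + b)) * W
          lemma = solve-∀

-- Asymptotic bounds and the conclusion

open Machine
open Algorithm
open NumberTheory
open Counting
open Sampling
open import Data.Nat
open import Data.Nat.Divisibility using (_∣_; ∣⇒≤; ∣m+n∣m⇒∣n; ∣m⇒∣m*n)
open import Data.Nat.Logarithm using (⌊log₂_⌋; ⌊log₂⌋-mono-≤; ⌊log₂[2*b]⌋≡1+⌊log₂b⌋; ⌊log₂[2^n]⌋≡n)
open import Data.Nat.Primality using (Prime; prime⇒nonTrivial)
open import Data.Nat.Properties
open import Data.Nat.Tactic.RingSolver using (solve-∀)
open import Data.Product using (_×_; _,_; Σ-syntax; ∃-syntax)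
open import Data.Rational as ℚ using (ℚ)
import Data.Rational.Properties as ℚ
open import Relation.Nullary using (¬_; contradiction)
open import Relation.Binary.PropositionalEquality
open Congruence using (p≢1)

n<2^bits : ∀ n → n < 2 ^ bits n
n<2^bits n = ≰⇒> λ le → <⇒≱ (n<1+n ⌊log₂ n ⌋) (subst (_≤ ⌊log₂ n ⌋) (⌊log₂[2^n]⌋≡n (bits n)) (⌊log₂⌋-mono-≤ le))

-- Keeps the toss counter 2E below n, so that computing it modulo n does not change it.
e+e≤2^e : ∀ e → suc e + suc e ≤ 2 ^ suc e
e+e≤2^e zero    = ≤-refl
e+e≤2^e (suc e) = begin
  suc (suc e) + suc (suc e)   ≡⟨ cong suc (+-suc (suc e) (suc e)) ⟩
  2 + (suc e + suc e)         ≤⟨ +-mono-≤ (≤-trans (s≤s (≤-trans (s≤s z≤n) (≤-reflexive (sym (+-suc e e))))) (e+e≤2^e e)) (e+e≤2^e e) ⟩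
  2 ^ suc e + 2 ^ suc e       ≡⟨ cong (λ x → 2 ^ suc e + x) (sym (+-identityʳ _)) ⟩
  2 ^ suc (suc e)             ∎
  where open ≤-Reasoning

-- The coefficients result from expanding the nested costs, with 5 root steps on average and 2E in
-- the worst case; see `expected≡` and `worst≡`.
expectedSteps worstSteps : ℕ → ℕ → ℕ → ℕ
expectedSteps E t λₜ = 868 + 469 * E + 352 * λₜ + 610 * t + 320 * (t * λₜ)
worstSteps E t λₜ    = 83 + 39 * E + 32 * λₜ + 2 * E * (157 + 64 * λₜ + 122 * t + 64 * (t * λₜ) + 86 * E)

-- Every monomial is at most Z, and 2619 is the sum of the coefficients.
expectedSteps≤ : ∀ E t l Z → 1 ≤ Z → E ≤ Z → l ≤ Z → t ≤ Z → t * l ≤ Z → expectedSteps E t l ≤ 2619 * Z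
expectedSteps≤ E t l Z 1≤Z E≤Z l≤Z t≤Z tl≤Z = ≤-trans
  (+-mono-≤ (+-mono-≤ (+-mono-≤ (+-mono-≤ (*-monoʳ-≤ 868 1≤Z) (*-monoʳ-≤ 469 E≤Z)) (*-monoʳ-≤ 352 l≤Z)) (*-monoʳ-≤ 610 t≤Z)) (*-monoʳ-≤ 320 tl≤Z))
  (≤-reflexive (lemma Z))
  where
  lemma : ∀ Z → 868 * Z + 469 * Z + 352 * Z + 610 * Z + 320 * Z ≡ 2619 * Z
  lemma = solve-∀

-- The coefficients outside the product sum to 154, and those in the parentheses to 493. The factor
-- 2 * E is at most 2 * L, and 154 + 2 * 493 = 1140.
worstSteps≤ : ∀ E t l Z L .{{_ : NonZero L}} → 1 ≤ Z → E ≤ Z → E ≤ L → l ≤ Z → t ≤ Z → t * l ≤ Z → worstSteps E t l ≤ 1140 * (Z * L)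
worstSteps≤ E t l Z L 1≤Z E≤Z E≤L l≤Z t≤Z tl≤Z = ≤-trans (+-mono-≤
  (≤-trans (+-mono-≤ (+-mono-≤ (*-monoʳ-≤ 83 1≤Z) (*-monoʳ-≤ 39 E≤Z)) (*-monoʳ-≤ 32 l≤Z))
    (≤-trans (≤-reflexive (lemma₁ Z)) (*-monoʳ-≤ 154 (m≤m*n Z L))))
  (≤-trans (*-mono-≤ {2 * E} {2 * L} (*-monoʳ-≤ 2 E≤L) (+-mono-≤ (+-mono-≤ (+-mono-≤ (+-mono-≤ (*-monoʳ-≤ 157 1≤Z) (*-monoʳ-≤ 64 l≤Z)) (*-monoʳ-≤ 122 t≤Z)) (*-monoʳ-≤ 64 tl≤Z)) (*-monoʳ-≤ 86 E≤Z)))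
    (≤-reflexive (lemma₂ Z L))))
  (≤-reflexive (lemma₃ Z L))
  where
  lemma₁ : ∀ Z → 83 * Z + 39 * Z + 32 * Z ≡ 154 * Z
  lemma₁ = solve-∀
  lemma₂ : ∀ Z L → 2 * L * (157 * Z + 64 * Z + 122 * Z + 64 * Z + 86 * Z) ≡ 986 * (Z * L)
  lemma₂ = solve-∀
  lemma₃ : ∀ Z L → 154 * (Z * L) + 986 * (Z * L) ≡ 1140 * (Z * L)
  lemma₃ = solve-∀

-- Opaque, since conversion would unfold a product with a numeral into a sum
-- with that many summands.
abstract
  expectedConstant worstConstant : ℕ
  expectedConstant  = 2619 * 40
  worstConstant = 1140 * 40

  expectedConstant-def : expectedConstant ≡ 2619 * 40
  expectedConstant-def = refl

  worstConstant-def : worstConstant ≡ 1140 * 40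
  worstConstant-def = refl

multiply-bounds : ∀ {c d C s u z l g} → C ≡ c * d → s ≤ c * z → u ≤ d * (l * g) → s * u ≤ C * (z * l * g ^ 1)
multiply-bounds {c} {d} {z = z} {l} {g} refl s≤ u≤ = ≤-trans (*-mono-≤ s≤ u≤) (≤-reflexive (lemma c d z l g))
  where
  lemma : ∀ c d z l g → c * z * (d * (l * g)) ≡ c * d * (z * l * (g * 1))
  lemma = solve-∀

module Analysis (e t : ℕ) (t-odd : ¬ 2 ∣ t) (0<t : 0 < t) (t<2^e : t < 2 ^ suc e) where

  E n : ℕ
  E = suc e
  n = 2 ^ E * t + 1

  2^E≤n : 2 ^ E ≤ n
  2^E≤n = ≤-trans (m≤m*n (2 ^ E) t {{>-nonZero 0<t}}) (m≤m+n _ 1)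

  2^E*t<n : 2 ^ E * t < n
  2^E*t<n = m<m+n (2 ^ E * t) (s≤s z≤n)

  3≤n : 3 ≤ n
  3≤n = +-monoˡ-≤ 1 (*-mono-≤ (≤-trans (≤-trans (s≤s (s≤s z≤n)) (≤-reflexive (cong suc (sym (+-suc e e)))) ) (e+e≤2^e e)) 0<t)

  2E<n : E + E < n
  2E<n = ≤-<-trans (≤-trans (e+e≤2^e e) (m≤m*n (2 ^ E) t {{>-nonZero 0<t}})) 2^E*t<n

  t<n : t < n
  t<n = ≤-<-trans (m≤n*m t (2 ^ E) {{m^n≢0 2 E}}) 2^E*t<n

  n≤2^2E : n ≤ 2 ^ (E + E)
  n≤2^2E = begin
    2 ^ E * t + 1         ≤⟨ +-monoʳ-≤ (2 ^ E * t) (m^n>0 2 E) ⟩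
    2 ^ E * t + 2 ^ E     ≡⟨ trans (+-comm (2 ^ E * t) (2 ^ E)) (sym (*-suc (2 ^ E) t)) ⟩
    2 ^ E * suc t         ≤⟨ *-monoʳ-≤ (2 ^ E) t<2^e ⟩
    2 ^ E * 2 ^ E         ≡⟨ sym (^-distribˡ-+-* 2 E E) ⟩
    2 ^ (E + E)           ∎
    where open ≤-Reasoning

  n-2< : n ∸ 2 < 2 ^ (2 * E)
  n-2< = <-≤-trans (∸-monoʳ-< {n} {2} {0} (s≤s z≤n) (≤-trans (s≤s (s≤s z≤n)) 3≤n)) (≤-trans n≤2^2E (≤-reflexive (cong (λ x → 2 ^ (E + x)) (sym (+-identityʳ E)))))

  prime-divisor : ∃[ p ] Prime p × p ∣ n
  prime-divisor = primeDivisor n (≤-trans (s≤s (s≤s z≤n)) 3≤n)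

  analyse : ∃[ p ] Prime p × p ∣ n → Outcome ⟨ proth-test , input n ⟩ (CorrectAnswer n)
    (worstSteps E t ⌊log₂ t ⌋ * unitCost n) (fromℕ (expectedSteps E t ⌊log₂ t ⌋ * unitCost n))
  analyse (p , pr , p∣n) = with-valuation (2-adic (p ∸ 1) 0<p-1)
    where
    p∤2 : ¬ p ∣ 2
    p∤2 p∣2 = p≢1 pr (∣m+n∣m⇒∣n p∣n (∣m⇒∣m*n t (∣m⇒∣m*n (2 ^ e) p∣2)))
    0<p-1 : 0 < p ∸ 1
    0<p-1 = m<n⇒0<n∸m (nonTrivial⇒n>1 p {{prime⇒nonTrivial pr}})
    p≤n : p ≤ n
    p≤n = ∣⇒≤ {{>-nonZero (≤-trans (s≤s z≤n) 3≤n)}} p∣n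
    with-valuation : ∃[ f ] ∃[ u ] p ∸ 1 ≡ 2 ^ f * u × ¬ 2 ∣ u → _
    with-valuation (f , u , p-1≡ , u-odd) = weaken (*-monoˡ-≤ (unitCost n) (≤-reflexive (worst≡ E t ⌊log₂ t ⌋)))
      (fromℕ-mono (*-monoˡ-≤ (unitCost n) (≤-reflexive (expected≡ E t ⌊log₂ t ⌋))))
      (proth-outcome f (λ {β} {j} h → limit {_} {j} h) attempts (attempts≥ t-odd) (E + E) (λ x → ≤-trans (attempts≤ x) f<2E)
        (attempts-total (2 ^ (E + E)) (≤-trans p≤n n≤2^2E)))
      where
      open RunSpec n 3≤n (unitCost n) refl e t (bits t) (n<2^bits t) n-2< 2E<n t<n refl 0<t t<2^e t-odd
      open Attempts {n} pr p∤2 p∣n {f} {u} p-1≡ u-odd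
      -- From 2 ^ f ≤ p - 1 < n ≤ 2 ^ (2E); hence `attempts` never exceeds 2E.
      f<2E : f < E + E
      f<2E = ≰⇒> λ 2E≤f → <⇒≱ (<-≤-trans (∸-monoʳ-< {p} {1} {0} (s≤s z≤n) (<⇒≤ (nonTrivial⇒n>1 p {{prime⇒nonTrivial pr}}))) (≤-trans p≤n n≤2^2E))
        (≤-trans (^-monoʳ-≤ 2 2E≤f) (≤-trans (m≤m*n (2 ^ f) u {{≢-nonZero λ u≡0 → <⇒≢ 0<p-1 (sym (trans p-1≡ (trans (cong (2 ^ f *_) u≡0) (*-zeroʳ (2 ^ f)))))}}) (≤-reflexive (sym p-1≡))))
      -- The left side is `worstUnits` for `Rmax` = 2E with all costs written out, so that the
      -- solver sees a polynomial.
      worst≡ : ∀ E t l → 2 + ((6 + ((1 + E * (1 + 8)) + 6)) + (8 * (E + E) + 1 + (((8 + ((5 + (1 + l) * 32) + (12 + ((1 + 6) + (1 + E * (1 + (2 + ((1 + 6) + 4)))))))) + (1 + (E + E) * (1 + ((6 + (1 + (2 + (t + t)) * (1 + (6 + ((5 + (1 + l) * 32) + (10 + (5 + 2))))))) + ((2 + (1 + E * (1 + (8 + (5 + 8))))) + (8 + ((5 + (2 * E) * 32) + (6 + 5)))))))) + 1))) ≡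
        83 + 39 * E + 32 * l + 2 * E * (157 + 64 * l + 122 * t + 64 * (t * l) + 86 * E)
      worst≡ = solve-∀
      expected≡ : ∀ E t l → 2 + ((6 + ((1 + E * (1 + 8)) + 6)) + (8 * (E + E) + 1 + (((8 + ((5 + (1 + l) * 32) + (12 + ((1 + 6) + (1 + E * (1 + (2 + ((1 + 6) + 4)))))))) + (1 + 5 * (1 + ((6 + (1 + (2 + (t + t)) * (1 + (6 + ((5 + (1 + l) * 32) + (10 + (5 + 2))))))) + ((2 + (1 + E * (1 + (8 + (5 + 8))))) + (8 + ((5 + (2 * E) * 32) + (6 + 5)))))))) + 1))) ≡
        868 + 469 * E + 352 * l + 610 * t + 320 * (t * l)
      expected≡ = solve-∀

  outcome-of : Outcome ⟨ proth-test , input n ⟩ (CorrectAnswer n)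
    (worstSteps E t ⌊log₂ t ⌋ * unitCost n) (fromℕ (expectedSteps E t ⌊log₂ t ⌋ * unitCost n))
  outcome-of = analyse prime-divisor

  module _ (4≤n : 4 ≤ n) where

    L l Z : ℕ
    L = ⌊log₂ n ⌋
    l = ⌊log₂ t ⌋
    Z = t * l + L

    2≤L : 2 ≤ L
    2≤L = ⌊log₂⌋-mono-≤ {4} 4≤n

    instance
      L≢0 : NonZero L
      L≢0 = >-nonZero (≤-trans (s≤s z≤n) 2≤L)

    E≤L : E ≤ L
    E≤L = subst (_≤ L) (⌊log₂[2^n]⌋≡n E) (⌊log₂⌋-mono-≤ 2^E≤n)

    L≤Z : L ≤ Z
    L≤Z = m≤n+m L (t * l)

    1≤Z : 1 ≤ Z
    1≤Z = ≤-trans (≤-trans (s≤s z≤n) 2≤L) L≤Z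

    l≤Z : l ≤ Z
    l≤Z = ≤-trans (⌊log₂⌋-mono-≤ (<⇒≤ t<n)) L≤Z

    -- The product t * l bounds t unless the logarithm vanishes, which happens only for t = 1; then
    -- L takes over.
    t≤Z : t ≤ Z
    t≤Z = go t 0<t ≤-refl
      where
      go : ∀ t′ → 0 < t′ → t ≤ t′ → t ≤ Z
      go 1 _ t≤1 = ≤-trans t≤1 1≤Z
      go (suc (suc _)) _ _ with l in eq
      ... | suc l′ = ≤-trans (m≤m*n t (suc l′)) (m≤m+n _ L)
      ... | zero   = ≤-trans (<⇒≤ (<-≤-trans (n<2^bits t) (≤-reflexive (cong (λ l → 2 ^ suc l) eq)))) (≤-trans 2≤L (m≤n+m L _))

    -- Since L ≥ 2, the operands have at most 4L bits each. In 8L * (4 + log L) the 4 is absorbed by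
    -- 4 * log g, as g ≥ 2, so 40 = 8 * 5. This is the only logarithmic loss, hence the exponent 1
    -- in both final bounds.
    unitCost≤ : ∀ {g} → L ≤ g → unitCost n ≤ 40 * (L * ⌊log₂ g ⌋)
    unitCost≤ {g} L≤g = begin
      unitCost n                        ≤⟨ quasilinear-mono (+-mono-≤ bits≤ bits≤) ⟩
      quasilinear (4 * L + 4 * L)       ≡⟨ cong quasilinear (lemma₁ L) ⟩
      8 * L * suc ⌊log₂ 8 * L ⌋         ≡⟨ cong (λ x → 8 * L * suc x) log8L ⟩
      8 * L * (4 + ⌊log₂ L ⌋)           ≤⟨ *-monoʳ-≤ (8 * L) (+-mono-≤ (*-monoʳ-≤ 4 (⌊log₂⌋-mono-≤ (≤-trans 2≤L L≤g))) (⌊log₂⌋-mono-≤ L≤g)) ⟩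
      8 * L * (4 * G + G)               ≡⟨ lemma₂ L G ⟩
      40 * (L * G)                      ∎
      where
      open ≤-Reasoning
      G : ℕ
      G = ⌊log₂ g ⌋
      lemma₁ : ∀ L → 4 * L + 4 * L ≡ 8 * L
      lemma₁ = solve-∀
      lemma₂ : ∀ L G → 8 * L * (4 * G + G) ≡ 40 * (L * G)
      lemma₂ = solve-∀
      lemma₃ : ∀ L → 8 * L ≡ 2 * (2 * (2 * L))
      lemma₃ = solve-∀
      log8L : ⌊log₂ 8 * L ⌋ ≡ 3 + ⌊log₂ L ⌋
      log8L = trans (cong ⌊log₂_⌋ (lemma₃ L)) (trans (⌊log₂[2*b]⌋≡1+⌊log₂b⌋ (2 * (2 * L)) {{m*n≢0 2 (2 * L) {{_}} {{m*n≢0 2 L}}}})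
        (cong suc (trans (⌊log₂[2*b]⌋≡1+⌊log₂b⌋ (2 * L) {{m*n≢0 2 L}}) (cong suc (⌊log₂[2*b]⌋≡1+⌊log₂b⌋ L)))))
      bits≤ : bits (n * n) ≤ 4 * L
      bits≤ = begin
        suc ⌊log₂ n * n ⌋                       ≤⟨ s≤s (⌊log₂⌋-mono-≤ (≤-trans (*-mono-≤ (<⇒≤ (n<2^bits n)) (<⇒≤ (n<2^bits n))) (≤-reflexive (sym (^-distribˡ-+-* 2 (bits n) (bits n)))))) ⟩
        suc ⌊log₂ 2 ^ (bits n + bits n) ⌋       ≡⟨ cong suc (⌊log₂[2^n]⌋≡n (bits n + bits n)) ⟩
        suc (suc L + suc L)                     ≡⟨ lemma₄ L ⟩
        3 + (L + L)                             ≤⟨ +-monoˡ-≤ (L + L) (≤-trans (n≤1+n 3) (+-mono-≤ 2≤L 2≤L)) ⟩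
        L + L + (L + L)                         ≡⟨ lemma₅ L ⟩
        4 * L                                   ∎
        where
        lemma₄ : ∀ L → suc (suc L + suc L) ≡ 3 + (L + L)
        lemma₄ = solve-∀
        lemma₅ : ∀ L → L + L + (L + L) ≡ 4 * L
        lemma₅ = solve-∀

    tl≤Z : t * l ≤ Z
    tl≤Z = m≤m+n (t * l) L

    E≤Z : E ≤ Z
    E≤Z = ≤-trans E≤L L≤Z

    expected-bound : expectedSteps E t l * unitCost n ≤ expectedConstant * (Z * L * ⌊log₂ Z * L ⌋ ^ 1)
    expected-bound = multiply-bounds {2619} {40} {expectedConstant} {expectedSteps E t l} {unitCost n} {Z} {L} {⌊log₂ Z * L ⌋} expectedConstant-def
      (expectedSteps≤ E t l Z 1≤Z E≤Z l≤Z t≤Z tl≤Z) (unitCost≤ {Z * L} (≤-trans L≤Z (m≤m*n Z L)))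

    worst-bound : worstSteps E t l * unitCost n ≤ worstConstant * (Z * L ^ 2 * ⌊log₂ Z * L ^ 2 ⌋ ^ 1)
    worst-bound = ≤-trans
      (multiply-bounds {1140} {40} {worstConstant} {worstSteps E t l} {unitCost n} {Z * L} {L} {⌊log₂ Z * L ^ 2 ⌋} worstConstant-def
        (worstSteps≤ E t l Z L 1≤Z E≤Z E≤L l≤Z t≤Z tl≤Z) (unitCost≤ {Z * L ^ 2} (≤-trans L≤Z (m≤m*n Z (L ^ 2) {{m^n≢0 L 2}}))))
      (≤-reflexive (cong (λ x → worstConstant * (x * ⌊log₂ Z * L ^ 2 ⌋ ^ 1)) (lemma Z L)))
      where
      lemma : ∀ Z L → Z * L * L ≡ Z * (L * (L * 1))
      lemma = solve-∀

  expected-time : (4≤n : 4 ≤ n) → expectedTime (Outcome′.run outcome-of) ℚ.≤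
    fromℕ (expectedConstant * ((t * ⌊log₂ t ⌋ + ⌊log₂ n ⌋) * ⌊log₂ n ⌋ * ⌊log₂ (t * ⌊log₂ t ⌋ + ⌊log₂ n ⌋) * ⌊log₂ n ⌋ ⌋ ^ 1))
  expected-time 4≤n = ℚ.≤-trans (Outcome′.expected outcome-of) (fromℕ-mono
    {expectedSteps E t ⌊log₂ t ⌋ * unitCost n} {expectedConstant * (Z 4≤n * L 4≤n * ⌊log₂ Z 4≤n * L 4≤n ⌋ ^ 1)} (expected-bound 4≤n))

  worst-time : (4≤n : 4 ≤ n) → worstTime (Outcome′.run outcome-of) ≤
    worstConstant * ((t * ⌊log₂ t ⌋ + ⌊log₂ n ⌋) * ⌊log₂ n ⌋ ^ 2 * ⌊log₂ (t * ⌊log₂ t ⌋ + ⌊log₂ n ⌋) * ⌊log₂ n ⌋ ^ 2 ⌋ ^ 1)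
  worst-time 4≤n = ≤-trans (Outcome′.worst outcome-of) (worst-bound 4≤n)

record Verdict (N : ProthNumber) : Set where
  field
    run      : Execution proth-test (value N)
    correct  : AllOutcomes (CorrectAnswer (value N)) run
    expected : 4 ≤ value N → expectedTime run ℚ.≤ fromℕ (expectedConstant * (expectedBound N * ⌊log₂ expectedBound N ⌋ ^ 1))
    worst    : 4 ≤ value N → worstTime run ≤ worstConstant * (worstBound N * ⌊log₂ worstBound N ⌋ ^ 1)

verdict : ∀ N → Verdict N
verdict record { e = zero ; t = t ; t-odd = t-odd ; 0<t = 0<t ; t<2^e = s≤s t≤0 } = contradiction t≤0 (<⇒≱ 0<t)
verdict record { e = suc e ; t = t ; t-odd = t-odd ; 0<t = 0<t ; t<2^e = t<2^e } = record
  { run      = Outcome′.run outcome-of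
  ; correct  = Outcome′.correct outcome-of
  ; expected = λ 4≤n → expected-time 4≤n
  ; worst    = λ 4≤n → worst-time 4≤n
  }
  where open Analysis e t t-odd 0<t t<2^e

theorem1p5 : Σ[ p ∈ Program ] Σ[ run ∈ ((N : ProthNumber) → Execution p (value N)) ]
    ( ((N : ProthNumber) → AllOutcomes (CorrectAnswer (value N)) (run N))
    × (λ N → expectedTime (run N)) ∈Õ expectedBound
    × (λ N → fromℕ (worstTime (run N))) ∈Õ worstBound )
theorem1p5 = proth-test , (λ N → Verdict.run (verdict N)) , (λ N → Verdict.correct (verdict N)) ,
  -- The threshold 4 excludes only N = 3, where the bounding function is 1 and its logarithm 0.
  (1 , expectedConstant , 4 , λ N → Verdict.expected (verdict N)) ,
  (1 , worstConstant , 4 , λ N 4≤ → fromℕ-mono (Verdict.worst (verdict N) 4≤))
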